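{- There exists an absolute constant $c>0$ such that the following holds. Let $r$ be a positive integer and let $M\in\{0,1\}^{m\times n}$ with $\operatorname{rank}(M)\leq r$. Let $p=\frac{|M|}{mn}$ and suppose $p\leq 1/2$. Then $$\operatorname{disc}(M)\geq c\,mn\cdot\min\left\{p,\frac{p^{1/2}}{\sqrt{r}}\right\}.$$
   Context: For a binary matrix $M\in\{0,1\}^{m\times n}$, $|M|$ denotes the number of $1$ entries of $M$, and for $X\subset[m]$, $Y\subset[n]$, $M[X\times Y]$ is the submatrix with rows $X$ and columns $Y$. With $p=|M|/(mn)$, the discrepancy is $\operatorname{disc}(M)=\max_{X\subset[m],Y\subset[n]}\big||M[X\times Y]|-p|X||Y|\big|$. -}

module Defs where

import Algebra.Properties.CommutativeMonoid.Sum as Sum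
open import Data.Bool.Base using (Bool; true; false; if_then_else_; _∧_)
open import Data.Fin.Base using (Fin)
open import Data.Fin.Subset as Subset using (Subset; inside; outside)
open import Data.Integer.Base using (+_)
import Data.Integer.Base as ℤ
import Data.Integer.Properties as ℤ
open import Data.List.Base using (List; []; _∷_; _++_; map; cartesianProduct)
import Data.List.Extrema as Extrema
open import Data.Nat.Base as ℕ using (ℕ; zero; suc; NonZero)
open import Data.Nat.Coprimality as Coprime using (1-coprimeTo)
import Data.Nat.Properties as ℕ
open import Data.Product.Base using (∃-syntax; _×_; _,_; proj₁; proj₂)
open import Data.Rational.Base using
  ( ℚ; mkℚ; 0ℚ; 1ℚ; ½; _+_; _*_; _-_; -_; _⊓_; _⊔_; ∣_∣; _≤_; _<_; _/_; 1/_
  ; Positive; positive; nonNegative; ≢-nonZero; *≤*)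
open import Data.Rational.Properties
open import Data.Rational.Solver using (module +-*-Solver)
open import Data.Sum.Base using (inj₁; inj₂)
open import Data.Vec.Base using ([]; _∷_; lookup)
open import Data.Vec.Functional using (Vector)
open import Relation.Binary.PropositionalEquality
  using (_≡_; _≢_; refl; sym; trans; cong; cong₂; subst; module ≡-Reasoning)
open import Relation.Binary.Bundles using (DecTotalOrder)
open import Relation.Nullary using (yes; no; contradiction)
open import Relation.Nullary.Decidable using (⌊_⌋)

open +-*-Solver using (solve; _:=_; _:+_; _:*_; _:-_; :-_; con)

private
  variable
    m n k : ℕ

------------------------------------------------------------------------
-- Real numbers, as Cauchy sequences of rationals

Cauchy : (ℕ → ℚ) → Set
Cauchy x = ∀ ε → 0ℚ < ε →
  ∃[ N ] (∀ i j → N ℕ.≤ i → N ℕ.≤ j → ∣ x i - x j ∣ ≤ ε)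

record ℝ : Set where
  constructor mkℝ
  field
    seq    : ℕ → ℚ
    cauchy : Cauchy seq

open ℝ public

infix 4 _≤ℝ_ _<ℝ_

_≤ℝ_ : ℝ → ℝ → Set
x ≤ℝ y = ∀ ε → 0ℚ < ε → ∃[ N ] (∀ i → N ℕ.≤ i → seq x i ≤ seq y i + ε)

_<ℝ_ : ℝ → ℝ → Set
x <ℝ y = ∃[ ε ] (0ℚ < ε × ∃[ N ] (∀ i → N ℕ.≤ i → seq x i + ε ≤ seq y i))

private

  p-p≤ : ∀ p {ε} → 0ℚ < ε → ∣ p - p ∣ ≤ ε
  p-p≤ p 0<ε = subst (_≤ _) (sym (cong ∣_∣ (+-inverseʳ p))) (<⇒≤ 0<ε)

fromℚ : ℚ → ℝ
fromℚ q = mkℝ (λ _ → q) (λ ε 0<ε → 0 , λ _ _ _ _ → p-p≤ q 0<ε)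

fromℕ : ℕ → ℚ
fromℕ n = + n / 1

0ℝ : ℝ
0ℝ = fromℚ 0ℚ

private

  ⊔≤ˡ : ∀ m n {i} → m ℕ.⊔ n ℕ.≤ i → m ℕ.≤ i
  ⊔≤ˡ m n = ℕ.≤-trans (ℕ.m≤m⊔n m n)

  ⊔≤ʳ : ∀ m n {i} → m ℕ.⊔ n ℕ.≤ i → n ℕ.≤ i
  ⊔≤ʳ m n = ℕ.≤-trans (ℕ.m≤n⊔m m n)

  a-b≤c⇒a≤b+c : ∀ {a b c} → a - b ≤ c → a ≤ b + c
  a-b≤c⇒a≤b+c {a} {b} {c} h = subst (_≤ b + c)
    (solve 2 (λ a b → b :+ (a :- b) := a) refl a b) (+-monoʳ-≤ b h)

  a≤b+c⇒a-b≤c : ∀ {a b c} → a ≤ b + c → a - b ≤ c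
  a≤b+c⇒a-b≤c {a} {b} {c} h = subst (a - b ≤_)
    (solve 2 (λ b c → (b :+ c) :- b := c) refl b c) (+-monoˡ-≤ (- b) h)

  p≤∣p∣ : ∀ p → p ≤ ∣ p ∣
  p≤∣p∣ p with ≤-total 0ℚ p
  ... | inj₁ 0≤p = ≤-reflexive (sym (0≤p⇒∣p∣≡p 0≤p))
  ... | inj₂ p≤0 = ≤-trans p≤0 (0≤∣p∣ p)

  ∣a-b∣≡∣b-a∣ : ∀ a b → ∣ a - b ∣ ≡ ∣ b - a ∣
  ∣a-b∣≡∣b-a∣ a b = trans
    (cong ∣_∣ (solve 2 (λ a b → a :- b := :- (b :- a)) refl a b)) (∣-p∣≡∣p∣ (b - a))

  dist⇒≤ : ∀ {a b ε} → ∣ a - b ∣ ≤ ε → a ≤ b + ε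
  dist⇒≤ {a} {b} h = a-b≤c⇒a≤b+c (≤-trans (p≤∣p∣ (a - b)) h)

  ≤⇒dist : ∀ {a b ε} → a ≤ b + ε → b ≤ a + ε → ∣ a - b ∣ ≤ ε
  ≤⇒dist {a} {b} {ε} a≤ b≤ with ∣p∣≡p∨∣p∣≡-p (a - b)
  ... | inj₁ eq = subst (_≤ ε) (sym eq) (a≤b+c⇒a-b≤c a≤)
  ... | inj₂ eq = subst (_≤ ε)
    (sym (trans eq (solve 2 (λ a b → :- (a :- b) := b :- a) refl a b)))
    (a≤b+c⇒a-b≤c b≤)

  ⊓-shift : ∀ {a b c d ε} → a ≤ c + ε → b ≤ d + ε → a ⊓ b ≤ (c ⊓ d) + ε
  ⊓-shift {a} {b} {c} {d} a≤ b≤ with ≤-total c d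
  ... | inj₁ c≤d rewrite p≤q⇒p⊓q≡p c≤d = ≤-trans (p⊓q≤p a b) a≤
  ... | inj₂ d≤c rewrite p≥q⇒p⊓q≡q d≤c = ≤-trans (p⊓q≤q a b) b≤

  ⊓-close : ∀ a b c d {ε} → ∣ a - c ∣ ≤ ε → ∣ b - d ∣ ≤ ε →
            ∣ (a ⊓ b) - (c ⊓ d) ∣ ≤ ε
  ⊓-close a b c d {ε} ac bd = ≤⇒dist {a ⊓ b} {c ⊓ d}
    (⊓-shift {a} {b} {c} {d} (dist⇒≤ {a} {c} ac) (dist⇒≤ {b} {d} bd))
    (⊓-shift {c} {d} {a} {b}
      (dist⇒≤ {c} {a} (subst (_≤ ε) (∣a-b∣≡∣b-a∣ a c) ac))
      (dist⇒≤ {d} {b} (subst (_≤ ε) (∣a-b∣≡∣b-a∣ b d) bd)))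

infixl 7 _⊓ℝ_

_⊓ℝ_ : ℝ → ℝ → ℝ
x ⊓ℝ y = mkℝ (λ i → seq x i ⊓ seq y i) is-cauchy
  where
  is-cauchy : Cauchy (λ i → seq x i ⊓ seq y i)
  is-cauchy ε 0<ε =
    let N₁ , h₁ = cauchy x ε 0<ε
        N₂ , h₂ = cauchy y ε 0<ε
    in N₁ ℕ.⊔ N₂ , λ i j N≤i N≤j →
      ⊓-close (seq x i) (seq y i) (seq x j) (seq y j)
        (h₁ i j (⊔≤ˡ N₁ N₂ N≤i) (⊔≤ˡ N₁ N₂ N≤j))
        (h₂ i j (⊔≤ʳ N₁ N₂ N≤i) (⊔≤ʳ N₁ N₂ N≤j))

-- The reciprocal on ℚ, with 0 sent to 0.
inv : ℚ → ℚ
inv q with q ≟ 0ℚ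
... | yes _  = 0ℚ
... | no q≢0 = (1/ q) {{≢-nonZero q≢0}}

private

  0<⇒≢0 : ∀ {q} → 0ℚ < q → q ≢ 0ℚ
  0<⇒≢0 0<q refl = <-irrefl refl 0<q

  *-inv : ∀ {q} → 0ℚ < q → q * inv q ≡ 1ℚ
  *-inv {q} 0<q with q ≟ 0ℚ
  ... | yes q≡0 = contradiction q≡0 (0<⇒≢0 0<q)
  ... | no q≢0  = *-inverseʳ q {{≢-nonZero q≢0}}

  inv-pos : ∀ {q} → 0ℚ < q → 0ℚ < inv q
  inv-pos {q} 0<q with q ≟ 0ℚ
  ... | yes q≡0 = contradiction q≡0 (0<⇒≢0 0<q)
  ... | no q≢0  = positive⁻¹ _ {{1/pos⇒pos q {{positive 0<q}}}}

  *-pos : ∀ {p q} → 0ℚ < p → 0ℚ < q → 0ℚ < p * q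
  *-pos {p} {q} 0<p 0<q =
    subst (_< p * q) (*-zeroʳ p) (*-monoʳ-<-pos p {{positive 0<p}} 0<q)

  *-mono : ∀ {a b c d} → 0ℚ ≤ a → 0ℚ ≤ d → a ≤ b → c ≤ d → a * c ≤ b * d
  *-mono {a} {b} {c} {d} 0≤a 0≤d a≤b c≤d = ≤-trans
    (*-monoˡ-≤-nonNeg a {{nonNegative 0≤a}} c≤d)
    (*-monoʳ-≤-nonNeg d {{nonNegative 0≤d}} a≤b)

  ε*½+ε*½ : ∀ ε → ε * ½ + ε * ½ ≡ ε
  ε*½+ε*½ ε = trans (sym (*-distribˡ-+ ε ½ ½)) (*-identityʳ ε)

  *-swap-inv : ∀ {b} e → 0ℚ < b → b * (e * inv b) ≡ e
  *-swap-inv {b} e 0<b = begin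
    b * (e * inv b) ≡⟨ solve 3 (λ b e i → b :* (e :* i) := (b :* i) :* e) refl b e (inv b) ⟩
    (b * inv b) * e ≡⟨ cong (_* e) (*-inv 0<b) ⟩
    1ℚ * e          ≡⟨ *-identityˡ e ⟩
    e               ∎ where open ≡-Reasoning

  bounded : ∀ x → ∃[ B ] (0ℚ < B × ∃[ N ] (∀ i → N ℕ.≤ i → ∣ seq x i ∣ ≤ B))
  bounded x with cauchy x 1ℚ (positive⁻¹ 1ℚ)
  ... | N , h = ∣ seq x N ∣ + 1ℚ ,
    ≤-<-trans (0≤∣p∣ (seq x N)) (subst (_< ∣ seq x N ∣ + 1ℚ) (+-identityʳ _)
      (+-monoʳ-< ∣ seq x N ∣ (positive⁻¹ 1ℚ))) ,
    N , λ i N≤i → ≤-trans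
      (≤-reflexive (cong ∣_∣ (solve 2 (λ a b → a := b :+ (a :- b)) refl (seq x i) (seq x N))))
      (≤-trans (∣p+q∣≤∣p∣+∣q∣ (seq x N) (seq x i - seq x N))
        (+-monoʳ-≤ ∣ seq x N ∣ (h i N N≤i ℕ.≤-refl)))

  *-dist : ∀ a b c d → ∣ a * b - c * d ∣ ≤ ∣ a ∣ * ∣ b - d ∣ + ∣ d ∣ * ∣ a - c ∣
  *-dist a b c d = begin
    ∣ a * b - c * d ∣
      ≡⟨ cong ∣_∣ (solve 4 (λ a b c d → a :* b :- c :* d
           := a :* (b :- d) :+ d :* (a :- c)) refl a b c d) ⟩
    ∣ a * (b - d) + d * (a - c) ∣
      ≤⟨ ∣p+q∣≤∣p∣+∣q∣ (a * (b - d)) (d * (a - c)) ⟩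
    ∣ a * (b - d) ∣ + ∣ d * (a - c) ∣
      ≡⟨ cong₂ _+_ (∣p*q∣≡∣p∣*∣q∣ a (b - d)) (∣p*q∣≡∣p∣*∣q∣ d (a - c)) ⟩
    ∣ a ∣ * ∣ b - d ∣ + ∣ d ∣ * ∣ a - c ∣ ∎
    where open ≤-Reasoning

  0<half : ∀ {ε} → 0ℚ < ε → 0ℚ < ε * ½
  0<half 0<ε = *-pos 0<ε (positive⁻¹ ½)

  *-close : ∀ a b c d {A B ε} → 0ℚ < A → 0ℚ < B → 0ℚ < ε →
            ∣ a ∣ ≤ A → ∣ d ∣ ≤ B →
            ∣ a - c ∣ ≤ ε * ½ * inv B → ∣ b - d ∣ ≤ ε * ½ * inv A →
            ∣ a * b - c * d ∣ ≤ ε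
  *-close a b c d {A} {B} {ε} 0<A 0<B 0<ε a≤A d≤B ac bd = begin
    ∣ a * b - c * d ∣                         ≤⟨ *-dist a b c d ⟩
    ∣ a ∣ * ∣ b - d ∣ + ∣ d ∣ * ∣ a - c ∣     ≤⟨ +-mono-≤
      (*-mono {∣ a ∣} {A} {∣ b - d ∣} {ε * ½ * inv A} (0≤∣p∣ a) (<⇒≤ (*-pos (0<half 0<ε) (inv-pos 0<A))) a≤A bd)
      (*-mono {∣ d ∣} {B} {∣ a - c ∣} {ε * ½ * inv B} (0≤∣p∣ d) (<⇒≤ (*-pos (0<half 0<ε) (inv-pos 0<B))) d≤B ac) ⟩
    A * (ε * ½ * inv A) + B * (ε * ½ * inv B) ≡⟨ cong₂ _+_ (*-swap-inv (ε * ½) 0<A) (*-swap-inv (ε * ½) 0<B) ⟩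
    ε * ½ + ε * ½                             ≡⟨ ε*½+ε*½ ε ⟩
    ε                                         ∎
    where open ≤-Reasoning

infixl 7 _*ℝ_

_*ℝ_ : ℝ → ℝ → ℝ
x *ℝ y = mkℝ (λ i → seq x i * seq y i) is-cauchy
  where
  is-cauchy : Cauchy (λ i → seq x i * seq y i)
  is-cauchy ε 0<ε =
    let A , 0<A , N₁ , hA = bounded x
        B , 0<B , N₂ , hB = bounded y
        N₃ , hx = cauchy x (ε * ½ * inv B) (*-pos (0<half 0<ε) (inv-pos 0<B))
        N₄ , hy = cauchy y (ε * ½ * inv A) (*-pos (0<half 0<ε) (inv-pos 0<A))
        ≤₁₂ : ∀ {i} → (N₁ ℕ.⊔ N₂) ℕ.⊔ (N₃ ℕ.⊔ N₄) ℕ.≤ i → N₁ ℕ.⊔ N₂ ℕ.≤ i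
        ≤₁₂ = ⊔≤ˡ (N₁ ℕ.⊔ N₂) (N₃ ℕ.⊔ N₄)
        ≤₃₄ : ∀ {i} → (N₁ ℕ.⊔ N₂) ℕ.⊔ (N₃ ℕ.⊔ N₄) ℕ.≤ i → N₃ ℕ.⊔ N₄ ℕ.≤ i
        ≤₃₄ = ⊔≤ʳ (N₁ ℕ.⊔ N₂) (N₃ ℕ.⊔ N₄)
    in (N₁ ℕ.⊔ N₂) ℕ.⊔ (N₃ ℕ.⊔ N₄) , λ i j N≤i N≤j →
      *-close (seq x i) (seq y i) (seq x j) (seq y j) 0<A 0<B 0<ε
        (hA i (⊔≤ˡ N₁ N₂ (≤₁₂ N≤i)))
        (hB j (⊔≤ʳ N₁ N₂ (≤₁₂ N≤j)))
        (hx i j (⊔≤ˡ N₃ N₄ (≤₃₄ N≤i)) (⊔≤ˡ N₃ N₄ (≤₃₄ N≤j)))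
        (hy i j (⊔≤ʳ N₃ N₄ (≤₃₄ N≤i)) (⊔≤ʳ N₃ N₄ (≤₃₄ N≤j)))

private

  inv-dist : ∀ {a b δ} → 0ℚ < δ → δ ≤ a → δ ≤ b →
             ∣ inv a - inv b ∣ ≤ (inv δ * inv δ) * ∣ a - b ∣
  inv-dist {a} {b} {δ} 0<δ δ≤a δ≤b = begin
    ∣ inv a - inv b ∣
      ≡⟨ cong ∣_∣ (cong₂ _-_ (one-b (inv a)) (one-a (inv b))) ⟩
    ∣ (b * inv b) * inv a - (a * inv a) * inv b ∣
      ≡⟨ cong ∣_∣ (solve 4 (λ a b i j → (b :* j) :* i :- (a :* i) :* j
           := (i :* j) :* (b :- a)) refl a b (inv a) (inv b)) ⟩
    ∣ (inv a * inv b) * (b - a) ∣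
      ≡⟨ ∣p*q∣≡∣p∣*∣q∣ (inv a * inv b) (b - a) ⟩
    ∣ inv a * inv b ∣ * ∣ b - a ∣
      ≡⟨ cong₂ _*_ (0≤p⇒∣p∣≡p (<⇒≤ (*-pos 0<ia 0<ib))) (∣a-b∣≡∣b-a∣ b a) ⟩
    (inv a * inv b) * ∣ a - b ∣
      ≤⟨ *-monoʳ-≤-nonNeg ∣ a - b ∣ {{nonNegative (0≤∣p∣ (a - b))}}
           (*-mono (<⇒≤ 0<ia) (<⇒≤ (inv-pos 0<δ)) (inv-anti 0<a δ≤a) (inv-anti 0<b δ≤b)) ⟩
    (inv δ * inv δ) * ∣ a - b ∣ ∎
    where
    open ≤-Reasoning
    0<a = <-≤-trans 0<δ δ≤a
    0<b = <-≤-trans 0<δ δ≤b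
    0<ia = inv-pos 0<a
    0<ib = inv-pos 0<b
    one-a : ∀ q → q ≡ (a * inv a) * q
    one-a q = sym (trans (cong (_* q) (*-inv 0<a)) (*-identityˡ q))
    one-b : ∀ q → q ≡ (b * inv b) * q
    one-b q = sym (trans (cong (_* q) (*-inv 0<b)) (*-identityˡ q))
    inv-anti : ∀ {c} → 0ℚ < c → δ ≤ c → inv c ≤ inv δ
    inv-anti {c} 0<c δ≤c = begin
      inv c               ≡⟨ sym (*-swap-inv (inv c) 0<δ) ⟩
      δ * (inv c * inv δ) ≤⟨ *-monoʳ-≤-nonNeg (inv c * inv δ)
                               {{nonNegative (<⇒≤ (*-pos (inv-pos 0<c) (inv-pos 0<δ)))}} δ≤c ⟩
      c * (inv c * inv δ) ≡⟨ cong (c *_) (*-comm (inv c) (inv δ)) ⟩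
      c * (inv δ * inv c) ≡⟨ *-swap-inv (inv δ) 0<c ⟩
      inv δ               ∎

infix 8 _⁻¹[_]

_⁻¹[_] : (x : ℝ) → 0ℝ <ℝ x → ℝ
x ⁻¹[ δ , 0<δ , N , x≥δ ] = mkℝ (λ i → inv (seq x i)) is-cauchy
  where
  K : ℚ
  K = inv δ * inv δ
  0<K : 0ℚ < K
  0<K = *-pos (inv-pos 0<δ) (inv-pos 0<δ)
  δ≤ : ∀ i → N ℕ.≤ i → δ ≤ seq x i
  δ≤ i N≤i = subst (_≤ seq x i) (+-identityˡ δ) (x≥δ i N≤i)
  is-cauchy : Cauchy (λ i → inv (seq x i))
  is-cauchy ε 0<ε with cauchy x (ε * inv K) (*-pos 0<ε (inv-pos 0<K))
  ... | N′ , h = N ℕ.⊔ N′ , λ i j N≤i N≤j →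
    ≤-trans
      (inv-dist 0<δ (δ≤ i (⊔≤ˡ N N′ N≤i)) (δ≤ j (⊔≤ˡ N N′ N≤j)))
      (≤-trans
        (*-monoˡ-≤-nonNeg K {{nonNegative (<⇒≤ 0<K)}}
          (h i j (⊔≤ʳ N N′ N≤i) (⊔≤ʳ N N′ N≤j)))
        (≤-reflexive (*-swap-inv ε 0<K)))

infix 7 _÷_[_]

_÷_[_] : ℝ → (y : ℝ) → 0ℝ <ℝ y → ℝ
x ÷ y [ 0<y ] = x *ℝ y ⁻¹[ 0<y ]

------------------------------------------------------------------------
-- Square roots of rationals, by bisection

bisect : ℚ → ℚ × ℚ → ℚ × ℚ
bisect q (lo , hi) =
  let mid = (lo + hi) * ½
  in if ⌊ mid * mid ≤? q ⌋ then (mid , hi) else (lo , mid)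

bracket : ℚ → ℕ → ℚ × ℚ
bracket q zero    = 0ℚ ⊔ (1ℚ ⊓ q) , 1ℚ ⊔ q
bracket q (suc i) = bisect q (bracket q i)

bracket-sound : ∀ {q} → 0ℚ ≤ q → ∀ i →
                let (lo , hi) = bracket q i in lo * lo ≤ q × q ≤ hi * hi
bracket-sound {q} 0≤q zero with ≤-total 1ℚ q
... | inj₁ 1≤q rewrite p≤q⇒p⊓q≡p 1≤q | p≤q⇒p⊔q≡q 1≤q =
  1≤q , subst (_≤ q * q) (*-identityʳ q) (*-monoˡ-≤-nonNeg q {{nonNegative 0≤q}} 1≤q)
... | inj₂ q≤1 rewrite p≥q⇒p⊓q≡q q≤1 | p≥q⇒p⊔q≡p q≤1 | p≤q⇒p⊔q≡q 0≤q =
  subst (q * q ≤_) (*-identityʳ q) (*-monoˡ-≤-nonNeg q {{nonNegative 0≤q}} q≤1) , q≤1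
bracket-sound {q} 0≤q (suc i) with bracket q i | bracket-sound 0≤q i
... | lo , hi | lo²≤q , q≤hi² with ((lo + hi) * ½) * ((lo + hi) * ½) ≤? q
...   | yes mid²≤q = mid²≤q , q≤hi²
...   | no  mid²≰q = lo²≤q , <⇒≤ (≰⇒> mid²≰q)

private

  fromℕ≡mkℚ : ∀ n → fromℕ n ≡ mkℚ (+ n) 0 (Coprime.sym (1-coprimeTo n))
  fromℕ≡mkℚ n = normalize-coprime (Coprime.sym (1-coprimeTo n))

  fromℕ-+ : ∀ m n → fromℕ (m ℕ.+ n) ≡ fromℕ m + fromℕ n
  fromℕ-+ m n = sym (trans (cong₂ _+_ (fromℕ≡mkℚ m) (fromℕ≡mkℚ n))
    (cong (_/ 1) (cong₂ ℤ._+_ (ℤ.*-identityʳ (+ m)) (ℤ.*-identityʳ (+ n)))))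

  fromℕ-mono : m ℕ.≤ n → fromℕ m ≤ fromℕ n
  fromℕ-mono {m} {n} m≤n rewrite fromℕ≡mkℚ m | fromℕ≡mkℚ n =
    *≤* (ℤ.*-monoʳ-≤-nonNeg (+ 1) (ℤ.+≤+ m≤n))

  archimedean : ∀ p → ∃[ N ] p ≤ fromℕ (suc N)
  archimedean p@(mkℚ z d-1 _) = ℤ.∣ z ∣ ,
    subst (p ≤_) (sym (fromℕ≡mkℚ (suc ℤ.∣ z ∣))) (*≤* (begin
      z ℤ.* + 1                       ≡⟨ ℤ.*-identityʳ z ⟩
      z                               ≤⟨ i≤+∣i∣ z ⟩
      + ℤ.∣ z ∣                       ≤⟨ ℤ.+≤+ (ℕ.≤-trans (ℕ.n≤1+n ℤ.∣ z ∣)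
                                           (ℕ.m≤m*n (suc ℤ.∣ z ∣) (suc d-1))) ⟩
      + suc ℤ.∣ z ∣ ℤ.* + suc d-1     ∎))
    where
    open ℤ.≤-Reasoning
    i≤+∣i∣ : ∀ i → i ℤ.≤ + ℤ.∣ i ∣
    i≤+∣i∣ (+ n)      = ℤ.≤-refl
    i≤+∣i∣ ℤ.-[1+ n ] = ℤ.-≤+

  module Bisection (q : ℚ) where

    lo hi wd : ℕ → ℚ
    lo i = proj₁ (bracket q i)
    hi i = proj₂ (bracket q i)
    wd i = hi i - lo i

    mid-lo : ∀ a b → (a + b) * ½ - a ≡ (b - a) * ½
    mid-lo a b = begin
      (a + b) * ½ - a               ≡⟨ cong (λ z → (a + b) * ½ - z) (sym (ε*½+ε*½ a)) ⟩
      (a + b) * ½ - (a * ½ + a * ½) ≡⟨ solve 3 (λ a b h → (a :+ b) :* h :- (a :* h :+ a :* h)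
                                         := (b :- a) :* h) refl a b ½ ⟩
      (b - a) * ½                   ∎ where open ≡-Reasoning

    hi-mid : ∀ a b → b - (a + b) * ½ ≡ (b - a) * ½
    hi-mid a b = begin
      b - (a + b) * ½               ≡⟨ cong (λ z → z - (a + b) * ½) (sym (ε*½+ε*½ b)) ⟩
      (b * ½ + b * ½) - (a + b) * ½ ≡⟨ solve 3 (λ a b h → (b :* h :+ b :* h) :- (a :+ b) :* h
                                         := (b :- a) :* h) refl a b ½ ⟩
      (b - a) * ½                   ∎ where open ≡-Reasoning

    0≤-⇒≤ : ∀ {a b} → 0ℚ ≤ b - a → a ≤ b
    0≤-⇒≤ {a} {b} h = subst (_≤ b) (+-identityʳ a)
      (subst (a + 0ℚ ≤_) (solve 2 (λ a b → a :+ (b :- a) := b) refl a b) (+-monoʳ-≤ a h))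

    wd-suc : ∀ i → wd (suc i) ≡ wd i * ½
    wd-suc i with bracket q i
    ... | a , b with ((a + b) * ½) * ((a + b) * ½) ≤? q
    ...   | yes _ = hi-mid a b
    ...   | no _  = mid-lo a b

    0≤half : ∀ {w} → 0ℚ ≤ w → 0ℚ ≤ w * ½
    0≤half {w} 0≤w = subst (_≤ w * ½) (*-zeroˡ ½) (*-monoʳ-≤-nonNeg ½ 0≤w)

    0≤wd : ∀ i → 0ℚ ≤ wd i
    0≤wd zero = subst (_≤ wd 0) (+-inverseʳ (lo 0)) (+-monoˡ-≤ (- lo 0) lo≤hi)
      where
      lo≤hi : lo 0 ≤ hi 0
      lo≤hi = ≤-trans
        (⊔-lub (≤-trans (nonNegative⁻¹ 1ℚ) (p≤p⊔q 1ℚ q)) (≤-trans (p⊓q≤p 1ℚ q) (p≤p⊔q 1ℚ q)))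
        ≤-refl
    0≤wd (suc i) = subst (0ℚ ≤_) (sym (wd-suc i)) (0≤half (0≤wd i))

    nest : ∀ i → lo i ≤ lo (suc i) × hi (suc i) ≤ hi i
    nest i with bracket q i | 0≤wd i
    ... | a , b | 0≤b-a with ((a + b) * ½) * ((a + b) * ½) ≤? q
    ...   | yes _ = 0≤-⇒≤ (subst (0ℚ ≤_) (sym (mid-lo a b)) (0≤half 0≤b-a)) , ≤-refl
    ...   | no _  = ≤-refl , 0≤-⇒≤ (subst (0ℚ ≤_) (sym (hi-mid a b)) (0≤half 0≤b-a))

    nests : ∀ {i j} → i ℕ.≤′ j → lo i ≤ lo j × hi j ≤ hi i
    nests (ℕ.≤′-reflexive refl) = ≤-refl , ≤-refl
    nests (ℕ.≤′-step {j} i≤j) with nests i≤j | nest j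
    ... | a , b | c , d = ≤-trans a c , ≤-trans d b

    -- (i + 1) · wd i ≤ wd 0
    wd-bound : ∀ i → fromℕ (suc i) * wd i ≤ wd 0
    wd-bound zero = ≤-reflexive (*-identityˡ (wd 0))
    wd-bound (suc i) = begin
      fromℕ (suc (suc i)) * wd (suc i)     ≡⟨ cong (fromℕ (suc (suc i)) *_) (wd-suc i) ⟩
      fromℕ (suc (suc i)) * (wd i * ½)     ≤⟨ *-monoʳ-≤-nonNeg (wd i * ½) {{nonNegative (0≤half (0≤wd i))}} 2+i≤ ⟩
      (s + s) * (wd i * ½)                 ≡⟨ solve 3 (λ s w h → (s :+ s) :* (w :* h) := s :* (w :* h :+ w :* h)) refl s (wd i) ½ ⟩
      s * (wd i * ½ + wd i * ½)            ≡⟨ cong (s *_) (ε*½+ε*½ (wd i)) ⟩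
      s * wd i                             ≤⟨ wd-bound i ⟩
      wd 0                                 ∎
      where
      open ≤-Reasoning
      s = fromℕ (suc i)
      2+i≤ : fromℕ (suc (suc i)) ≤ s + s
      2+i≤ = subst (fromℕ (suc (suc i)) ≤_) (fromℕ-+ (suc i) (suc i))
        (fromℕ-mono (subst (ℕ._≤ suc i ℕ.+ suc i) (ℕ.+-comm (suc i) 1)
          (ℕ.+-monoʳ-≤ (suc i) (ℕ.s≤s ℕ.z≤n))))

    is-cauchy : Cauchy lo
    is-cauchy ε 0<ε with archimedean (wd 0 * inv ε)
    ... | N , h = N , λ i j N≤i N≤j → ≤⇒dist (close i j N≤i N≤j) (close j i N≤j N≤i)
      where
      S = fromℕ (suc N)
      instance
        S-pos : Positive S
        S-pos = normalize-pos (suc N) 1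
      wdN≤ε : wd N ≤ ε
      wdN≤ε = *-cancelˡ-≤-pos S (≤-trans (wd-bound N) (begin
        wd 0                ≡⟨ sym (*-swap-inv (wd 0) 0<ε) ⟩
        ε * (wd 0 * inv ε)  ≤⟨ *-monoˡ-≤-nonNeg ε {{nonNegative (<⇒≤ 0<ε)}} h ⟩
        ε * S               ≡⟨ *-comm ε S ⟩
        S * ε               ∎))
        where open ≤-Reasoning
      close : ∀ i j → N ℕ.≤ i → N ℕ.≤ j → lo i ≤ lo j + ε
      close i j N≤i N≤j with nests (ℕ.≤⇒≤′ N≤i) | nests (ℕ.≤⇒≤′ N≤j)
      ... | _ , hi≤ | lo≤ , _ = begin
        lo i          ≤⟨ 0≤-⇒≤ (0≤wd i) ⟩
        hi i          ≤⟨ hi≤ ⟩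
        hi N          ≤⟨ a-b≤c⇒a≤b+c wdN≤ε ⟩
        lo N + ε      ≤⟨ +-monoˡ-≤ ε lo≤ ⟩
        lo j + ε      ∎
        where open ≤-Reasoning

-- On negative q this is 0.
√ : ℚ → ℝ
√ q = mkℝ (λ i → proj₁ (bracket q i)) (Bisection.is-cauchy q)

√-pos : ∀ {q} → 0ℚ < q → 0ℝ <ℝ √ q
√-pos {q} 0<q = 1ℚ ⊓ q , 0<1⊓q , 0 , λ i _ →
  subst (_≤ proj₁ (bracket q i)) (sym (+-identityˡ (1ℚ ⊓ q)))
    (≤-trans (p≤q⊔p 0ℚ (1ℚ ⊓ q)) (proj₁ (Bisection.nests q {0} {i} (ℕ.≤⇒≤′ ℕ.z≤n))))
  where
  0<1⊓q : 0ℚ < 1ℚ ⊓ q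
  0<1⊓q with ≤-total 1ℚ q
  ... | inj₁ 1≤q = subst (0ℚ <_) (sym (p≤q⇒p⊓q≡p 1≤q)) (positive⁻¹ 1ℚ)
  ... | inj₂ q≤1 = subst (0ℚ <_) (sym (p≥q⇒p⊓q≡q q≤1)) 0<q

fromℕ-pos : ∀ r .{{_ : NonZero r}} → 0ℚ < fromℕ r
fromℕ-pos r = positive⁻¹ (fromℕ r) {{normalize-pos r 1}}

------------------------------------------------------------------------
-- Binary matrices

Matrix : Set → ℕ → ℕ → Set
Matrix A m n = Vector (Vector A n) m

BinaryMatrix : ℕ → ℕ → Set
BinaryMatrix = Matrix Bool

open Sum ℕ.+-0-commutativeMonoid using () renaming (sum to ∑ℕ)
open Sum +-0-commutativeMonoid using () renaming (sum to ∑ℚ)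

ones : BinaryMatrix m n → ℕ
ones M = ∑ℕ λ i → ∑ℕ λ j → if M i j then 1 else 0

-- M[X × Y], with the entries outside X × Y replaced by 0 rather than deleted;
-- this does not affect the number of ones.
_[_×ˢ_] : BinaryMatrix m n → Subset m → Subset n → BinaryMatrix m n
(M [ X ×ˢ Y ]) i j = lookup X i ∧ lookup Y j ∧ M i j

density : .{{NonZero m}} → .{{NonZero n}} → BinaryMatrix m n → ℚ
density {m} {n} M = (+ ones M / (m ℕ.* n)) {{ℕ.m*n≢0 m n}}

subsets : ∀ n → List (Subset n)
subsets zero    = [] ∷ []
subsets (suc n) = map (inside ∷_) (subsets n) ++ map (outside ∷_) (subsets n)

deviation : .{{NonZero m}} → .{{NonZero n}} →
            BinaryMatrix m n → Subset m → Subset n → ℚ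
deviation M X Y =
  ∣ fromℕ (ones (M [ X ×ˢ Y ])) - density M * fromℕ Subset.∣ X ∣ * fromℕ Subset.∣ Y ∣ ∣

open Extrema (DecTotalOrder.totalOrder ≤-decTotalOrder) using (max)

-- The base value 0 is harmless: deviation M ∅ ∅ = 0.
disc : .{{NonZero m}} → .{{NonZero n}} → BinaryMatrix m n → ℚ
disc {m} {n} M =
  max 0ℚ (map (λ (X , Y) → deviation M X Y) (cartesianProduct (subsets m) (subsets n)))

------------------------------------------------------------------------
-- Rank

toℚ : BinaryMatrix m n → Matrix ℚ m n
toℚ M i j = if M i j then 1ℚ else 0ℚ

LinearlyIndependent : Vector (Vector ℚ m) k → Set
LinearlyIndependent {m} {k} v = (a : Vector ℚ k) →
  (∀ i → ∑ℚ (λ l → a l * v l i) ≡ 0ℚ) → ∀ l → a l ≡ 0ℚ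

IndependentColumns : Matrix ℚ m n → Vector (Fin n) k → Set
IndependentColumns A s = LinearlyIndependent λ l i → A i (s l)

-- HasRank A ρ: ρ is the largest number of linearly independent columns of A.
-- A linearly independent family has no repetitions, so s is a choice of
-- distinct columns.
HasRank : Matrix ℚ m n → ℕ → Set
HasRank {m} {n} A ρ =
  (∃[ s ] IndependentColumns {k = ρ} A s) ×
  (∀ {k} (s : Vector (Fin n) k) → IndependentColumns A s → k ℕ.≤ ρ)

{-# OPTIONS --safe #-}
module Submission where

-- Put A = M − p and let D = disc M, the cut norm of A. By Grothendieck's
-- inequality, Σ A i j ⟨x i , y j⟩ ≤ 32 D for all vectors of norm at most 1, so
-- it suffices to find vectors for which this sum is of order s m n, where s is
-- min {p, √(p/r)}. If D is small compared with s m n, then for all X and Y that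
-- miss at most 1/8 of the rows and columns the Frobenius norm of A on X × Y is
-- of order √(p m n). As rank A ≤ r + 1, the operator norm of A on X × Y is then at
-- least of order s √(m n), so there is a pair of vectors supported on X and Y
-- for which A gains s m n per unit of normalised mass. Such pairs are
-- accumulated greedily, each time with X and Y the rows and columns that have
-- not received much more than the average mass yet. Reading the collected
-- pairs coordinatewise gives the required vectors x i, y j of bounded norm.
-- Everything is rational, square roots entering only through the statement.

open import Defs
import Algebra.Properties.CommutativeMonoid.Sum as CommutativeMonoidSum
import Algebra.Properties.Semiring.Sum as Sum
open import Algebra.Bundles using (CommutativeRing)
open import Data.Bool.Base using (true; false; if_then_else_; _∧_)
open import Data.Empty using (⊥-elim)
open import Data.Fin.Base using (Fin; zero; suc)
open import Data.Fin.Subset as Subset using (Subset; inside; outside)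
import Data.Integer.Base as ℤ
import Data.Integer.Properties as ℤ
open import Data.List.Base using
  (List; []; _∷_; _++_; map; length; replicate; tabulate; cartesianProduct)
open import Data.List.Properties using (length-tabulate; length-map)
open import Data.List.Relation.Unary.All as All using (All; []; _∷_)
open import Data.List.Relation.Unary.Any using (here)
open import Data.List.Membership.Propositional using (_∈_)
open import Data.List.Membership.Propositional.Properties
  using (∈-++⁺ˡ; ∈-++⁺ʳ; ∈-map⁺; ∈-cartesianProduct⁺)
import Data.List.Extrema as Extrema
open import Data.Nat.Base as ℕ using (ℕ; NonZero; zero; suc)
open import Data.Nat.Coprimality as Coprime using (1-coprimeTo)
import Data.Nat.Properties as ℕ
open import Data.Product.Base using (∃-syntax; _×_; _,_; proj₁; proj₂)
open import Data.Rational.Unnormalised.Base as ℚᵘ using (mkℚᵘ)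
import Data.Rational.Unnormalised.Properties as ℚᵘ
open import Data.Rational.Base using
  ( ℚ; mkℚ; 0ℚ; 1ℚ; ½; _+_; _*_; _-_; -_; _⊓_; ∣_∣; _≤_; _<_; _/_
  ; toℚᵘ; fromℚᵘ; positive; nonNegative; ≢-nonZero; *≤*)
open import Data.Rational.Properties
open import Data.Sum.Base using (_⊎_; inj₁; inj₂)
open import Data.Vec.Base using ([]; _∷_; lookup)
open import Function.Base using (_∘_)
open import Level using (0ℓ)
open import Relation.Binary.PropositionalEquality
  using (_≡_; _≗_; refl; sym; trans; cong; cong₂; subst; module ≡-Reasoning)
open import Relation.Binary.Bundles using (DecTotalOrder)
open import Relation.Binary.Definitions using (tri<; tri≈; tri>)
open import Relation.Nullary using (Dec; yes; no)
open import Relation.Nullary.Decidable using (dec⇒maybe; from-yes)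
open import Tactic.RingSolver using (solve-∀)
open import Tactic.RingSolver.Core.AlmostCommutativeRing
  using (AlmostCommutativeRing; fromCommutativeRing)

open Sum (CommutativeRing.semiring +-*-commutativeRing)
  using (*-distribˡ-sum)
  renaming (sum to ∑; ∑-distrib-+ to ∑-+; sum-cong-≗ to ∑-cong)

private
  variable
    I J : Set
    m n : ℕ
    a b c d q : ℚ

-- The obstacle is concentration. A pair with a large ratio of gain to norm, such as a top singular
-- pair, may live on few rows and columns, and cutting its entries down to size can destroy the
-- gain. Passing to vectors removes the obstacle: many pairs become the coordinates of one vector
-- system, gains and squared norms both add up, and overloaded rows or columns can be switched off.
-- The restricted Frobenius norm stays large because the entries of `M` are 0 and 1: A² is entrywise
-- an affine function of A, so its sum over X × Y differs from p (1 - p) |X| |Y| by at most (1 - 2p)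
-- D. A pair (x, y) is charged n ‖x‖² + m ‖y‖², which is at least 2 √(mn) ‖x‖ ‖y‖. Gain γ per unit
-- of this weight therefore needs an operator norm of at least 2 γ √(mn), the origin of the
-- expression 4 γ² m n. The final constant is 1/(16 · 9 · 32): 32 from Grothendieck's inequality, 9
-- from the excess load in the greedy construction, 16 from taking γ to be a sixteenth of the
-- minimum in the statement.

ℚ-ring : AlmostCommutativeRing 0ℓ 0ℓ
ℚ-ring = fromCommutativeRing +-*-commutativeRing (λ x → dec⇒maybe (0ℚ ≟ x))

-- Ordered-field arithmetic

-- Nonlinear inequalities are proved throughout by exhibiting the slack `d` as a visibly nonnegative
-- expression; the equation that remains is left to the ring solver.
≤-by : ∀ d → 0ℚ ≤ d → b ≡ a + d → a ≤ b
≤-by {a = a} d 0≤d refl = subst (_≤ a + d) (+-identityʳ a) (+-monoʳ-≤ a 0≤d)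

0≤-diff : a ≤ b → 0ℚ ≤ b - a
0≤-diff {a} {b} a≤b = subst (_≤ b - a) (+-inverseʳ a) (+-monoˡ-≤ (- a) a≤b)

0<-diff : a < b → 0ℚ < b - a
0<-diff {a} {b} a<b = subst (_< b - a) (+-inverseʳ a) (+-monoˡ-< (- a) a<b)

<-by : ∀ d → 0ℚ < d → b ≡ a + d → a < b
<-by {a = a} d 0<d refl = subst (_< a + d) (+-identityʳ a) (+-monoʳ-< a 0<d)

0≤+ : 0ℚ ≤ a → 0ℚ ≤ b → 0ℚ ≤ a + b
0≤+ = +-mono-≤

0<+ : 0ℚ < a → 0ℚ ≤ b → 0ℚ < a + b
0<+ = +-mono-<-≤

0≤* : 0ℚ ≤ a → 0ℚ ≤ b → 0ℚ ≤ a * b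
0≤* {a} {b} 0≤a 0≤b =
  subst (_≤ a * b) (*-zeroʳ a) (*-monoˡ-≤-nonNeg a {{nonNegative 0≤a}} 0≤b)

0<* : 0ℚ < a → 0ℚ < b → 0ℚ < a * b
0<* {a} {b} 0<a 0<b =
  subst (_< a * b) (*-zeroʳ a) (*-monoʳ-<-pos a {{positive 0<a}} 0<b)

0≤sq : ∀ a → 0ℚ ≤ a * a
0≤sq a with ≤-total 0ℚ a
... | inj₁ 0≤a = 0≤* 0≤a 0≤a
... | inj₂ a≤0 = subst (0ℚ ≤_) (neg-sq a) (0≤* (neg-antimono-≤ a≤0) (neg-antimono-≤ a≤0))
  where
  neg-sq : ∀ a → - a * - a ≡ a * a
  neg-sq = solve-∀ ℚ-ring

*-monoˡ : 0ℚ ≤ c → a ≤ b → c * a ≤ c * b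
*-monoˡ {c} 0≤c = *-monoˡ-≤-nonNeg c {{nonNegative 0≤c}}

*-monoʳ : 0ℚ ≤ c → a ≤ b → a * c ≤ b * c
*-monoʳ {c} 0≤c = *-monoʳ-≤-nonNeg c {{nonNegative 0≤c}}

*-mono₂ : 0ℚ ≤ a → 0ℚ ≤ d → a ≤ b → c ≤ d → a * c ≤ b * d
*-mono₂ 0≤a 0≤d a≤b c≤d = ≤-trans (*-monoˡ 0≤a c≤d) (*-monoʳ 0≤d a≤b)

*-cancelˡ-≤ : 0ℚ < c → c * a ≤ c * b → a ≤ b
*-cancelˡ-≤ {c} 0<c = *-cancelˡ-≤-pos c {{positive 0<c}}

sq≤0⇒≡0 : a * a ≤ 0ℚ → a ≡ 0ℚ
sq≤0⇒≡0 {a} a²≤0 with <-cmp a 0ℚ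
... | tri≈ _ a≡0 _ = a≡0
... | tri> _ _ 0<a = ⊥-elim (<-irrefl refl (<-≤-trans (0<* 0<a 0<a) a²≤0))
... | tri< a<0 _ _ = ⊥-elim (<-irrefl refl
  (<-≤-trans (subst (0ℚ <_) (neg-sq a) (0<* (neg-antimono-< a<0) (neg-antimono-< a<0))) a²≤0))
  where
  neg-sq : ∀ a → - a * - a ≡ a * a
  neg-sq = solve-∀ ℚ-ring

≤∣∣ : ∀ a → a ≤ ∣ a ∣
≤∣∣ a with ≤-total 0ℚ a
... | inj₁ 0≤a = ≤-reflexive (sym (0≤p⇒∣p∣≡p 0≤a))
... | inj₂ a≤0 = ≤-trans a≤0 (0≤∣p∣ a)

-≤∣∣ : ∀ a → - a ≤ ∣ a ∣
-≤∣∣ a = subst (- a ≤_) (∣-p∣≡∣p∣ a) (≤∣∣ (- a))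

fromℕ≡mkℚ : ∀ n → fromℕ n ≡ mkℚ (ℤ.+ n) 0 (Coprime.sym (1-coprimeTo n))
fromℕ≡mkℚ n = normalize-coprime (Coprime.sym (1-coprimeTo n))

fromℕ-+ : ∀ m n → fromℕ (m ℕ.+ n) ≡ fromℕ m + fromℕ n
fromℕ-+ m n = sym (trans (cong₂ _+_ (fromℕ≡mkℚ m) (fromℕ≡mkℚ n))
  (cong (_/ 1) (cong₂ ℤ._+_ (ℤ.*-identityʳ (ℤ.+ m)) (ℤ.*-identityʳ (ℤ.+ n)))))

fromℕ-* : ∀ m n → fromℕ (m ℕ.* n) ≡ fromℕ m * fromℕ n
fromℕ-* m n = sym (trans (cong₂ _*_ (fromℕ≡mkℚ m) (fromℕ≡mkℚ n))
  (cong (_/ 1) (sym (ℤ.pos-* m n))))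

fromℕ-mono : m ℕ.≤ n → fromℕ m ≤ fromℕ n
fromℕ-mono {m} {n} m≤n rewrite fromℕ≡mkℚ m | fromℕ≡mkℚ n =
  *≤* (ℤ.*-monoʳ-≤-nonNeg (ℤ.+ 1) (ℤ.+≤+ m≤n))

fromℕ-suc : ∀ n → fromℕ (suc n) ≡ 1ℚ + fromℕ n
fromℕ-suc n = fromℕ-+ 1 n

0≤fromℕ : ∀ n → 0ℚ ≤ fromℕ n
0≤fromℕ n = fromℕ-mono {0} {n} ℕ.z≤n

-- Finite sums

∑-*ˡ : ∀ c (f : Fin n → ℚ) → ∑ (λ i → c * f i) ≡ c * ∑ f
∑-*ˡ c f = sym (*-distribˡ-sum c f)

∑-comm : (f : Fin m → Fin n → ℚ) → ∑ (λ i → ∑ (f i)) ≡ ∑ (λ j → ∑ (λ i → f i j))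
∑-comm = Sum.∑-comm (CommutativeRing.semiring +-*-commutativeRing)

∑-mono : {f g : Fin n → ℚ} → (∀ i → f i ≤ g i) → ∑ f ≤ ∑ g
∑-mono {zero}  f≤g = ≤-refl
∑-mono {suc n} f≤g = +-mono-≤ (f≤g zero) (∑-mono (f≤g ∘ suc))

∑-const : ∀ n c → ∑ {n} (λ _ → c) ≡ fromℕ n * c
∑-const zero    c = sym (*-zeroˡ c)
∑-const (suc n) c = begin
  c + ∑ {n} (λ _ → c)  ≡⟨ cong (c +_) (∑-const n c) ⟩
  c + fromℕ n * c      ≡⟨ distrib c (fromℕ n) ⟩
  (1ℚ + fromℕ n) * c   ≡⟨ cong (_* c) (sym (fromℕ-suc n)) ⟩
  fromℕ (suc n) * c    ∎
  where
  open ≡-Reasoning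
  distrib : ∀ c t → c + t * c ≡ (1ℚ + t) * c
  distrib = solve-∀ ℚ-ring

∑-0 : ∀ n → ∑ {n} (λ _ → 0ℚ) ≡ 0ℚ
∑-0 n = trans (∑-const n 0ℚ) (*-zeroʳ (fromℕ n))

0≤∑ : {f : Fin n → ℚ} → (∀ i → 0ℚ ≤ f i) → 0ℚ ≤ ∑ f
0≤∑ {n} {f} 0≤f = subst (_≤ ∑ f) (∑-0 n) (∑-mono 0≤f)

term≤∑ : {f : Fin n → ℚ} → (∀ i → 0ℚ ≤ f i) → ∀ i → f i ≤ ∑ f
term≤∑ {suc n} {f} 0≤f zero    = ≤-by _ (0≤∑ (0≤f ∘ suc)) refl
term≤∑ {suc n} {f} 0≤f (suc i) =
  ≤-trans (term≤∑ (0≤f ∘ suc) i) (≤-by (f zero) (0≤f zero) (+-comm (f zero) _))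

-- Sums over lists are for the growing families of auxiliary vectors; `∑` is kept for sums over rows
-- and columns.
total : (I → ℚ) → List I → ℚ
total f []       = 0ℚ
total f (z ∷ zs) = f z + total f zs

total-++ : ∀ (f : I → ℚ) zs ws → total f (zs ++ ws) ≡ total f zs + total f ws
total-++ f []       ws = sym (+-identityˡ _)
total-++ f (z ∷ zs) ws =
  trans (cong (f z +_) (total-++ f zs ws)) (sym (+-assoc (f z) (total f zs) (total f ws)))

total-map : ∀ (f : J → ℚ) (g : I → J) zs → total f (map g zs) ≡ total (f ∘ g) zs
total-map f g []       = refl
total-map f g (z ∷ zs) = cong (f (g z) +_) (total-map f g zs)

total-cong : {f g : I → ℚ} → f ≗ g → ∀ zs → total f zs ≡ total g zs
total-cong f≗g []       = refl
total-cong f≗g (z ∷ zs) = cong₂ _+_ (f≗g z) (total-cong f≗g zs)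

total-mono : {f g : I → ℚ} → (∀ z → f z ≤ g z) → ∀ zs → total f zs ≤ total g zs
total-mono f≤g []       = ≤-refl
total-mono f≤g (z ∷ zs) = +-mono-≤ (f≤g z) (total-mono f≤g zs)

total-+ : ∀ (f g : I → ℚ) zs → total (λ z → f z + g z) zs ≡ total f zs + total g zs
total-+ f g []       = refl
total-+ f g (z ∷ zs) = trans (cong (f z + g z +_) (total-+ f g zs)) (interchange (f z) (g z) _ _)
  where
  interchange : ∀ a b c d → (a + b) + (c + d) ≡ (a + c) + (b + d)
  interchange = solve-∀ ℚ-ring

total-*ˡ : ∀ c (f : I → ℚ) zs → total (λ z → c * f z) zs ≡ c * total f zs
total-*ˡ c f []       = sym (*-zeroʳ c)
total-*ˡ c f (z ∷ zs) =
  trans (cong (c * f z +_) (total-*ˡ c f zs)) (sym (*-distribˡ-+ c (f z) (total f zs)))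

total-replicate : ∀ (f : I → ℚ) k z → total f (replicate k z) ≡ fromℕ k * f z
total-replicate f zero    z = sym (*-zeroˡ (f z))
total-replicate f (suc k) z = begin
  f z + total f (replicate k z)  ≡⟨ cong (f z +_) (total-replicate f k z) ⟩
  f z + fromℕ k * f z            ≡⟨ distrib (f z) (fromℕ k) ⟩
  (1ℚ + fromℕ k) * f z           ≡⟨ cong (_* f z) (sym (fromℕ-suc k)) ⟩
  fromℕ (suc k) * f z            ∎
  where
  open ≡-Reasoning
  distrib : ∀ c t → c + t * c ≡ (1ℚ + t) * c
  distrib = solve-∀ ℚ-ring

total-∑ : ∀ (f : I → Fin n → ℚ) zs →
          total (λ z → ∑ (f z)) zs ≡ ∑ (λ i → total (λ z → f z i) zs)
total-∑ {n = n} f []       = sym (∑-0 n)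
total-∑ {n = n} f (z ∷ zs) = trans (cong (∑ (f z) +_) (total-∑ f zs))
  (sym (∑-+ (f z) (λ i → total (λ w → f w i) zs)))

∑-lin : ∀ a b (f g : Fin n → ℚ) → ∑ (λ i → a * f i + b * g i) ≡ a * ∑ f + b * ∑ g
∑-lin a b f g = trans (∑-+ (λ i → a * f i) (λ i → b * g i)) (cong₂ _+_ (∑-*ˡ a f) (∑-*ˡ b g))

total-lin : ∀ a b (f g : I → ℚ) zs →
            total (λ z → a * f z + b * g z) zs ≡ a * total f zs + b * total g zs
total-lin a b f g zs =
  trans (total-+ (λ z → a * f z) (λ z → b * g z) zs) (cong₂ _+_ (total-*ˡ a f zs) (total-*ˡ b g zs))

-- Bilinear forms and the cut norm

form : Matrix ℚ m n → (Fin m → ℚ) → (Fin n → ℚ) → ℚ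
form A x y = ∑ λ i → ∑ λ j → A i j * (x i * y j)

form-∑ˡ : ∀ (A : Matrix ℚ m n) x y → form A x y ≡ ∑ λ i → x i * ∑ λ j → A i j * y j
form-∑ˡ A x y = ∑-cong λ i → trans
  (∑-cong λ j → swap (A i j) (x i) (y j)) (∑-*ˡ (x i) (λ j → A i j * y j))
  where
  swap : ∀ a x y → a * (x * y) ≡ x * (a * y)
  swap = solve-∀ ℚ-ring

form-∑ʳ : ∀ (A : Matrix ℚ m n) x y → form A x y ≡ ∑ λ j → y j * ∑ λ i → A i j * x i
form-∑ʳ A x y = trans (∑-comm λ i j → A i j * (x i * y j))
  (∑-cong λ j → trans (∑-cong λ i → swap (A i j) (x i) (y j)) (∑-*ˡ (y j) (λ i → A i j * x i)))
  where
  swap : ∀ a x y → a * (x * y) ≡ y * (a * x)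
  swap = solve-∀ ℚ-ring

form-linˡ : ∀ (A : Matrix ℚ m n) a b x x′ y →
            form A (λ i → a * x i + b * x′ i) y ≡ a * form A x y + b * form A x′ y
form-linˡ A a b x x′ y = begin
  form A (λ i → a * x i + b * x′ i) y
    ≡⟨ form-∑ˡ A (λ i → a * x i + b * x′ i) y ⟩
  ∑ (λ i → (a * x i + b * x′ i) * r i)
    ≡⟨ ∑-cong (λ i → expand a b (x i) (x′ i) (r i)) ⟩
  ∑ (λ i → a * (x i * r i) + b * (x′ i * r i))
    ≡⟨ ∑-lin a b (λ i → x i * r i) (λ i → x′ i * r i) ⟩
  a * ∑ (λ i → x i * r i) + b * ∑ (λ i → x′ i * r i)
    ≡⟨ sym (cong₂ (λ s t → a * s + b * t) (form-∑ˡ A x y) (form-∑ˡ A x′ y)) ⟩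
  a * form A x y + b * form A x′ y ∎
  where
  open ≡-Reasoning
  r : _ → ℚ
  r i = ∑ λ j → A i j * y j
  expand : ∀ a b x x′ r → (a * x + b * x′) * r ≡ a * (x * r) + b * (x′ * r)
  expand = solve-∀ ℚ-ring

form-linʳ : ∀ (A : Matrix ℚ m n) a b x y y′ →
            form A x (λ j → a * y j + b * y′ j) ≡ a * form A x y + b * form A x y′
form-linʳ A a b x y y′ = begin
  form A x (λ j → a * y j + b * y′ j)
    ≡⟨ form-∑ʳ A x (λ j → a * y j + b * y′ j) ⟩
  ∑ (λ j → (a * y j + b * y′ j) * r j)
    ≡⟨ ∑-cong (λ j → expand a b (y j) (y′ j) (r j)) ⟩
  ∑ (λ j → a * (y j * r j) + b * (y′ j * r j))
    ≡⟨ ∑-lin a b (λ j → y j * r j) (λ j → y′ j * r j) ⟩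
  a * ∑ (λ j → y j * r j) + b * ∑ (λ j → y′ j * r j)
    ≡⟨ sym (cong₂ (λ s t → a * s + b * t) (form-∑ʳ A x y) (form-∑ʳ A x y′)) ⟩
  a * form A x y + b * form A x y′ ∎
  where
  open ≡-Reasoning
  r : _ → ℚ
  r j = ∑ λ i → A i j * x i
  expand : ∀ a b x x′ r → (a * x + b * x′) * r ≡ a * (x * r) + b * (x′ * r)
  expand = solve-∀ ℚ-ring

form-scale : ∀ (A : Matrix ℚ m n) a b x y →
             form A (λ i → a * x i) (λ j → b * y j) ≡ a * b * form A x y
form-scale A a b x y = trans
  (∑-cong λ i → trans (∑-cong λ j → swap (A i j) a b (x i) (y j))
                      (∑-*ˡ (a * b) (λ j → A i j * (x i * y j))))
  (∑-*ˡ (a * b) (λ i → ∑ λ j → A i j * (x i * y j)))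
  where
  swap : ∀ A a b x y → A * (a * x * (b * y)) ≡ a * b * (A * (x * y))
  swap = solve-∀ ℚ-ring

ind : Subset n → Fin n → ℚ
ind X i = if lookup X i then 1ℚ else 0ℚ

-- A vertex of the cube [-2, 2]^n, written as a difference of indicators so that forms in it expand
-- into cuts. The radius 2 is the level of `truncation`.
signs : Subset n → Fin n → ℚ
signs X i = fromℕ 2 * ind X i + - fromℕ 2 * ind (Subset.∁ X) i

-- A linear function on a cube is largest at a vertex: each coordinate moves to 2 or -2 according to
-- the sign of its coefficient `c i`.
∑≤∑-signs : ∀ (c x : Fin n → ℚ) → (∀ i → - fromℕ 2 ≤ x i) → (∀ i → x i ≤ fromℕ 2) →
            ∃[ X ] ∑ (λ i → x i * c i) ≤ ∑ (λ i → signs X i * c i)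
∑≤∑-signs {zero}  c x lo hi = [] , ≤-refl
∑≤∑-signs {suc n} c x lo hi with ∑≤∑-signs (c ∘ suc) (x ∘ suc) (lo ∘ suc) (hi ∘ suc)
... | X , h with ≤-total 0ℚ (c zero)
...   | inj₁ 0≤c = inside ∷ X , +-mono-≤ (*-monoʳ 0≤c (hi zero)) h
...   | inj₂ c≤0 = outside ∷ X , +-mono-≤
  (≤-by {a = x zero * c zero} ((x zero - - fromℕ 2) * - c zero)
    (0≤* (0≤-diff (lo zero)) (neg-antimono-≤ c≤0)) (flip-sign (x zero) (c zero))) h
  where
  flip-sign : ∀ x c → - fromℕ 2 * c ≡ x * c + (x - - fromℕ 2) * - c
  flip-sign = solve-∀ ℚ-ring

-- The form is linear in each argument separately, so `x` and then `y` can be moved to a vertex.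
-- Each vertex is twice a difference of two indicators, which leaves four cuts with coefficients 4
-- or -4, hence 16.
form≤16·cut : ∀ (A : Matrix ℚ m n) {D} → (∀ X Y → ∣ form A (ind X) (ind Y) ∣ ≤ D) →
              ∀ {x y} → (∀ i → - fromℕ 2 ≤ x i) → (∀ i → x i ≤ fromℕ 2) →
              (∀ j → - fromℕ 2 ≤ y j) → (∀ j → y j ≤ fromℕ 2) →
              form A x y ≤ fromℕ 16 * D
form≤16·cut A {D} cut {x} {y} lx hx ly hy
  with ∑≤∑-signs (λ i → ∑ λ j → A i j * y j) x lx hx
... | X , hX with ∑≤∑-signs (λ j → ∑ λ i → A i j * signs X i) y ly hy
...   | Y , hY = begin
  form A x y                   ≡⟨ form-∑ˡ A x y ⟩
  _                            ≤⟨ hX ⟩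
  _                            ≡⟨ sym (form-∑ˡ A (signs X) y) ⟩
  form A (signs X) y           ≡⟨ form-∑ʳ A (signs X) y ⟩
  _                            ≤⟨ hY ⟩
  _                            ≡⟨ sym (form-∑ʳ A (signs X) (signs Y)) ⟩
  form A (signs X) (signs Y)   ≡⟨ form-linˡ A 2ℚ (- 2ℚ) (ind X) (ind X′) (signs Y) ⟩
  2ℚ * form A (ind X) (signs Y) + - 2ℚ * form A (ind X′) (signs Y)
    ≡⟨ cong₂ (λ s t → 2ℚ * s + - 2ℚ * t)
         (form-linʳ A 2ℚ (- 2ℚ) (ind X) (ind Y) (ind Y′))
         (form-linʳ A 2ℚ (- 2ℚ) (ind X′) (ind Y) (ind Y′)) ⟩
  2ℚ * (2ℚ * form A (ind X) (ind Y) + - 2ℚ * form A (ind X) (ind Y′)) +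
  - 2ℚ * (2ℚ * form A (ind X′) (ind Y) + - 2ℚ * form A (ind X′) (ind Y′))
    ≤⟨ combine (≤-trans (≤∣∣ _) (cut X Y)) (≤-trans (-≤∣∣ _) (cut X Y′))
               (≤-trans (-≤∣∣ _) (cut X′ Y)) (≤-trans (≤∣∣ _) (cut X′ Y′)) ⟩
  fromℕ 16 * D                 ∎
  where
  open ≤-Reasoning
  2ℚ = fromℕ 2
  X′ = Subset.∁ X
  Y′ = Subset.∁ Y
  identity : ∀ a b c d D → fromℕ 16 * D ≡
    fromℕ 2 * (fromℕ 2 * a + - fromℕ 2 * b) + - fromℕ 2 * (fromℕ 2 * c + - fromℕ 2 * d) +
    fromℕ 4 * ((D - a) + (D - - b) + ((D - - c) + (D - d)))
  identity = solve-∀ ℚ-ring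
  combine : ∀ {a b c d} → a ≤ D → - b ≤ D → - c ≤ D → d ≤ D →
    2ℚ * (2ℚ * a + - 2ℚ * b) + - 2ℚ * (2ℚ * c + - 2ℚ * d) ≤ fromℕ 16 * D
  combine {a} {b} {c} {d} ha hb hc hd = ≤-by _
    (0≤* (0≤fromℕ 4) (0≤+ (0≤+ (0≤-diff ha) (0≤-diff hb)) (0≤+ (0≤-diff hc) (0≤-diff hd))))
    (identity a b c d D)

-- Rademacher sums

rademacher : List (I → ℚ) → List (I → ℚ)
rademacher []       = (λ _ → 0ℚ) ∷ []
rademacher (z ∷ zs) = (plus ++ plus) ++ (minus ++ minus)
  where
  plus  = map (λ w i → w i + z i) (rademacher zs)
  minus = map (λ w i → w i - z i) (rademacher zs)

halves : List I → ℚ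
halves []       = 1ℚ
halves (_ ∷ zs) = ½ * halves zs

-- The expectation of f (Σ ± z). Each pair of signs occurs twice in rademacher,
-- so that the square root of 1 / length (rademacher zs) is rational.
𝔼 : List (I → ℚ) → ((I → ℚ) → ℚ) → ℚ
𝔼 zs f = halves zs * halves zs * total f (rademacher zs)

0≤halves² : ∀ (zs : List I) → 0ℚ ≤ halves zs * halves zs
0≤halves² zs = 0≤sq (halves zs)

𝔼-cong : ∀ (zs : List (I → ℚ)) {f g} → f ≗ g → 𝔼 zs f ≡ 𝔼 zs g
𝔼-cong zs f≗g = cong (halves zs * halves zs *_) (total-cong f≗g (rademacher zs))

𝔼-mono : ∀ (zs : List (I → ℚ)) {f g} → (∀ w → f w ≤ g w) → 𝔼 zs f ≤ 𝔼 zs g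
𝔼-mono zs f≤g = *-monoˡ (0≤halves² zs) (total-mono f≤g (rademacher zs))

𝔼-lin : ∀ (zs : List (I → ℚ)) a b f g →
        𝔼 zs (λ w → a * f w + b * g w) ≡ a * 𝔼 zs f + b * 𝔼 zs g
𝔼-lin zs a b f g = trans (cong (h *_) (total-lin a b f g (rademacher zs)))
  (expand h a b (total f (rademacher zs)) (total g (rademacher zs)))
  where
  h = halves zs * halves zs
  expand : ∀ h a b s t → h * (a * s + b * t) ≡ a * (h * s) + b * (h * t)
  expand = solve-∀ ℚ-ring

𝔼-+ : ∀ (zs : List (I → ℚ)) f g → 𝔼 zs (λ w → f w + g w) ≡ 𝔼 zs f + 𝔼 zs g
𝔼-+ zs f g = trans (cong (h *_) (total-+ f g (rademacher zs)))
  (*-distribˡ-+ h (total f (rademacher zs)) (total g (rademacher zs)))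
  where
  h = halves zs * halves zs

𝔼-∷ : ∀ (z : I → ℚ) zs f →
      𝔼 (z ∷ zs) f ≡ ½ * 𝔼 zs (λ w → f (λ i → w i + z i) + f (λ i → w i - z i))
𝔼-∷ z zs f = begin
  (½ * h) * (½ * h) * total f ((plus ++ plus) ++ (minus ++ minus))
    ≡⟨ cong ((½ * h) * (½ * h) *_) (trans (total-++ f (plus ++ plus) (minus ++ minus))
         (cong₂ _+_ (total-++ f plus plus) (total-++ f minus minus))) ⟩
  (½ * h) * (½ * h) * ((total f plus + total f plus) + (total f minus + total f minus))
    ≡⟨ collect h (total f plus) (total f minus) ⟩
  ½ * (h * h * (total f plus + total f minus))
    ≡⟨ cong (λ t → ½ * (h * h * t)) (cong₂ _+_ (total-map f _ ω) (total-map f _ ω)) ⟩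
  ½ * (h * h * (total (λ w → f (λ i → w i + z i)) ω + total (λ w → f (λ i → w i - z i)) ω))
    ≡⟨ cong (λ t → ½ * (h * h * t))
         (sym (total-+ (λ w → f (λ i → w i + z i)) (λ w → f (λ i → w i - z i)) ω)) ⟩
  ½ * 𝔼 zs (λ w → f (λ i → w i + z i) + f (λ i → w i - z i)) ∎
  where
  open ≡-Reasoning
  h = halves zs
  ω = rademacher zs
  plus  = map (λ w i → w i + z i) ω
  minus = map (λ w i → w i - z i) ω
  collect : ∀ h s t →
    (½ * h) * (½ * h) * ((s + s) + (t + t)) ≡ ½ * (h * h * (s + t))
  collect = solve-∀ ℚ-ring

𝔼-const : ∀ (zs : List (I → ℚ)) c → 𝔼 zs (λ _ → c) ≡ c
𝔼-const []       c = trans (*-identityˡ (c + 0ℚ)) (+-identityʳ c)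
𝔼-const (z ∷ zs) c = trans (𝔼-∷ z zs (λ _ → c))
  (trans (cong (½ *_) (𝔼-const zs (c + c))) (half-double c))
  where
  half-double : ∀ c → ½ * (c + c) ≡ c
  half-double = solve-∀ ℚ-ring

-- Signs of different list entries are independent with mean 0, so cross terms cancel. This turns
-- the inner product of the vectors encoded at `i` and `j` into the expectation of a product of two
-- scalars, to which truncation applies.
second-moment : ∀ (zs : List (I → ℚ)) i j →
                𝔼 zs (λ w → w i * w j) ≡ total (λ z → z i * z j) zs
second-moment []       i j = refl
second-moment (z ∷ zs) i j = begin
  𝔼 (z ∷ zs) (λ w → w i * w j)
    ≡⟨ 𝔼-∷ z zs (λ w → w i * w j) ⟩
  ½ * 𝔼 zs (λ w → (w i + z i) * (w j + z j) + (w i - z i) * (w j - z j))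
    ≡⟨ cong (½ *_) (𝔼-cong zs λ w → expand (w i) (z i) (w j) (z j)) ⟩
  ½ * 𝔼 zs (λ w → fromℕ 2 * (w i * w j) + fromℕ 2 * (z i * z j))
    ≡⟨ cong (½ *_) (𝔼-lin zs (fromℕ 2) (fromℕ 2) (λ w → w i * w j) (λ _ → z i * z j)) ⟩
  ½ * (fromℕ 2 * 𝔼 zs (λ w → w i * w j) + fromℕ 2 * 𝔼 zs (λ _ → z i * z j))
    ≡⟨ cong₂ (λ s t → ½ * (fromℕ 2 * s + fromℕ 2 * t))
         (second-moment zs i j) (𝔼-const zs (z i * z j)) ⟩
  ½ * (fromℕ 2 * total (λ z → z i * z j) zs + fromℕ 2 * (z i * z j))
    ≡⟨ collect (total (λ z → z i * z j) zs) (z i * z j) ⟩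
  z i * z j + total (λ z → z i * z j) zs ∎
  where
  open ≡-Reasoning
  expand : ∀ w z w′ z′ →
    (w + z) * (w′ + z′) + (w - z) * (w′ - z′) ≡ fromℕ 2 * (w * w′) + fromℕ 2 * (z * z′)
  expand = solve-∀ ℚ-ring
  collect : ∀ s t → ½ * (fromℕ 2 * s + fromℕ 2 * t) ≡ t + s
  collect = solve-∀ ℚ-ring

-- Khintchine's inequality for exponent 4. Adding `z` turns E w⁴ into E w⁴ + 6 z² E w² + z⁴, and 3
-- s² + 6 β s + β² is at most 3 (s + β)².
fourth-moment : ∀ (zs : List (I → ℚ)) i →
  𝔼 zs (λ w → w i * w i * (w i * w i)) ≤
  fromℕ 3 * (total (λ z → z i * z i) zs * total (λ z → z i * z i) zs)
fourth-moment []       i = ≤-refl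
fourth-moment (z ∷ zs) i = begin
  𝔼 (z ∷ zs) (λ w → w i * w i * (w i * w i))
    ≡⟨ 𝔼-∷ z zs (λ w → w i * w i * (w i * w i)) ⟩
  ½ * 𝔼 zs (λ w → (w i + z i) * (w i + z i) * ((w i + z i) * (w i + z i)) +
                  (w i - z i) * (w i - z i) * ((w i - z i) * (w i - z i)))
    ≡⟨ cong (½ *_) (𝔼-cong zs λ w → expand (w i) (z i)) ⟩
  ½ * 𝔼 zs (λ w → fromℕ 2 * (w i * w i * (w i * w i)) +
                  1ℚ * (fromℕ 12 * β * (w i * w i) + fromℕ 2 * (β * β)))
    ≡⟨ cong (½ *_) (trans
         (𝔼-lin zs (fromℕ 2) 1ℚ (λ w → w i * w i * (w i * w i))
           (λ w → fromℕ 12 * β * (w i * w i) + fromℕ 2 * (β * β)))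
         (cong (λ t → fromℕ 2 * e + 1ℚ * t)
           (𝔼-lin zs (fromℕ 12 * β) (fromℕ 2) (λ w → w i * w i) (λ _ → β * β)))) ⟩
  ½ * (fromℕ 2 * e + 1ℚ * (fromℕ 12 * β * 𝔼 zs (λ w → w i * w i) +
                           fromℕ 2 * 𝔼 zs (λ _ → β * β)))
    ≡⟨ cong₂ (λ u v → ½ * (fromℕ 2 * e + 1ℚ * (fromℕ 12 * β * u + fromℕ 2 * v)))
         (second-moment zs i i) (𝔼-const zs (β * β)) ⟩
  ½ * (fromℕ 2 * e + 1ℚ * (fromℕ 12 * β * s + fromℕ 2 * (β * β)))
    ≤⟨ ≤-by ((fromℕ 3 * (s * s) - e) + fromℕ 2 * (β * β))
         (0≤+ (0≤-diff (fourth-moment zs i)) (0≤* (0≤fromℕ 2) (0≤sq β))) (collect e β s) ⟩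
  fromℕ 3 * ((β + s) * (β + s)) ∎
  where
  open ≤-Reasoning
  β = z i * z i
  s = total (λ z → z i * z i) zs
  e = 𝔼 zs (λ w → w i * w i * (w i * w i))
  expand : ∀ w z →
    (w + z) * (w + z) * ((w + z) * (w + z)) + (w - z) * (w - z) * ((w - z) * (w - z)) ≡
    fromℕ 2 * (w * w * (w * w)) +
    1ℚ * (fromℕ 12 * (z * z) * (w * w) + fromℕ 2 * (z * z * (z * z)))
  expand = solve-∀ ℚ-ring
  collect : ∀ e b s → fromℕ 3 * ((b + s) * (b + s)) ≡
    ½ * (fromℕ 2 * e + 1ℚ * (fromℕ 12 * b * s + fromℕ 2 * (b * b))) +
    ((fromℕ 3 * (s * s) - e) + fromℕ 2 * (b * b))
  collect = solve-∀ ℚ-ring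

-- Beyond the level 2 the excess |x - t| is |x| - 2, and 8 (|x| - 2) ≤ x² since (|x| - 4)² ≥ 0.
-- Squaring gives the last bound, which ties the remainder to the fourth moment.
truncation : ∀ x → ∃[ t ] (- fromℕ 2 ≤ t × t ≤ fromℕ 2 × t * t ≤ x * x ×
             fromℕ 64 * ((x - t) * (x - t)) ≤ x * x * (x * x))
truncation x with ≤-total (fromℕ 2) x
... | inj₁ 2≤x = fromℕ 2 , from-yes (- fromℕ 2 ≤? fromℕ 2) , ≤-refl ,
  *-mono₂ (0≤fromℕ 2) (≤-trans (0≤fromℕ 2) 2≤x) 2≤x 2≤x ,
  ≤-by _ (0≤* (0≤sq (x - fromℕ 4)) (0≤+ (0≤sq x) (0≤* (0≤fromℕ 8) (0≤-diff 2≤x)))) (identity x)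
  where
  identity : ∀ x → x * x * (x * x) ≡ fromℕ 64 * ((x - fromℕ 2) * (x - fromℕ 2)) +
    (x - fromℕ 4) * (x - fromℕ 4) * (x * x + fromℕ 8 * (x - fromℕ 2))
  identity = solve-∀ ℚ-ring
... | inj₂ x≤2 with ≤-total x (- fromℕ 2)
...   | inj₁ x≤-2 = - fromℕ 2 , ≤-refl , from-yes (- fromℕ 2 ≤? fromℕ 2) ,
  ≤-by _ (0≤* (0≤-diff x≤-2) (0≤+ (0≤-diff x≤-2) (0≤fromℕ 4))) (sq-diff x) ,
  ≤-by _ (0≤* (0≤sq (x + fromℕ 4)) (0≤+ (0≤sq x) (0≤* (0≤fromℕ 8) (0≤-diff x≤-2)))) (identity x)
  where
  sq-diff : ∀ x → x * x ≡ - fromℕ 2 * - fromℕ 2 + (- fromℕ 2 - x) * ((- fromℕ 2 - x) + fromℕ 4)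
  sq-diff = solve-∀ ℚ-ring
  identity : ∀ x → x * x * (x * x) ≡ fromℕ 64 * ((x - - fromℕ 2) * (x - - fromℕ 2)) +
    (x + fromℕ 4) * (x + fromℕ 4) * (x * x + fromℕ 8 * (- fromℕ 2 - x))
  identity = solve-∀ ℚ-ring
...   | inj₂ -2≤x = x , -2≤x , x≤2 , ≤-refl , ≤-by _ (0≤sq (x * x)) (identity x)
  where
  identity : ∀ x → x * x * (x * x) ≡ fromℕ 64 * ((x - x) * (x - x)) + x * x * (x * x)
  identity = solve-∀ ℚ-ring

-- Grothendieck's inequality

-- The list zs encodes the vectors v i = (z i | z ∈ zs), so this says ‖v i‖ ≤ 1.
Unit : List (I → ℚ) → Set
Unit {I} zs = ∀ i → total (λ z → z i * z i) zs ≤ 1ℚ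

-- One coordinate of all the row vectors x i and column vectors y j at once; a list of these is a
-- whole system of vectors.
Pair : ℕ → ℕ → Set
Pair m n = Fin m ⊎ Fin n → ℚ

-- This is Σ A i j ⟨x i , y j⟩ summed coordinate by coordinate, the left side of Grothendieck's
-- inequality.
gain : Matrix ℚ m n → List (Pair m n) → ℚ
gain A = total λ z → form A (z ∘ inj₁) (z ∘ inj₂)

total-form : ∀ (A : Matrix ℚ m n) (x : I → Fin m → ℚ) (y : I → Fin n → ℚ) zs →
             total (λ z → form A (x z) (y z)) zs ≡
             ∑ λ i → ∑ λ j → A i j * total (λ z → x z i * y z j) zs
total-form A x y zs = trans
  (total-∑ (λ z i → ∑ λ j → A i j * (x z i * y z j)) zs)
  (∑-cong λ i → trans (total-∑ (λ z j → A i j * (x z i * y z j)) zs)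
    (∑-cong λ j → total-*ˡ (A i j) (λ z → x z i * y z j) zs))

gain-𝔼 : ∀ (A : Matrix ℚ m n) zs → gain A zs ≡ 𝔼 zs (λ w → form A (w ∘ inj₁) (w ∘ inj₂))
gain-𝔼 A zs = begin
  gain A zs
    ≡⟨ total-form A (_∘ inj₁) (_∘ inj₂) zs ⟩
  (∑ λ i → ∑ λ j → A i j * total (λ z → z (inj₁ i) * z (inj₂ j)) zs)
    ≡⟨ (∑-cong λ i → ∑-cong λ j → cong (A i j *_) (sym (second-moment zs (inj₁ i) (inj₂ j)))) ⟩
  (∑ λ i → ∑ λ j → A i j * (h * t i j))
    ≡⟨ (∑-cong λ i → trans (∑-cong λ j → swap (A i j) h (t i j)) (∑-*ˡ h (λ j → A i j * t i j))) ⟩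
  (∑ λ i → h * ∑ λ j → A i j * t i j)
    ≡⟨ ∑-*ˡ h (λ i → ∑ λ j → A i j * t i j) ⟩
  h * (∑ λ i → ∑ λ j → A i j * t i j)
    ≡⟨ cong (h *_) (sym (total-form A (_∘ inj₁) (_∘ inj₂) (rademacher zs))) ⟩
  𝔼 zs (λ w → form A (w ∘ inj₁) (w ∘ inj₂)) ∎
  where
  open ≡-Reasoning
  h = halves zs * halves zs
  t : _ → _ → ℚ
  t i j = total (λ w → w (inj₁ i) * w (inj₂ j)) (rademacher zs)
  swap : ∀ A h t → A * (h * t) ≡ h * (A * t)
  swap = solve-∀ ℚ-ring

Bounded : Matrix ℚ m n → ℚ → Set
Bounded A G = ∀ zs → Unit zs → gain A zs ≤ G

-- Random scalars are again vectors, with one coordinate per outcome `w`, so the assumed bound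
-- applies to functions of the signs, in particular to truncation remainders. The factors `α` and
-- `β` exploit that such a remainder has norm well below 1.
𝔼-form≤ : ∀ {A : Matrix ℚ m n} {G} → Bounded A G → ∀ (zs : List (I → ℚ)) α β
  (x : (I → ℚ) → Fin m → ℚ) (y : (I → ℚ) → Fin n → ℚ) →
  (∀ i → α * α * 𝔼 zs (λ w → x w i * x w i) ≤ 1ℚ) →
  (∀ j → β * β * 𝔼 zs (λ w → y w j * y w j) ≤ 1ℚ) →
  α * β * 𝔼 zs (λ w → form A (x w) (y w)) ≤ G
𝔼-form≤ {A = A} {G} bounded zs α β x y x≤ y≤ = subst (_≤ G) gain≡ (bounded (map embed ω) unit)
  where
  open ≡-Reasoning
  h = halves zs
  ω = rademacher zs
  -- `h` is the square root of the probability of one entry in the list of outcomes.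
  embed : _ → Pair _ _
  embed w (inj₁ i) = α * h * x w i
  embed w (inj₂ j) = β * h * y w j
  expand : ∀ α h x → α * h * x * (α * h * x) ≡ α * α * (h * h) * (x * x)
  expand = solve-∀ ℚ-ring
  unit₁ : ∀ γ (f : _ → ℚ) → γ * γ * 𝔼 zs (λ w → f w * f w) ≤ 1ℚ →
          total (λ w → γ * h * f w * (γ * h * f w)) ω ≤ 1ℚ
  unit₁ γ f f≤ = subst (_≤ 1ℚ) (sym (begin
    total (λ w → γ * h * f w * (γ * h * f w)) ω
      ≡⟨ total-cong (λ w → expand γ h (f w)) ω ⟩
    total (λ w → γ * γ * (h * h) * (f w * f w)) ω
      ≡⟨ total-*ˡ (γ * γ * (h * h)) (λ w → f w * f w) ω ⟩
    γ * γ * (h * h) * total (λ w → f w * f w) ω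
      ≡⟨ *-assoc (γ * γ) (h * h) _ ⟩
    γ * γ * 𝔼 zs (λ w → f w * f w) ∎)) f≤
  unit : Unit (map embed ω)
  unit (inj₁ i) = subst (_≤ 1ℚ) (sym (total-map _ embed ω)) (unit₁ α (λ w → x w i) (x≤ i))
  unit (inj₂ j) = subst (_≤ 1ℚ) (sym (total-map _ embed ω)) (unit₁ β (λ w → y w j) (y≤ j))
  regroup : ∀ α β h t → α * h * (β * h) * t ≡ α * β * (h * h * t)
  regroup = solve-∀ ℚ-ring
  gain≡ : gain A (map embed ω) ≡ α * β * 𝔼 zs (λ w → form A (x w) (y w))
  gain≡ = begin
    gain A (map embed ω)
      ≡⟨ total-map _ embed ω ⟩
    total (λ w → form A (λ i → α * h * x w i) (λ j → β * h * y w j)) ω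
      ≡⟨ total-cong (λ w → form-scale A (α * h) (β * h) (x w) (y w)) ω ⟩
    total (λ w → α * h * (β * h) * form A (x w) (y w)) ω
      ≡⟨ total-*ˡ (α * h * (β * h)) (λ w → form A (x w) (y w)) ω ⟩
    α * h * (β * h) * total (λ w → form A (x w) (y w)) ω
      ≡⟨ regroup α β h _ ⟩
    α * β * 𝔼 zs (λ w → form A (x w) (y w)) ∎

-- The starting point for the improvement below: by the inequality of arithmetic and geometric
-- means, inner products of vectors of norm at most 1 lie between -1 and 1.
trivially-bounded : ∀ (A : Matrix ℚ m n) → Bounded A (∑ λ i → ∑ λ j → ∣ A i j ∣)
trivially-bounded A zs unit = subst (_≤ _) (sym (total-form A (_∘ inj₁) (_∘ inj₂) zs))
  (∑-mono λ i → ∑-mono λ j → entry i j)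
  where
  amgm : ∀ x y → x * y ≤ ½ * (x * x) + ½ * (y * y)
  amgm x y = ≤-by _ (0≤* (nonNegative⁻¹ ½) (0≤sq (x - y))) (identity x y)
    where
    identity : ∀ x y → ½ * (x * x) + ½ * (y * y) ≡ x * y + ½ * ((x - y) * (x - y))
    identity = solve-∀ ℚ-ring
  neg-amgm : ∀ x y → - 1ℚ * (x * y) ≤ ½ * (x * x) + ½ * (y * y)
  neg-amgm x y = ≤-by _ (0≤* (nonNegative⁻¹ ½) (0≤sq (x + y))) (identity x y)
    where
    identity : ∀ x y → ½ * (x * x) + ½ * (y * y) ≡ - 1ℚ * (x * y) + ½ * ((x + y) * (x + y))
    identity = solve-∀ ℚ-ring
  squares≤1 : ∀ i j → total (λ z → ½ * (z i * z i) + ½ * (z j * z j)) zs ≤ 1ℚ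
  squares≤1 i j = ≤-trans (≤-reflexive (total-lin ½ ½ (λ z → z i * z i) (λ z → z j * z j) zs))
    (+-mono-≤ (*-monoˡ (nonNegative⁻¹ ½) (unit i)) (*-monoˡ (nonNegative⁻¹ ½) (unit j)))
  entry : ∀ i j → A i j * total (λ z → z (inj₁ i) * z (inj₂ j)) zs ≤ ∣ A i j ∣
  entry i j with ∣p∣≡p∨∣p∣≡-p (A i j)
  ... | inj₁ eq = begin
    A i j * s      ≡⟨ cong (_* s) (sym eq) ⟩
    ∣ A i j ∣ * s  ≤⟨ *-monoˡ (0≤∣p∣ (A i j)) (≤-trans
                        (total-mono (λ z → amgm (z (inj₁ i)) (z (inj₂ j))) zs)
                        (squares≤1 (inj₁ i) (inj₂ j))) ⟩
    ∣ A i j ∣ * 1ℚ ≡⟨ *-identityʳ ∣ A i j ∣ ⟩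
    ∣ A i j ∣      ∎
    where
    open ≤-Reasoning
    s = total (λ z → z (inj₁ i) * z (inj₂ j)) zs
  ... | inj₂ eq = begin
    A i j * s                ≡⟨ two-signs (A i j) s ⟩
    - A i j * (- 1ℚ * s)     ≡⟨ cong (_* (- 1ℚ * s)) (sym eq) ⟩
    ∣ A i j ∣ * (- 1ℚ * s)   ≡⟨ cong (∣ A i j ∣ *_)
                                  (sym (total-*ˡ (- 1ℚ) (λ z → z (inj₁ i) * z (inj₂ j)) zs)) ⟩
    ∣ A i j ∣ * total (λ z → - 1ℚ * (z (inj₁ i) * z (inj₂ j))) zs
      ≤⟨ *-monoˡ (0≤∣p∣ (A i j)) (≤-trans
           (total-mono (λ z → neg-amgm (z (inj₁ i)) (z (inj₂ j))) zs)
           (squares≤1 (inj₁ i) (inj₂ j))) ⟩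
    ∣ A i j ∣ * 1ℚ ≡⟨ *-identityʳ ∣ A i j ∣ ⟩
    ∣ A i j ∣      ∎
    where
    open ≤-Reasoning
    s = total (λ z → z (inj₁ i) * z (inj₂ j)) zs
    two-signs : ∀ a s → a * s ≡ - a * (- 1ℚ * s)
    two-signs = solve-∀ ℚ-ring

-- Truncate the Rademacher sums at ±2: the truncated part is controlled by the
-- cut norm, and the remainder has norm at most 1/4 by the fourth moment.
Bounded-improve : ∀ (A : Matrix ℚ m n) {D G} → (∀ X Y → ∣ form A (ind X) (ind Y) ∣ ≤ D) →
                  Bounded A G → Bounded A (fromℕ 16 * D + ½ * G)
Bounded-improve A {D} {G} cut bounded zs unit = begin
  gain A zs
    ≡⟨ gain-𝔼 A zs ⟩
  𝔼 zs (λ w → form A (w ∘ inj₁) (w ∘ inj₂))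
    ≡⟨ 𝔼-cong zs split ⟩
  𝔼 zs (λ w → form A (t w ∘ inj₁) (t w ∘ inj₂) +
    (form A (r w ∘ inj₁) (w ∘ inj₂) + form A (t w ∘ inj₁) (r w ∘ inj₂)))
    ≡⟨ trans (𝔼-+ zs _ _) (cong (main +_) (𝔼-+ zs _ _)) ⟩
  -- The product x y is t t + r y + t r. Each error has one factor of norm at most 1/4 and is thus
  -- at most G/4, so the two together cost G/2.
  main + (err₁ + err₂)
    ≤⟨ collect {main} {err₁} {err₂} main≤ err₁≤ err₂≤ ⟩
  fromℕ 16 * D + ½ * G ∎
  where
  open ≤-Reasoning
  trunc : ℚ → ℚ
  trunc x = proj₁ (truncation x)
  t r : Pair _ _ → Pair _ _
  t w i = trunc (w i)
  r w i = w i - trunc (w i)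
  main = 𝔼 zs (λ w → form A (t w ∘ inj₁) (t w ∘ inj₂))
  err₁ = 𝔼 zs (λ w → form A (r w ∘ inj₁) (w ∘ inj₂))
  err₂ = 𝔼 zs (λ w → form A (t w ∘ inj₁) (r w ∘ inj₂))
  split : ∀ w → form A (w ∘ inj₁) (w ∘ inj₂) ≡ form A (t w ∘ inj₁) (t w ∘ inj₂) +
    (form A (r w ∘ inj₁) (w ∘ inj₂) + form A (t w ∘ inj₁) (r w ∘ inj₂))
  split w = trans (∑-cong λ i → trans
      (trans (∑-cong λ j → split₁ (A i j) (w (inj₁ i)) (w (inj₂ j)) (t w (inj₁ i)) (t w (inj₂ j)))
        (∑-+ (λ j → A i j * (t w (inj₁ i) * t w (inj₂ j))) _))
      (cong (∑ (λ j → A i j * (t w (inj₁ i) * t w (inj₂ j))) +_)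
        (∑-+ (λ j → A i j * (r w (inj₁ i) * w (inj₂ j))) _)))
    (trans (∑-+ (λ i → ∑ λ j → A i j * (t w (inj₁ i) * t w (inj₂ j))) _)
      (cong (form A (t w ∘ inj₁) (t w ∘ inj₂) +_)
        (∑-+ (λ i → ∑ λ j → A i j * (r w (inj₁ i) * w (inj₂ j))) _)))
    where
    split₁ : ∀ a x y u v →
      a * (x * y) ≡ a * (u * v) + (a * ((x - u) * y) + a * (u * (y - v)))
    split₁ = solve-∀ ℚ-ring
  main≤ : main ≤ fromℕ 16 * D
  main≤ = ≤-trans
    (𝔼-mono zs λ w → form≤16·cut A cut
      (λ i → proj₁ (proj₂ (truncation (w (inj₁ i)))))
      (λ i → proj₁ (proj₂ (proj₂ (truncation (w (inj₁ i))))))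
      (λ j → proj₁ (proj₂ (truncation (w (inj₂ j)))))
      (λ j → proj₁ (proj₂ (proj₂ (truncation (w (inj₂ j)))))))
    (≤-reflexive (𝔼-const zs (fromℕ 16 * D)))
  w-unit : ∀ i → 1ℚ * 1ℚ * 𝔼 zs (λ w → w i * w i) ≤ 1ℚ
  w-unit i = ≤-trans
    (≤-reflexive (trans (*-identityˡ (𝔼 zs (λ w → w i * w i))) (second-moment zs i i))) (unit i)
  t-unit : ∀ i → 1ℚ * 1ℚ * 𝔼 zs (λ w → t w i * t w i) ≤ 1ℚ
  t-unit i = ≤-trans (*-monoˡ (nonNegative⁻¹ 1ℚ)
    (𝔼-mono zs λ w → proj₁ (proj₂ (proj₂ (proj₂ (truncation (w i))))))) (w-unit i)
  -- 64 E r² ≤ E w⁴ ≤ 3, hence 16 E r² ≤ 1 with room to spare.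
  r-unit : ∀ i → fromℕ 4 * fromℕ 4 * 𝔼 zs (λ w → r w i * r w i) ≤ 1ℚ
  r-unit i = *-cancelˡ-≤ {c = fromℕ 4} (positive⁻¹ (fromℕ 4)) (begin
    fromℕ 4 * (fromℕ 4 * fromℕ 4 * e)
      ≡⟨ regroup e ⟩
    fromℕ 64 * e + 0ℚ * 0ℚ
      ≡⟨ trans (cong (fromℕ 64 * e +_) (cong (0ℚ *_) (sym (𝔼-const zs 0ℚ))))
               (sym (𝔼-lin zs (fromℕ 64) 0ℚ (λ w → r w i * r w i) (λ _ → 0ℚ))) ⟩
    𝔼 zs (λ w → fromℕ 64 * (r w i * r w i) + 0ℚ * 0ℚ)
      ≤⟨ 𝔼-mono zs (λ w → ≤-trans (≤-reflexive (+-identityʳ (fromℕ 64 * (r w i * r w i))))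
           (proj₂ (proj₂ (proj₂ (proj₂ (truncation (w i))))))) ⟩
    𝔼 zs (λ w → w i * w i * (w i * w i))
      ≤⟨ fourth-moment zs i ⟩
    fromℕ 3 * (s * s)
      ≤⟨ *-monoˡ (0≤fromℕ 3) (*-mono₂ {a = s} {d = 1ℚ} {b = 1ℚ} {c = s} 0≤s (nonNegative⁻¹ 1ℚ) (unit i) (unit i)) ⟩
    fromℕ 3 * (1ℚ * 1ℚ)
      ≤⟨ from-yes (fromℕ 3 * (1ℚ * 1ℚ) ≤? fromℕ 4 * 1ℚ) ⟩
    fromℕ 4 * 1ℚ ∎)
    where
    e = 𝔼 zs (λ w → r w i * r w i)
    s = total (λ z → z i * z i) zs
    0≤s : 0ℚ ≤ s
    0≤s = subst (0ℚ ≤_) (second-moment zs i i) (≤-trans (≤-reflexive (sym (𝔼-const zs 0ℚ)))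
      (𝔼-mono zs λ w → 0≤sq (w i)))
    regroup : ∀ e → fromℕ 4 * (fromℕ 4 * fromℕ 4 * e) ≡ fromℕ 64 * e + 0ℚ * 0ℚ
    regroup = solve-∀ ℚ-ring
  err₁≤ : fromℕ 4 * 1ℚ * err₁ ≤ G
  err₁≤ = 𝔼-form≤ {A = A} bounded zs (fromℕ 4) 1ℚ (λ w → r w ∘ inj₁) (λ w → w ∘ inj₂)
    (r-unit ∘ inj₁) (w-unit ∘ inj₂)
  err₂≤ : 1ℚ * fromℕ 4 * err₂ ≤ G
  err₂≤ = 𝔼-form≤ {A = A} bounded zs 1ℚ (fromℕ 4) (λ w → t w ∘ inj₁) (λ w → r w ∘ inj₂)
    (t-unit ∘ inj₁) (r-unit ∘ inj₂)
  quarter = ½ * ½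
  identity : ∀ D G u v w → D + ½ * G ≡
    u + (v + w) + ((D - u) + (½ * ½ * (G - fromℕ 4 * 1ℚ * v) + ½ * ½ * (G - 1ℚ * fromℕ 4 * w)))
  identity = solve-∀ ℚ-ring
  collect : ∀ {u v w} → u ≤ fromℕ 16 * D → fromℕ 4 * 1ℚ * v ≤ G → 1ℚ * fromℕ 4 * w ≤ G →
            u + (v + w) ≤ fromℕ 16 * D + ½ * G
  collect {u} {v} {w} hu hv hw = ≤-by _
    (0≤+ (0≤-diff hu) (0≤+ (0≤* (nonNegative⁻¹ quarter) (0≤-diff hv))
                           (0≤* (nonNegative⁻¹ quarter) (0≤-diff hw))))
    (identity (fromℕ 16 * D) G u v w)

-- Clearing denominators and the Archimedean property

times-denominator : ∀ q → 0ℚ ≤ q → ∃[ k ] ∃[ d ] q * fromℕ (suc d) ≡ fromℕ k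
times-denominator q@(mkℚ (ℤ.+ k) d _) _ = k , d , (begin
  q * fromℕ (suc d)
    ≡⟨ cong (q *_) (fromℕ≡mkℚ (suc d)) ⟩
  q * mkℚ (ℤ.+ suc d) 0 (Coprime.sym (1-coprimeTo (suc d)))
    ≡⟨ /-cong {p₁ = ℤ.+ k ℤ.* ℤ.+ suc d} {q₁ = suc d ℕ.* 1} (sym (ℤ.pos-* k (suc d)))
         (ℕ.*-identityʳ (suc d)) ⟩
  ℤ.+ (k ℕ.* suc d) / suc d
    ≡⟨ sym (fromℚᵘ-toℚᵘ (ℤ.+ (k ℕ.* suc d) / suc d)) ⟩
  fromℚᵘ (toℚᵘ (ℤ.+ (k ℕ.* suc d) / suc d))
    ≡⟨ fromℚᵘ-cong {y = mkℚᵘ (ℤ.+ k) 0} (ℚᵘ.≃-trans (toℚᵘ-fromℚᵘ (mkℚᵘ (ℤ.+ (k ℕ.* suc d)) d))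
         (ℚᵘ.*≡* (trans (ℤ.*-identityʳ (ℤ.+ (k ℕ.* suc d))) (ℤ.pos-* k (suc d))))) ⟩
  fromℕ k ∎)
  where open ≡-Reasoning
times-denominator (mkℚ ℤ.-[1+ k ] d _) (*≤* ())

archimedean : ∀ a → 0ℚ < b → ∃[ N ] a < fromℕ (suc N) * b
archimedean {b} a 0<b with ≤-total a 0ℚ
... | inj₁ a≤0 = 0 , ≤-<-trans a≤0 (0<* (positive⁻¹ (fromℕ 1)) 0<b)
... | inj₂ 0≤a with times-denominator a 0≤a | times-denominator b (<⇒≤ 0<b)
-- The successor of the witness is (k + 1) (e + 1): here a < k + 1, and (e + 1) b is a positive
-- integer, so at least 1.
...   | k , d , a≡ | l , e , b≡ = k ℕ.* suc e ℕ.+ e , (begin-strict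
  a                                      ≤⟨ ≤-by (a * fromℕ d) (0≤* 0≤a (0≤fromℕ d)) (*-suc a d) ⟩
  a * fromℕ (suc d)                      ≡⟨ a≡ ⟩
  fromℕ k                                <⟨ <-by 1ℚ (positive⁻¹ 1ℚ) (trans (fromℕ-suc k) (+-comm 1ℚ (fromℕ k))) ⟩
  fromℕ (suc k)                          ≡⟨ sym (*-identityʳ (fromℕ (suc k))) ⟩
  fromℕ (suc k) * 1ℚ                     ≤⟨ *-monoˡ (0≤fromℕ (suc k)) (1≤ l b≡) ⟩
  fromℕ (suc k) * (fromℕ (suc e) * b)    ≡⟨ sym (*-assoc (fromℕ (suc k)) (fromℕ (suc e)) b) ⟩
  fromℕ (suc k) * fromℕ (suc e) * b      ≡⟨ cong (_* b) (sym (fromℕ-* (suc k) (suc e))) ⟩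
  fromℕ (suc k ℕ.* suc e) * b            ≡⟨ cong (λ t → fromℕ (suc t) * b) (ℕ.+-comm e (k ℕ.* suc e)) ⟩
  fromℕ (suc (k ℕ.* suc e ℕ.+ e)) * b    ∎)
  where
  open ≤-Reasoning
  *-suc : ∀ a d → a * fromℕ (suc d) ≡ a + a * fromℕ d
  *-suc a d = trans (cong (a *_) (fromℕ-suc d)) (expand a (fromℕ d))
    where
    expand : ∀ a t → a * (1ℚ + t) ≡ a + a * t
    expand = solve-∀ ℚ-ring
  1≤ : ∀ l → b * fromℕ (suc e) ≡ fromℕ l → 1ℚ ≤ fromℕ (suc e) * b
  1≤ zero    b≡ = ⊥-elim (<-irrefl (sym b≡) (0<* 0<b (fromℕ-pos (suc e))))
  1≤ (suc l) b≡ = subst (1ℚ ≤_) (trans (sym b≡) (*-comm b (fromℕ (suc e))))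
    (fromℕ-mono {1} {suc l} (ℕ.s≤s ℕ.z≤n))

inverse : 0ℚ < q → ∃[ r ] (0ℚ < r × q * r ≡ 1ℚ)
inverse {q} 0<q = _ , positive⁻¹ _ {{1/pos⇒pos q}} , *-inverseʳ q
  where instance
  _ = positive 0<q
  _ = pos⇒nonZero q

-- A list of k copies of a vector scaled by β multiplies its quadratic data by
-- k β², and every nonnegative rational has this form.
multiple-of-square : ∀ q → 0ℚ ≤ q → ∃[ k ] ∃[ β ] fromℕ k * (β * β) ≡ q
multiple-of-square q 0≤q =
  let k , d , q≡ = times-denominator q 0≤q
      β , _ , dβ≡1 = inverse (fromℕ-pos (suc d))
  in k ℕ.* suc d , β , trans (cong (λ s → s * (β * β)) (fromℕ-* k (suc d)))
       (simplify {q} {fromℕ (suc d)} {fromℕ k} {β} q≡ dβ≡1)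
  where
  regroup : ∀ q t β → q * t * t * (β * β) ≡ q * ((t * β) * (t * β))
  regroup = solve-∀ ℚ-ring
  simplify : ∀ {q t l β} → q * t ≡ l → t * β ≡ 1ℚ → l * t * (β * β) ≡ q
  simplify {q} {t} {l} {β} refl tβ≡1 = trans (regroup q t β)
    (trans (cong (λ s → q * (s * s)) tβ≡1) (*-identityʳ q))

-- Iterating the improvement to Grothendieck's inequality

halvings : ℚ → ℕ → ℚ
halvings δ zero    = δ
halvings δ (suc k) = ½ * halvings δ k

0≤halvings : ∀ {δ} → 0ℚ ≤ δ → ∀ k → 0ℚ ≤ halvings δ k
0≤halvings 0≤δ zero    = 0≤δ
0≤halvings 0≤δ (suc k) = 0≤* (nonNegative⁻¹ ½) (0≤halvings 0≤δ k)

-- Decay like 1/k is all that the Archimedean argument requires.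
suc*halvings≤ : ∀ {δ} → 0ℚ ≤ δ → ∀ k → fromℕ (suc k) * halvings δ k ≤ δ
suc*halvings≤ {δ} 0≤δ zero = ≤-reflexive (*-identityˡ δ)
suc*halvings≤ {δ} 0≤δ (suc k) = begin
  fromℕ (suc (suc k)) * (½ * η)   ≡⟨ cong (_* (½ * η)) (fromℕ-suc (suc k)) ⟩
  (1ℚ + fromℕ (suc k)) * (½ * η)  ≤⟨ *-monoʳ (0≤* (nonNegative⁻¹ ½) (0≤halvings 0≤δ k))
                                     (+-monoˡ-≤ (fromℕ (suc k)) (fromℕ-mono {1} {suc k} (ℕ.s≤s ℕ.z≤n))) ⟩
  (fromℕ (suc k) + fromℕ (suc k)) * (½ * η) ≡⟨ regroup (fromℕ (suc k)) η ⟩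
  fromℕ (suc k) * η               ≤⟨ suc*halvings≤ 0≤δ k ⟩
  δ                               ∎
  where
  open ≤-Reasoning
  η = halvings δ k
  regroup : ∀ t h → (t + t) * (½ * h) ≡ t * h
  regroup = solve-∀ ℚ-ring

-- The map G ↦ 16 D + G/2 has the fixed point 32 D and halves the distance to it. Iterating from the
-- trivial bound replaces the usual argument with the optimal constant, which need not be rational.
grothendieck : ∀ (A : Matrix ℚ m n) {D} → (∀ X Y → ∣ form A (ind X) (ind Y) ∣ ≤ D) → 0ℚ ≤ D →
               Bounded A (fromℕ 32 * D)
grothendieck A {D} cut 0≤D zs unit with gain A zs ≤? fromℕ 32 * D
... | yes gain≤ = gain≤
... | no  gain≰ = ⊥-elim (<-irrefl refl (begin-strict
  δ                            <⟨ proj₂ arch ⟩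
  fromℕ (suc N) * ε            ≤⟨ *-monoˡ (0≤fromℕ (suc N)) ε≤ ⟩
  fromℕ (suc N) * halvings δ N ≤⟨ suc*halvings≤ 0≤δ N ⟩
  δ                            ∎))
  where
  open ≤-Reasoning
  δ = ∑ λ i → ∑ λ j → ∣ A i j ∣
  0≤δ : 0ℚ ≤ δ
  0≤δ = 0≤∑ λ i → 0≤∑ λ j → 0≤∣p∣ (A i j)
  ε = gain A zs - fromℕ 32 * D
  arch = archimedean {ε} δ (0<-diff (≰⇒> gain≰))
  N = proj₁ arch
  halve : ∀ D h → fromℕ 16 * D + ½ * (fromℕ 32 * D + h) ≡ fromℕ 32 * D + ½ * h
  halve = solve-∀ ℚ-ring
  bounded : ∀ k → Bounded A (fromℕ 32 * D + halvings δ k)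
  bounded zero    zs unit = ≤-trans (trivially-bounded A zs unit)
    (≤-by (fromℕ 32 * D) (0≤* (0≤fromℕ 32) 0≤D) (+-comm (fromℕ 32 * D) δ))
  bounded (suc k) zs unit = ≤-trans (Bounded-improve A cut (bounded k) zs unit)
    (≤-reflexive (halve D (halvings δ k)))
  ε≤ : ε ≤ halvings δ N
  ε≤ = ≤-by _ (0≤-diff (bounded N zs unit)) (identity (gain A zs) (fromℕ 32 * D) (halvings δ N))
    where
    identity : ∀ g D h → h ≡ (g - D) + (D + h - g)
    identity = solve-∀ ℚ-ring

-- Orthogonal projection

dot : (Fin m → ℚ) → (Fin m → ℚ) → ℚ
dot u v = ∑ λ i → u i * v i

dot-congʳ : ∀ (u : Fin m → ℚ) {v v′} → v ≗ v′ → dot u v ≡ dot u v′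
dot-congʳ u v≗v′ = ∑-cong λ i → cong (u i *_) (v≗v′ i)

dot-comm : ∀ (u v : Fin m → ℚ) → dot u v ≡ dot v u
dot-comm u v = ∑-cong λ i → *-comm (u i) (v i)

dot-subʳ : ∀ (u v : Fin m → ℚ) t w → dot u (λ i → v i - t * w i) ≡ dot u v - t * dot u w
dot-subʳ u v t w = begin
  dot u (λ i → v i - t * w i)                 ≡⟨ ∑-cong (λ i → expand (u i) (v i) t (w i)) ⟩
  ∑ (λ i → 1ℚ * (u i * v i) + - t * (u i * w i))
    ≡⟨ ∑-lin 1ℚ (- t) (λ i → u i * v i) (λ i → u i * w i) ⟩
  1ℚ * dot u v + - t * dot u w                ≡⟨ collect (dot u v) t (dot u w) ⟩
  dot u v - t * dot u w                       ∎
  where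
  open ≡-Reasoning
  expand : ∀ u v t w → u * (v - t * w) ≡ 1ℚ * (u * v) + - t * (u * w)
  expand = solve-∀ ℚ-ring
  collect : ∀ s t r → 1ℚ * s + - t * r ≡ s - t * r
  collect = solve-∀ ℚ-ring

dot-subˡ : ∀ (u : Fin m → ℚ) t w v → dot (λ i → u i - t * w i) v ≡ dot u v - t * dot w v
dot-subˡ u t w v = trans (dot-comm (λ i → u i - t * w i) v) (trans (dot-subʳ v u t w)
  (cong₂ (λ r s → r - t * s) (dot-comm v u) (dot-comm v w)))

0≤dot : ∀ (u : Fin m → ℚ) → 0ℚ ≤ dot u u
0≤dot u = 0≤∑ λ i → 0≤sq (u i)

dot≡0⇒≡0 : ∀ (u : Fin m → ℚ) → dot u u ≡ 0ℚ → ∀ i → u i ≡ 0ℚ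
dot≡0⇒≡0 u u²≡0 i = sq≤0⇒≡0 (subst (u i * u i ≤_) u²≡0 (term≤∑ (λ k → 0≤sq (u k)) i))

-- The coefficient of the projection of `u` onto the line of `w`. For `w` = 0 both sides vanish and
-- 0 serves, so the orthogonalisation below works for dependent lists as well.
dot-coefficient : ∀ (u w : Fin m → ℚ) → ∃[ t ] dot u w ≡ t * dot w w
dot-coefficient {m} u w with <-cmp 0ℚ (dot w w)
... | tri< 0<w² _ _ = let r , _ , w²r≡1 = inverse 0<w² in dot u w * r ,
  trans (sym (*-identityʳ (dot u w))) (trans (cong (dot u w *_) (sym w²r≡1))
    (swap (dot u w) (dot w w) r))
  where
  swap : ∀ s t r → s * (t * r) ≡ s * r * t
  swap = solve-∀ ℚ-ring
... | tri≈ _ 0≡w² _ = 0ℚ , trans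
  (trans (∑-cong λ i → trans (cong (u i *_) (dot≡0⇒≡0 w (sym 0≡w²) i)) (*-zeroʳ (u i))) (∑-0 m))
  (sym (*-zeroˡ (dot w w)))
... | tri> _ _ w²<0 = ⊥-elim (<-irrefl refl (<-≤-trans w²<0 (0≤dot w)))

-- Coefficients are peeled off one at a time, to match induction along the list. The list may be
-- dependent; its length serves as a bound for the rank.
Span : List (Fin m → ℚ) → (Fin m → ℚ) → Set
Span []       v = ∀ i → v i ≡ 0ℚ
Span (e ∷ es) v = ∃[ t ] Span es (λ i → v i - t * e i)

Span-cong : ∀ (es : List (Fin m → ℚ)) {v v′} → v ≗ v′ → Span es v → Span es v′
Span-cong []       v≗v′ s       i = trans (sym (v≗v′ i)) (s i)
Span-cong (e ∷ es) v≗v′ (t , s) = t , Span-cong es (λ i → cong (_- t * e i) (v≗v′ i)) s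

Span-lin : ∀ (es : List (Fin m → ℚ)) α β {v w} → Span es v → Span es w →
           Span es (λ i → α * v i + β * w i)
Span-lin [] α β sv sw i =
  trans (cong₂ (λ x y → α * x + β * y) (sv i) (sw i)) (cong₂ _+_ (*-zeroʳ α) (*-zeroʳ β))
Span-lin (e ∷ es) α β {v} {w} (t , sv) (r , sw) = α * t + β * r ,
  Span-cong es (λ i → regroup α β (v i) (w i) t r (e i)) (Span-lin es α β sv sw)
  where
  regroup : ∀ α β v w t r e →
    α * (v - t * e) + β * (w - r * e) ≡ α * v + β * w - (α * t + β * r) * e
  regroup = solve-∀ ℚ-ring

Orthogonal : (Fin m → ℚ) → List (Fin m → ℚ) → Set
Orthogonal w = All λ e → dot w e ≡ 0ℚ

Span-⊥ : ∀ (w : Fin m → ℚ) {es v} → Orthogonal w es → Span es v → dot w v ≡ 0ℚ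
Span-⊥ {m} w [] v≡0 =
  trans (∑-cong λ i → trans (cong (w i *_) (v≡0 i)) (*-zeroʳ (w i))) (∑-0 m)
Span-⊥ w {e ∷ _} {v} (w⊥e ∷ w⊥es) (t , s) = begin
  dot w v                              ≡⟨ restore (dot w v) (t * dot w e) ⟩
  (dot w v - t * dot w e) + t * dot w e ≡⟨ cong₂ (λ x y → x + t * y)
                                            (trans (sym (dot-subʳ w v t e)) (Span-⊥ w w⊥es s)) w⊥e ⟩
  0ℚ + t * 0ℚ                          ≡⟨ trans (+-identityˡ (t * 0ℚ)) (*-zeroʳ t) ⟩
  0ℚ                                   ∎
  where
  open ≡-Reasoning
  restore : ∀ x y → x ≡ (x - y) + y
  restore = solve-∀ ℚ-ring

dot-residual : ∀ (u : Fin m → ℚ) {es} v w → Orthogonal u es → Span es (λ i → v i - w i) →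
               dot u v ≡ dot u w
dot-residual u v w u⊥es s = begin
  dot u v                              ≡⟨ dot-congʳ u (λ i → restore (v i) (w i)) ⟩
  dot u (λ i → w i - - 1ℚ * (v i - w i)) ≡⟨ dot-subʳ u w (- 1ℚ) (λ i → v i - w i) ⟩
  dot u w - - 1ℚ * dot u (λ i → v i - w i) ≡⟨ cong (λ x → dot u w - - 1ℚ * x) (Span-⊥ u u⊥es s) ⟩
  dot u w - - 1ℚ * 0ℚ                  ≡⟨ +-identityʳ (dot u w) ⟩
  dot u w                              ∎
  where
  open ≡-Reasoning
  restore : ∀ v w → v ≡ w - - 1ℚ * (v - w)
  restore = solve-∀ ℚ-ring

-- Gram-Schmidt: `f` is the part of `e` orthogonal to `es`, and removing the component of `w` along
-- `f` keeps it orthogonal to `es`. As e - f lies in the span of `es`, orthogonality to `f` gives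
-- orthogonality to `e`.
project : ∀ (es : List (Fin m → ℚ)) v →
          ∃[ w ] (Span es (λ i → v i - w i) × Orthogonal w es)
project [] v = v , (λ i → +-inverseʳ (v i)) , []
project (e ∷ es) v =
  let f , e-f , f⊥es = project es e
      w , v-w , w⊥es = project es v
      t , wf≡tff     = dot-coefficient w f
      w′⊥es = All.zipWith (λ {g} (wg≡0 , fg≡0) → trans (dot-subˡ w t f g)
        (trans (cong₂ (λ x y → x - t * y) wg≡0 fg≡0) (vanish t))) (w⊥es , f⊥es)
  in (λ i → w i - t * f i) ,
     (t , Span-cong es (λ i → regroup (v i) (w i) t (f i) (e i)) (Span-lin es 1ℚ (- t) v-w e-f)) ,
     trans (dot-residual (λ i → w i - t * f i) e f w′⊥es e-f) (trans (dot-subˡ w t f f)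
       (trans (cong (_- t * dot f f) wf≡tff) (+-inverseʳ (t * dot f f)))) ∷ w′⊥es
  where
  vanish : ∀ t → 0ℚ - t * 0ℚ ≡ 0ℚ
  vanish = solve-∀ ℚ-ring
  regroup : ∀ v w t f e → 1ℚ * (v - w) + - t * (e - f) ≡ (v - (w - t * f)) - t * e
  regroup = solve-∀ ℚ-ring

-- ‖A‖²_F ≤ rank(A) ‖A‖² for the operator norm ‖A‖, where the v j are the columns
-- of A; in the second case u witnesses ‖A‖² > Λ.
frobenius≤rank*norm : ∀ (es : List (Fin m → ℚ)) (v : Fin n → Fin m → ℚ) → (∀ j → Span es (v j)) →
  ∀ Λ → 0ℚ ≤ Λ →
  (∑ (λ j → dot (v j) (v j)) ≤ fromℕ (length es) * Λ) ⊎
  (∃[ u ] Λ * dot u u < ∑ (λ j → dot (v j) u * dot (v j) u))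
frobenius≤rank*norm {n = n} [] v v≡0 Λ 0≤Λ = inj₁ (≤-reflexive (trans
  (trans (∑-cong λ j → Span-⊥ (v j) {[]} [] (v≡0 j)) (∑-0 n)) (sym (*-zeroˡ Λ))))
frobenius≤rank*norm {m} {n} (e ∷ es) v span Λ 0≤Λ
  with project es e
-- Either `f`, the part of `e` orthogonal to the rest, is itself a witness, or the components of the
-- columns along `f` contribute at most `Λ` to the squared Frobenius norm, and the residues `w j`
-- lie in the span of `es`.
... | f , e-f , f⊥es with Λ * dot f f <? ∑ (λ j → dot (v j) f * dot (v j) f)
...   | yes f-witness = inj₂ (f , f-witness)
...   | no  ¬f-witness = combine (frobenius≤rank*norm es w w-span Λ 0≤Λ)
  where
  N = dot f f
  t : Fin n → ℚ
  t j = proj₁ (span j)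
  w : Fin n → Fin m → ℚ
  w j i = v j i - t j * f i
  w-span : ∀ j → Span es (w j)
  w-span j = Span-cong es (λ i → regroup (v j i) (t j) (e i) (f i))
    (Span-lin es 1ℚ (t j) (proj₂ (span j)) e-f)
    where
    regroup : ∀ v t e f → 1ℚ * (v - t * e) + t * (e - f) ≡ v - t * f
    regroup = solve-∀ ℚ-ring
  wf≡0 : ∀ j → dot (w j) f ≡ 0ℚ
  wf≡0 j = trans (dot-comm (w j) f) (Span-⊥ f f⊥es (w-span j))
  vf≡tN : ∀ j → dot (v j) f ≡ t j * N
  vf≡tN j = trans (restore (dot (v j) f) (t j * N))
    (trans (cong (_+ t j * N) (trans (sym (dot-subˡ (v j) (t j) f f)) (wf≡0 j))) (+-identityˡ (t j * N)))
    where
    restore : ∀ x y → x ≡ (x - y) + y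
    restore = solve-∀ ℚ-ring
  vv≡ : ∀ j → dot (v j) (v j) ≡ t j * t j * N + dot (w j) (w j)
  vv≡ j = sym (begin
    t j * t j * N + dot (w j) (w j)
      ≡⟨ cong (t j * t j * N +_) (trans (dot-subʳ (w j) (v j) (t j) f)
           (cong₂ (λ x y → x - t j * y) (dot-subˡ (v j) (t j) f (v j)) (wf≡0 j))) ⟩
    t j * t j * N + (dot (v j) (v j) - t j * dot f (v j) - t j * 0ℚ)
      ≡⟨ cong (λ x → t j * t j * N + (dot (v j) (v j) - t j * x - t j * 0ℚ))
           (trans (dot-comm f (v j)) (vf≡tN j)) ⟩
    t j * t j * N + (dot (v j) (v j) - t j * (t j * N) - t j * 0ℚ)
      ≡⟨ cancel (t j) N (dot (v j) (v j)) ⟩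
    dot (v j) (v j) ∎)
    where
    open ≡-Reasoning
    cancel : ∀ t N s → t * t * N + (s - t * (t * N) - t * 0ℚ) ≡ s
    cancel = solve-∀ ℚ-ring
  τ = ∑ λ j → t j * t j * N
  τN≤ΛN : N * τ ≤ N * Λ
  τN≤ΛN = begin
    N * τ                                  ≡⟨ sym (∑-*ˡ N (λ j → t j * t j * N)) ⟩
    ∑ (λ j → N * (t j * t j * N))          ≡⟨ ∑-cong (λ j → trans (regroup (t j) N)
                                                (sym (cong₂ _*_ (vf≡tN j) (vf≡tN j)))) ⟩
    ∑ (λ j → dot (v j) f * dot (v j) f)    ≤⟨ ≮⇒≥ ¬f-witness ⟩
    Λ * N                                  ≡⟨ *-comm Λ N ⟩
    N * Λ                                  ∎
    where
    open ≤-Reasoning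
    regroup : ∀ t N → N * (t * t * N) ≡ t * N * (t * N)
    regroup = solve-∀ ℚ-ring
  τ≤Λ : τ ≤ Λ
  τ≤Λ with <-cmp 0ℚ N
  ... | tri< 0<N _ _ = *-cancelˡ-≤ 0<N τN≤ΛN
  -- For `f` = 0 there is no division by ‖f‖², but then `τ` is 0.
  ... | tri≈ _ 0≡N _ = ≤-trans (≤-reflexive (trans
    (∑-cong λ j → trans (cong (t j * t j *_) (sym 0≡N)) (*-zeroʳ (t j * t j))) (∑-0 n))) 0≤Λ
  ... | tri> _ _ N<0 = ⊥-elim (<-irrefl refl (<-≤-trans N<0 (0≤dot f)))
  combine : (∑ (λ j → dot (w j) (w j)) ≤ fromℕ (length es) * Λ) ⊎
            (∃[ u ] Λ * dot u u < ∑ (λ j → dot (w j) u * dot (w j) u)) →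
            (∑ (λ j → dot (v j) (v j)) ≤ fromℕ (suc (length es)) * Λ) ⊎
            (∃[ u ] Λ * dot u u < ∑ (λ j → dot (v j) u * dot (v j) u))
  combine (inj₁ bound) = inj₁ (begin
    ∑ (λ j → dot (v j) (v j))                ≡⟨ trans (∑-cong vv≡) (∑-+ _ (λ j → dot (w j) (w j))) ⟩
    τ + ∑ (λ j → dot (w j) (w j))            ≤⟨ +-mono-≤ τ≤Λ bound ⟩
    Λ + fromℕ (length es) * Λ                ≡⟨ distrib Λ (fromℕ (length es)) ⟩
    (1ℚ + fromℕ (length es)) * Λ             ≡⟨ cong (_* Λ) (sym (fromℕ-suc (length es))) ⟩
    fromℕ (suc (length es)) * Λ              ∎)
    where
    open ≤-Reasoning
    distrib : ∀ s t → s + t * s ≡ (1ℚ + t) * s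
    distrib = solve-∀ ℚ-ring
  -- A witness `u` for the residues is made orthogonal to `f`. This does not increase its norm, and
  -- the products of the columns `v j` with the new vector equal those of the residues `w j` with
  -- `u`.
  combine (inj₂ (u , witness)) = inj₂ (u′ , (begin-strict
    Λ * dot u′ u′                             ≤⟨ *-monoˡ 0≤Λ u′u′≤uu ⟩
    Λ * dot u u                               <⟨ witness ⟩
    ∑ (λ j → dot (w j) u * dot (w j) u)       ≡⟨ ∑-cong (λ j → sym (cong₂ _*_ (vu′≡wu j) (vu′≡wu j))) ⟩
    ∑ (λ j → dot (v j) u′ * dot (v j) u′)     ∎))
    where
    open ≤-Reasoning
    r = proj₁ (dot-coefficient u f)
    u′ : Fin m → ℚ
    u′ i = u i - r * f i
    u′f≡0 : dot u′ f ≡ 0ℚ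
    u′f≡0 = trans (dot-subˡ u r f f)
      (trans (cong (_- r * N) (proj₂ (dot-coefficient u f))) (+-inverseʳ (r * N)))
    u′u′≤uu : dot u′ u′ ≤ dot u u
    u′u′≤uu = ≤-by (r * r * N) (0≤* (0≤sq r) (0≤dot f)) (≡-Reasoning.begin
      dot u u                        ≡-Reasoning.≡⟨ expand (dot u u) r N ⟩
      (dot u u - r * (r * N) - r * 0ℚ) + r * r * N
        ≡-Reasoning.≡⟨ cong (_+ r * r * N) (sym (trans (dot-subʳ u′ u r f)
          (cong₂ (λ x y → x - r * y)
            (trans (dot-subˡ u r f u) (cong (λ x → dot u u - r * x)
              (trans (dot-comm f u) (proj₂ (dot-coefficient u f)))))
            u′f≡0))) ⟩
      dot u′ u′ + r * r * N          ≡-Reasoning.∎)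
      where
      expand : ∀ s r N → s ≡ (s - r * (r * N) - r * 0ℚ) + r * r * N
      expand = solve-∀ ℚ-ring
    vu′≡wu : ∀ j → dot (v j) u′ ≡ dot (w j) u
    vu′≡wu j = ≡-Reasoning.begin
      dot (v j) u′                        ≡-Reasoning.≡⟨ restore (dot (v j) u′) (t j) ⟩
      dot (v j) u′ - t j * 0ℚ             ≡-Reasoning.≡⟨ cong (λ x → dot (v j) u′ - t j * x)
                                               (sym (trans (dot-comm f u′) u′f≡0)) ⟩
      dot (v j) u′ - t j * dot f u′       ≡-Reasoning.≡⟨ sym (dot-subˡ (v j) (t j) f u′) ⟩
      dot (w j) u′                        ≡-Reasoning.≡⟨ dot-subʳ (w j) u r f ⟩
      dot (w j) u - r * dot (w j) f       ≡-Reasoning.≡⟨ cong (λ x → dot (w j) u - r * x) (wf≡0 j) ⟩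
      dot (w j) u - r * 0ℚ                ≡-Reasoning.≡⟨ sym (restore (dot (w j) u) r) ⟩
      dot (w j) u                         ≡-Reasoning.∎
      where
      restore : ∀ x t → x ≡ x - t * 0ℚ
      restore = solve-∀ ℚ-ring

-- Rank

Span-tabulate : ∀ {k} (v : Fin k → Fin m → ℚ) (a : Fin k → ℚ) →
                Span (tabulate v) (λ i → ∑ λ l → a l * v l i)
Span-tabulate {k = zero}  v a i = refl
Span-tabulate {k = suc k} v a = a zero ,
  Span-cong (tabulate (v ∘ suc)) (λ i → cancel (a zero * v zero i) _)
    (Span-tabulate (v ∘ suc) (a ∘ suc))
  where
  cancel : ∀ x y → y ≡ (x + y) - x
  cancel = solve-∀ ℚ-ring

-- A maximal independent family of columns spans: a column with a nonzero residue `w` could be added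
-- to it, against the maximality of `ρ`.
column-span : ∀ {A : Matrix ℚ m n} {ρ} → HasRank A ρ →
              ∃[ es ] (length es ≡ ρ × ∀ j → Span es (λ i → A i j))
column-span {m} {n} {A} {ρ} ((s , independent) , maximal) = es , length-tabulate cols , spans
  where
  cols : Fin ρ → Fin m → ℚ
  cols l i = A i (s l)
  es = tabulate cols
  spans : ∀ j → Span es (λ i → A i j)
  spans j with project es (λ i → A i j)
  ... | w , v-w , w⊥es with dot w w ≟ 0ℚ
  ...   | yes w²≡0 = Span-cong es (λ i → trans (cong (λ x → A i j - x) (dot≡0⇒≡0 w w²≡0 i))
                                           (+-identityʳ (A i j))) v-w
  ...   | no  w²≢0 = ⊥-elim (ℕ.<-irrefl refl (maximal s′ independent′))
    where
    s′ : Fin (suc ρ) → Fin n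
    s′ zero    = j
    s′ (suc l) = s l
    independent′ : IndependentColumns A s′
    independent′ a a·A≡0 = λ { zero → a₀≡0 ; (suc l) → independent (a ∘ suc) tail≡0 l }
      where
      a₀ = a zero
      v : Fin m → ℚ
      v i = ∑ λ l → a (suc l) * cols l i
      wv≡0 : dot w v ≡ 0ℚ
      wv≡0 = Span-⊥ w w⊥es (Span-tabulate cols (a ∘ suc))
      -- Pairing the relation with `w` kills the old columns and leaves ‖w‖² times the new
      -- coefficient.
      w²a₀≡0 : dot w w * a₀ ≡ 0ℚ
      w²a₀≡0 = begin
        dot w w * a₀                            ≡⟨ cong (_* a₀) (sym (dot-residual w (λ i → A i j) w w⊥es v-w)) ⟩
        dot w (λ i → A i j) * a₀                ≡⟨ neg-neg (dot w (λ i → A i j)) a₀ ⟩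
        0ℚ - - a₀ * dot w (λ i → A i j)         ≡⟨ cong (λ x → x - - a₀ * dot w (λ i → A i j)) (sym wv≡0) ⟩
        dot w v - - a₀ * dot w (λ i → A i j)    ≡⟨ sym (dot-subʳ w v (- a₀) (λ i → A i j)) ⟩
        dot w (λ i → v i - - a₀ * A i j)        ≡⟨ dot-congʳ w (λ i → trans (flip (v i) a₀ (A i j)) (a·A≡0 i)) ⟩
        dot w (λ _ → 0ℚ)                        ≡⟨ trans (∑-cong λ i → *-zeroʳ (w i)) (∑-0 m) ⟩
        0ℚ                                      ∎
        where
        open ≡-Reasoning
        neg-neg : ∀ x a → x * a ≡ 0ℚ - - a * x
        neg-neg = solve-∀ ℚ-ring
        flip : ∀ v a x → v - - a * x ≡ a * x + v
        flip = solve-∀ ℚ-ring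
      0<w² : 0ℚ < dot w w
      0<w² with <-cmp 0ℚ (dot w w)
      ... | tri< 0<w² _ _ = 0<w²
      ... | tri≈ _ 0≡w² _ = ⊥-elim (w²≢0 (sym 0≡w²))
      ... | tri> _ _ w²<0 = ⊥-elim (<-irrefl refl (<-≤-trans w²<0 (0≤dot w)))
      a₀≡0 : a₀ ≡ 0ℚ
      a₀≡0 = ≤-antisym
        (*-cancelˡ-≤ 0<w² (≤-reflexive (trans w²a₀≡0 (sym (*-zeroʳ (dot w w))))))
        (*-cancelˡ-≤ 0<w² (≤-reflexive (trans (*-zeroʳ (dot w w)) (sym w²a₀≡0))))
      tail≡0 : ∀ i → v i ≡ 0ℚ
      tail≡0 i = trans (sym (+-identityˡ (v i))) (trans (cong (_+ v i)
        (sym (trans (cong (_* A i j) a₀≡0) (*-zeroˡ (A i j))))) (a·A≡0 i))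

-- The greedy construction

-- The factors n and m charge rows and columns alike: for the all-ones pair each of the two terms of
-- `weight` is m n.
row-weight col-weight weight : Pair m n → ℚ
row-weight z = dot (z ∘ inj₁) (z ∘ inj₁)
col-weight z = dot (z ∘ inj₂) (z ∘ inj₂)
weight {m} {n} z = fromℕ n * row-weight z + fromℕ m * col-weight z

-- The squared length of the vector encoded at `i`; `Unit` says that all loads are at most 1.
load : I → List (I → ℚ) → ℚ
load i = total λ z → z i * z i

0≤load : ∀ (i : I) zs → 0ℚ ≤ load i zs
0≤load i []       = ≤-refl
0≤load i (z ∷ zs) = 0≤+ (0≤sq (z i)) (0≤load i zs)

total-weight : ∀ (zs : List (Pair m n)) → total weight zs ≡
  fromℕ n * ∑ (λ i → load (inj₁ i) zs) + fromℕ m * ∑ (λ j → load (inj₂ j) zs)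
total-weight {m} {n} zs = trans (total-lin (fromℕ n) (fromℕ m) row-weight col-weight zs)
  (cong₂ (λ x y → fromℕ n * x + fromℕ m * y)
    (total-∑ (λ z i → z (inj₁ i) * z (inj₁ i)) zs) (total-∑ (λ z j → z (inj₂ j) * z (inj₂ j)) zs))

scaled-copies : ℕ → ℚ → (I → ℚ) → List (I → ℚ)
scaled-copies k β z = replicate k λ i → β * z i

module _ (k : ℕ) (β : ℚ) where

  private
    square : ∀ l β x → l * (β * x * (β * x)) ≡ l * (β * β) * (x * x)
    square = solve-∀ ℚ-ring

  load-scaled-copies : ∀ (z : I → ℚ) i →
    load i (scaled-copies k β z) ≡ fromℕ k * (β * β) * (z i * z i)
  load-scaled-copies z i = trans (total-replicate _ k _) (square (fromℕ k) β (z i))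

  weight-scaled-copies : ∀ (z : Pair m n) →
    total weight (scaled-copies k β z) ≡ fromℕ k * (β * β) * weight z
  weight-scaled-copies {m} {n} z = begin
    total weight (scaled-copies k β z)
      ≡⟨ total-weight (scaled-copies k β z) ⟩
    fromℕ n * ∑ (λ i → load (inj₁ i) (scaled-copies k β z)) +
    fromℕ m * ∑ (λ j → load (inj₂ j) (scaled-copies k β z))
      ≡⟨ cong₂ (λ x y → fromℕ n * x + fromℕ m * y)
           (trans (∑-cong λ i → load-scaled-copies z (inj₁ i)) (∑-*ˡ t (λ i → z (inj₁ i) * z (inj₁ i))))
           (trans (∑-cong λ j → load-scaled-copies z (inj₂ j)) (∑-*ˡ t (λ j → z (inj₂ j) * z (inj₂ j)))) ⟩
    fromℕ n * (t * row-weight z) + fromℕ m * (t * col-weight z)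
      ≡⟨ collect (fromℕ n) (fromℕ m) t (row-weight z) (col-weight z) ⟩
    t * weight z ∎
    where
    open ≡-Reasoning
    t = fromℕ k * (β * β)
    collect : ∀ n m t x y → n * (t * x) + m * (t * y) ≡ t * (n * x + m * y)
    collect = solve-∀ ℚ-ring

  gain-scaled-copies : ∀ (A : Matrix ℚ m n) z →
    gain A (scaled-copies k β z) ≡ fromℕ k * (β * β) * form A (z ∘ inj₁) (z ∘ inj₂)
  gain-scaled-copies A z = trans (total-replicate _ k _)
    (trans (cong (fromℕ k *_) (form-scale A β β (z ∘ inj₁) (z ∘ inj₂)))
      (sym (*-assoc (fromℕ k) (β * β) (form A (z ∘ inj₁) (z ∘ inj₂)))))

Large : Subset n → Set
Large {n} X = fromℕ 7 * fromℕ n ≤ fromℕ 8 * ∑ (ind X)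

threshold : ∀ (f : Fin n → ℚ) t →
            ∃[ X ] (∀ i → (ind X i ≡ 1ℚ × f i ≤ t) ⊎ (ind X i ≡ 0ℚ × t ≤ f i))
threshold {zero}  f t = [] , λ ()
threshold {suc n} f t with threshold (f ∘ suc) t | ≤-total (f zero) t
... | X , h | inj₁ f≤t = inside ∷ X , λ { zero → inj₁ (refl , f≤t) ; (suc i) → h i }
... | X , h | inj₂ t≤f = outside ∷ X , λ { zero → inj₂ (refl , t≤f) ; (suc i) → h i }

-- An excluded index has f i ≥ 8 t, and a mean of at most `t` leaves room for at most n/8 of these.
markov : ∀ (f : Fin n → ℚ) {t} → 0ℚ < t → (∀ i → 0ℚ ≤ f i) → ∑ f ≤ t * fromℕ n →
         ∃[ X ] (Large X × (∀ i → f i ≤ fromℕ 8 * t ⊎ ind X i ≡ 0ℚ))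
markov {n} f {t} 0<t 0≤f ∑f≤ = X , large , below
  where
  open ≤-Reasoning
  X = proj₁ (threshold f (fromℕ 8 * t))
  h = proj₂ (threshold f (fromℕ 8 * t))
  below : ∀ i → f i ≤ fromℕ 8 * t ⊎ ind X i ≡ 0ℚ
  below i with h i
  ... | inj₁ (_ , f≤) = inj₁ f≤
  ... | inj₂ (X≡0 , _) = inj₂ X≡0
  outside≤ : ∀ i → fromℕ 8 * t * 1ℚ + - (fromℕ 8 * t) * ind X i ≤ f i
  outside≤ i with ind X i | h i
  ... | _ | inj₁ (refl , _) = ≤-trans (≤-reflexive (vanish (fromℕ 8 * t))) (0≤f i)
    where
    vanish : ∀ s → s * 1ℚ + - s * 1ℚ ≡ 0ℚ
    vanish = solve-∀ ℚ-ring
  ... | _ | inj₂ (refl , ≤f) = ≤-trans (≤-reflexive (keep (fromℕ 8 * t))) ≤f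
    where
    keep : ∀ s → s * 1ℚ + - s * 0ℚ ≡ s
    keep = solve-∀ ℚ-ring
  large : Large X
  large = *-cancelˡ-≤ 0<t (≤-by _ (0≤-diff (begin
    fromℕ 8 * t * (fromℕ n * 1ℚ) + - (fromℕ 8 * t) * ∑ (ind X)
      ≡⟨ cong (λ x → fromℕ 8 * t * x + - (fromℕ 8 * t) * ∑ (ind X)) (sym (∑-const n 1ℚ)) ⟩
    fromℕ 8 * t * ∑ {n} (λ _ → 1ℚ) + - (fromℕ 8 * t) * ∑ (ind X)
      ≡⟨ sym (∑-lin (fromℕ 8 * t) (- (fromℕ 8 * t)) (λ _ → 1ℚ) (ind X)) ⟩
    ∑ (λ i → fromℕ 8 * t * 1ℚ + - (fromℕ 8 * t) * ind X i)
      ≤⟨ ∑-mono outside≤ ⟩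
    ∑ f
      ≤⟨ ∑f≤ ⟩
    t * fromℕ n ∎)) (rearrange t (fromℕ n) (∑ (ind X))))
    where
    rearrange : ∀ t n s → t * (fromℕ 8 * s) ≡ t * (fromℕ 7 * n) +
      (t * n - (fromℕ 8 * t * (n * 1ℚ) + - (fromℕ 8 * t) * s))
    rearrange = solve-∀ ℚ-ring

Efficient : Matrix ℚ m n → ℚ → Subset m → Subset n → Pair m n → Set
Efficient A γ X Y z =
  (∀ i → ind X i ≡ 0ℚ → z (inj₁ i) ≡ 0ℚ) × (∀ j → ind Y j ≡ 0ℚ → z (inj₂ j) ≡ 0ℚ) ×
  0ℚ < weight z × γ * weight z ≤ form A (z ∘ inj₁) (z ∘ inj₂)

record Increment (A : Matrix ℚ m n) (γ : ℚ) (X : Subset m) (Y : Subset n) : Set where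
  field
    vectors     : List (Pair m n)
    weight≡     : total weight vectors ≡ fromℕ m * fromℕ n
    gain≥       : γ * (fromℕ m * fromℕ n) ≤ gain A vectors
    row-load≤   : ∀ i → load (inj₁ i) vectors ≤ fromℕ m
    col-load≤   : ∀ j → load (inj₂ j) vectors ≤ fromℕ n
    row-support : ∀ i → ind X i ≡ 0ℚ → load (inj₁ i) vectors ≡ 0ℚ
    col-support : ∀ j → ind Y j ≡ 0ℚ → load (inj₂ j) vectors ≡ 0ℚ

-- Once the pair is scaled to weight m n, n times the load of a row is at most m n, and likewise for
-- columns, whence the load bounds `m` and `n`. The factor l β² leaves the ratio of gain to weight
-- unchanged.
increment′ : ∀ {A : Matrix ℚ m n} {γ X Y} → 0ℚ < fromℕ m → 0ℚ < fromℕ n →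
             ∀ z → Efficient A γ X Y z → ∀ l β →
             fromℕ l * (β * β) * weight z ≡ fromℕ m * fromℕ n → Increment A γ X Y
increment′ {m} {n} {A} {γ} {X} {Y} 0<M 0<N z (z-rows , z-cols , 0<weight , z-gain) l β eq = record
  { vectors     = ws
  ; weight≡     = trans (weight-scaled-copies l β z) eq
  ; gain≥       = begin
      γ * (M * N)          ≡⟨ cong (γ *_) (sym eq) ⟩
      γ * (κ * weight z)   ≡⟨ swap γ κ (weight z) ⟩
      κ * (γ * weight z)   ≤⟨ *-monoˡ 0≤κ z-gain ⟩
      κ * form A (z ∘ inj₁) (z ∘ inj₂) ≡⟨ sym (gain-scaled-copies l β A z) ⟩
      gain A ws            ∎
  ; row-load≤   = λ i → *-cancelˡ-≤ 0<N (begin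
      N * load (inj₁ i) ws                 ≡⟨ cong (N *_) (load-scaled-copies l β z (inj₁ i)) ⟩
      N * (κ * (z (inj₁ i) * z (inj₁ i)))
        ≤⟨ *-monoˡ (0≤fromℕ n) (*-monoˡ 0≤κ (term≤∑ (λ i′ → 0≤sq (z (inj₁ i′))) i)) ⟩
      N * (κ * row-weight z)
        ≤⟨ ≤-by (κ * M * col-weight z) (0≤* (0≤* 0≤κ (0≤fromℕ m)) (0≤dot (z ∘ inj₂)))
             (expand-row N M κ (row-weight z) (col-weight z)) ⟩
      κ * weight z                         ≡⟨ trans eq (*-comm M N) ⟩
      N * M                                ∎)
  ; col-load≤   = λ j → *-cancelˡ-≤ 0<M (begin
      M * load (inj₂ j) ws                 ≡⟨ cong (M *_) (load-scaled-copies l β z (inj₂ j)) ⟩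
      M * (κ * (z (inj₂ j) * z (inj₂ j)))
        ≤⟨ *-monoˡ (0≤fromℕ m) (*-monoˡ 0≤κ (term≤∑ (λ j′ → 0≤sq (z (inj₂ j′))) j)) ⟩
      M * (κ * col-weight z)
        ≤⟨ ≤-by (κ * N * row-weight z) (0≤* (0≤* 0≤κ (0≤fromℕ n)) (0≤dot (z ∘ inj₁)))
             (expand-col N M κ (row-weight z) (col-weight z)) ⟩
      κ * weight z                         ≡⟨ eq ⟩
      M * N                                ∎)
  ; row-support = λ i X≡0 → no-load (inj₁ i) (z-rows i X≡0)
  ; col-support = λ j Y≡0 → no-load (inj₂ j) (z-cols j Y≡0)
  }
  where
  open ≤-Reasoning
  M = fromℕ m
  N = fromℕ n
  κ = fromℕ l * (β * β)
  ws = scaled-copies l β z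
  0≤κ : 0ℚ ≤ κ
  0≤κ = 0≤* (0≤fromℕ l) (0≤sq β)
  no-load : ∀ i → z i ≡ 0ℚ → load i ws ≡ 0ℚ
  no-load i z≡0 = trans (load-scaled-copies l β z i)
    (trans (cong (λ x → κ * (x * x)) z≡0) (*-zeroʳ κ))
  swap : ∀ g k w → g * (k * w) ≡ k * (g * w)
  swap = solve-∀ ℚ-ring
  expand-row : ∀ N M κ r c → κ * (N * r + M * c) ≡ N * (κ * r) + κ * M * c
  expand-row = solve-∀ ℚ-ring
  expand-col : ∀ N M κ r c → κ * (N * r + M * c) ≡ M * (κ * c) + κ * N * r
  expand-col = solve-∀ ℚ-ring

increment : .{{_ : NonZero m}} .{{_ : NonZero n}} →
            ∀ {A : Matrix ℚ m n} {γ X Y} z → Efficient A γ X Y z → Increment A γ X Y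
increment {m} {n} z eff@(_ , _ , 0<weight , _) =
  let r , 0<r , wr≡1 = inverse 0<weight
      l , β , κ≡     = multiple-of-square (M * N * r) (<⇒≤ (0<* (0<* 0<M 0<N) 0<r))
  in increment′ 0<M 0<N z eff l β (rescale (M * N) r (weight z) κ≡ wr≡1)
  where
  M = fromℕ m
  N = fromℕ n
  0<M = fromℕ-pos m
  0<N = fromℕ-pos n
  swap : ∀ W r w → W * r * w ≡ W * (w * r)
  swap = solve-∀ ℚ-ring
  rescale : ∀ W r w {κ} → κ ≡ W * r → w * r ≡ 1ℚ → κ * w ≡ W
  rescale W r w refl wr≡1 = trans (swap W r w) (trans (cong (W *_) wr≡1) (*-identityʳ W))

-- `t` counts the rounds, each of weight m n, and `T` is the limit imposed on them. A coordinate is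
-- charged only while its load is at most 8 T, so the bound is passed by at most one charge, which
-- is no more than `m` or `n`.
record Greedy (A : Matrix ℚ m n) (γ T t : ℚ) : Set where
  field
    vectors : List (Pair m n)
    weight≡ : total weight vectors ≡ t * (fromℕ m * fromℕ n)
    gain≥   : γ * (t * (fromℕ m * fromℕ n)) ≤ gain A vectors
    load≤   : ∀ i → load i vectors ≤ fromℕ 8 * T + (fromℕ m + fromℕ n)

-- The weight bounds the sum of the row loads by T m and that of the column loads by T n, so the
-- mean load is at most `T` on both sides.
light : ∀ (zs : List (Pair m n)) {T} → 0ℚ < T → 0ℚ < fromℕ m → 0ℚ < fromℕ n →
        total weight zs ≤ T * (fromℕ m * fromℕ n) →
        (∃[ X ] (Large X × (∀ i → load (inj₁ i) zs ≤ fromℕ 8 * T ⊎ ind X i ≡ 0ℚ))) ×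
        (∃[ Y ] (Large Y × (∀ j → load (inj₂ j) zs ≤ fromℕ 8 * T ⊎ ind Y j ≡ 0ℚ)))
light {m} {n} zs {T} 0<T 0<M 0<N weight≤ =
  markov (λ i → load (inj₁ i) zs) 0<T (λ i → 0≤load (inj₁ i) zs) rows≤ ,
  markov (λ j → load (inj₂ j) zs) 0<T (λ j → 0≤load (inj₂ j) zs) cols≤
  where
  M = fromℕ m
  N = fromℕ n
  rows = ∑ λ i → load (inj₁ i) zs
  cols = ∑ λ j → load (inj₂ j) zs
  weight≤′ : N * rows + M * cols ≤ T * (M * N)
  weight≤′ = subst (_≤ T * (M * N)) (total-weight zs) weight≤
  rows≤ : rows ≤ T * M
  rows≤ = *-cancelˡ-≤ 0<N (≤-by ((T * (M * N) - (N * rows + M * cols)) + M * cols)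
    (0≤+ (0≤-diff weight≤′) (0≤* (0≤fromℕ m) (0≤∑ λ j → 0≤load (inj₂ j) zs)))
    (identity T M N rows cols))
    where
    identity : ∀ T M N r c →
      N * (T * M) ≡ N * r + ((T * (M * N) - (N * r + M * c)) + M * c)
    identity = solve-∀ ℚ-ring
  cols≤ : cols ≤ T * N
  cols≤ = *-cancelˡ-≤ 0<M (≤-by ((T * (M * N) - (N * rows + M * cols)) + N * rows)
    (0≤+ (0≤-diff weight≤′) (0≤* (0≤fromℕ n) (0≤∑ λ i → 0≤load (inj₁ i) zs)))
    (identity T M N rows cols))
    where
    identity : ∀ T M N r c →
      M * (T * N) ≡ M * c + ((T * (M * N) - (N * r + M * c)) + N * r)
    identity = solve-∀ ℚ-ring

load-++ : ∀ (i : I) ws zs {u v} → load i ws ≤ u → load i zs ≤ v → load i (ws ++ zs) ≤ v + u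
load-++ i ws zs {u} {v} ws≤ zs≤ = subst (_≤ v + u)
  (trans (+-comm (load i zs) (load i ws)) (sym (total-++ (λ z → z i * z i) ws zs)))
  (+-mono-≤ zs≤ ws≤)

load-++-0 : ∀ (i : I) ws zs → load i ws ≡ 0ℚ → load i (ws ++ zs) ≡ load i zs
load-++-0 i ws zs ws≡0 = trans (total-++ (λ z → z i * z i) ws zs)
  (trans (cong (_+ load i zs) ws≡0) (+-identityˡ (load i zs)))

greedy-∷ : ∀ {A : Matrix ℚ m n} {γ T t} (G : Greedy A γ T t) X Y →
  (∀ i → load (inj₁ i) (Greedy.vectors G) ≤ fromℕ 8 * T ⊎ ind X i ≡ 0ℚ) →
  (∀ j → load (inj₂ j) (Greedy.vectors G) ≤ fromℕ 8 * T ⊎ ind Y j ≡ 0ℚ) →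
  Increment A γ X Y → Greedy A γ T (1ℚ + t)
greedy-∷ {m} {n} {A} {γ} {T} {t} G X Y light-rows light-cols I = record
  { vectors = ws ++ zs
  ; weight≡ = trans (total-++ weight ws zs)
      (trans (cong₂ _+_ I.weight≡ G.weight≡) (distrib (M * N) t))
  ; gain≥   = begin
      γ * ((1ℚ + t) * (M * N))         ≡⟨ distribˡ γ (M * N) t ⟩
      γ * (M * N) + γ * (t * (M * N))  ≤⟨ +-mono-≤ I.gain≥ G.gain≥ ⟩
      gain A ws + gain A zs            ≡⟨ sym (total-++ (λ z → form A (z ∘ inj₁) (z ∘ inj₂)) ws zs) ⟩
      gain A (ws ++ zs)                ∎
  ; load≤   = λ { (inj₁ i) → row i (light-rows i) ; (inj₂ j) → col j (light-cols j) }
  }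
  where
  open ≤-Reasoning
  module I = Increment I
  module G = Greedy G
  M = fromℕ m
  N = fromℕ n
  ws = I.vectors
  zs = G.vectors
  distrib : ∀ w t → w + t * w ≡ (1ℚ + t) * w
  distrib = solve-∀ ℚ-ring
  distribˡ : ∀ g w t → g * ((1ℚ + t) * w) ≡ g * w + g * (t * w)
  distribˡ = solve-∀ ℚ-ring
  row : ∀ i → load (inj₁ i) zs ≤ fromℕ 8 * T ⊎ ind X i ≡ 0ℚ →
        load (inj₁ i) (ws ++ zs) ≤ fromℕ 8 * T + (M + N)
  row i (inj₁ ≤8T) = load-++ (inj₁ i) ws zs
    (≤-trans (I.row-load≤ i) (≤-by N (0≤fromℕ n) refl)) ≤8T
  row i (inj₂ X≡0) = subst (_≤ fromℕ 8 * T + (M + N))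
    (sym (load-++-0 (inj₁ i) ws zs (I.row-support i X≡0))) (G.load≤ (inj₁ i))
  col : ∀ j → load (inj₂ j) zs ≤ fromℕ 8 * T ⊎ ind Y j ≡ 0ℚ →
        load (inj₂ j) (ws ++ zs) ≤ fromℕ 8 * T + (M + N)
  col j (inj₁ ≤8T) = load-++ (inj₂ j) ws zs
    (≤-trans (I.col-load≤ j) (≤-by M (0≤fromℕ m) (+-comm M N))) ≤8T
  col j (inj₂ Y≡0) = subst (_≤ fromℕ 8 * T + (M + N))
    (sym (load-++-0 (inj₂ j) ws zs (I.col-support j Y≡0))) (G.load≤ (inj₂ j))

-- Vectors supported on the rows and columns of small load are added until the
-- total weight is t m n. The total load of the rows being at most t m, only a
-- few rows are excluded at any time, and similarly for the columns.
greedy : .{{_ : NonZero m}} .{{_ : NonZero n}} → ∀ {A : Matrix ℚ m n} {γ T} → 0ℚ < T →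
  (∀ X Y → Large X → Large Y → ∃[ z ] Efficient A γ X Y z) →
  ∀ t → fromℕ t ≤ T → Greedy A γ T (fromℕ t)
greedy {m} {n} {A} {γ} {T} 0<T efficient zero _ = record
  { vectors = []
  ; weight≡ = sym (*-zeroˡ (fromℕ m * fromℕ n))
  ; gain≥   = ≤-reflexive (trans (cong (γ *_) (*-zeroˡ (fromℕ m * fromℕ n))) (*-zeroʳ γ))
  ; load≤   = λ _ → 0≤+ (0≤* (0≤fromℕ 8) (<⇒≤ 0<T)) (0≤+ (0≤fromℕ m) (0≤fromℕ n))
  }
greedy {m} {n} {A} {γ} {T} 0<T efficient (suc t) 1+t≤T =
  subst (Greedy A γ T) (sym (fromℕ-suc t)) (extend (greedy 0<T efficient t t≤T))
  where
  t≤T : fromℕ t ≤ T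
  t≤T = ≤-trans (fromℕ-mono (ℕ.n≤1+n t)) 1+t≤T
  0≤W : 0ℚ ≤ fromℕ m * fromℕ n
  0≤W = 0≤* (0≤fromℕ m) (0≤fromℕ n)
  extend : Greedy A γ T (fromℕ t) → Greedy A γ T (1ℚ + fromℕ t)
  extend G =
    let (X , X-large , light-rows) , (Y , Y-large , light-cols) =
          light G.vectors 0<T (fromℕ-pos m) (fromℕ-pos n)
            (≤-trans (≤-reflexive G.weight≡) (*-monoʳ 0≤W t≤T))
        z , z-efficient = efficient X Y X-large Y-large
    in greedy-∷ G X Y light-rows light-cols (increment z z-efficient)
    where
    module G = Greedy G

-- With S = m + n and T = S² rounds, the overshoot of a last charge is absorbed: the loads are at
-- most 8 S² + S ≤ 9 S². That `T` is a perfect square lets σ = 1/(3 S) rescale the vectors to norm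
-- at most 1 within the rationals.
greedy-bound : .{{_ : NonZero m}} .{{_ : NonZero n}} → ∀ {A : Matrix ℚ m n} {γ G} → Bounded A G →
  (∀ X Y → Large X → Large Y → ∃[ z ] Efficient A γ X Y z) →
  γ * (fromℕ m * fromℕ n) ≤ fromℕ 9 * G
greedy-bound {m} {n} {A} {γ} {G} bounded efficient =
  let σ , _ , 3Sσ≡1 = inverse {fromℕ 3 * S} (0<* (positive⁻¹ (fromℕ 3)) 0<S)
  in conclude σ 3Sσ≡1 (greedy 0<T efficient ((m ℕ.+ n) ℕ.* (m ℕ.+ n)) (≤-reflexive T≡))
  where
  S = fromℕ m + fromℕ n
  T = S * S
  W = fromℕ m * fromℕ n
  0<S : 0ℚ < S
  0<S = 0<+ (fromℕ-pos m) (0≤fromℕ n)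
  0<T : 0ℚ < T
  0<T = 0<* 0<S 0<S
  T≡ : fromℕ ((m ℕ.+ n) ℕ.* (m ℕ.+ n)) ≡ T
  T≡ = trans (fromℕ-* (m ℕ.+ n) (m ℕ.+ n)) (cong₂ _*_ (fromℕ-+ m n) (fromℕ-+ m n))
  1≤S : 1ℚ ≤ S
  1≤S = subst (1ℚ ≤_) (fromℕ-+ m n)
    (fromℕ-mono {1} {m ℕ.+ n} (ℕ.≤-trans (ℕ.>-nonZero⁻¹ m) (ℕ.m≤m+n m n)))
  8T+S≤9T : fromℕ 8 * T + S ≤ fromℕ 9 * T
  8T+S≤9T = ≤-by (S * (S - 1ℚ)) (0≤* (<⇒≤ 0<S) (0≤-diff 1≤S)) (identity S)
    where
    identity : ∀ S → fromℕ 9 * (S * S) ≡ fromℕ 8 * (S * S) + S + S * (S - 1ℚ)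
    identity = solve-∀ ℚ-ring
  conclude : ∀ σ → fromℕ 3 * S * σ ≡ 1ℚ → Greedy A γ T (fromℕ ((m ℕ.+ n) ℕ.* (m ℕ.+ n))) →
             γ * W ≤ fromℕ 9 * G
  conclude σ 3Sσ≡1 greedy = *-cancelˡ-≤ 0<T (begin
    T * (γ * W)                          ≡⟨ swap T γ W ⟩
    γ * (T * W)                          ≡⟨ cong (λ t → γ * (t * W)) (sym T≡) ⟩
    γ * (fromℕ ((m ℕ.+ n) ℕ.* (m ℕ.+ n)) * W) ≤⟨ gain≥ ⟩
    gain A vectors                       ≡⟨ sym (trans (cong (_* gain A vectors) 9Tσσ≡1)
                                              (*-identityˡ (gain A vectors))) ⟩
    fromℕ 9 * T * (σ * σ) * gain A vectors ≡⟨ *-assoc (fromℕ 9 * T) (σ * σ) (gain A vectors) ⟩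
    fromℕ 9 * T * (σ * σ * gain A vectors) ≡⟨ cong (fromℕ 9 * T *_) (sym gain-scaled) ⟩
    fromℕ 9 * T * gain A scaled          ≤⟨ *-monoˡ 0≤9T (bounded scaled unit) ⟩
    fromℕ 9 * T * G                      ≡⟨ swap′ T G ⟩
    T * (fromℕ 9 * G)                    ∎)
    where
    open ≤-Reasoning
    open Greedy greedy
    scaled = map (λ z i → σ * z i) vectors
    0≤9T : 0ℚ ≤ fromℕ 9 * T
    0≤9T = 0≤* (0≤fromℕ 9) (<⇒≤ 0<T)
    swap : ∀ T g W → T * (g * W) ≡ g * (T * W)
    swap = solve-∀ ℚ-ring
    swap′ : ∀ T G → fromℕ 9 * T * G ≡ T * (fromℕ 9 * G)
    swap′ = solve-∀ ℚ-ring
    square : ∀ S σ → fromℕ 9 * (S * S) * (σ * σ) ≡ fromℕ 3 * S * σ * (fromℕ 3 * S * σ)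
    square = solve-∀ ℚ-ring
    9Tσσ≡1 : fromℕ 9 * T * (σ * σ) ≡ 1ℚ
    9Tσσ≡1 = trans (square S σ) (cong₂ _*_ 3Sσ≡1 3Sσ≡1)
    gain-scaled : gain A scaled ≡ σ * σ * gain A vectors
    gain-scaled = trans (total-map _ (λ z i → σ * z i) vectors)
      (trans (total-cong (λ z → form-scale A σ σ (z ∘ inj₁) (z ∘ inj₂)) vectors)
        (total-*ˡ (σ * σ) (λ z → form A (z ∘ inj₁) (z ∘ inj₂)) vectors))
    unit : Unit scaled
    unit i = begin
      total (λ z → z i * z i) scaled             ≡⟨ total-map _ (λ z i → σ * z i) vectors ⟩
      total (λ z → σ * z i * (σ * z i)) vectors  ≡⟨ total-cong (λ z → regroup σ (z i)) vectors ⟩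
      total (λ z → σ * σ * (z i * z i)) vectors  ≡⟨ total-*ˡ (σ * σ) (λ z → z i * z i) vectors ⟩
      σ * σ * load i vectors                     ≤⟨ *-monoˡ (0≤sq σ) (≤-trans (load≤ i) 8T+S≤9T) ⟩
      σ * σ * (fromℕ 9 * T)                      ≡⟨ trans (*-comm (σ * σ) (fromℕ 9 * T)) 9Tσσ≡1 ⟩
      1ℚ                                         ∎
      where
      regroup : ∀ σ x → σ * x * (σ * x) ≡ σ * σ * (x * x)
      regroup = solve-∀ ℚ-ring

-- From a large Frobenius norm to an efficient pair

ind-idem : ∀ (X : Subset n) i → ind X i * ind X i ≡ ind X i
ind-idem X i with lookup X i
... | true  = refl
... | false = refl

-- Restricting to a set of rows acts coordinatewise on the spanning vectors, so the length of the
-- list still bounds the rank.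
Span-restrict : ∀ (μ : Fin m → ℚ) es {v} → Span es v →
                Span (map (λ e i → μ i * e i) es) (λ i → μ i * v i)
Span-restrict μ [] v≡0 i = trans (cong (μ i *_) (v≡0 i)) (*-zeroʳ (μ i))
Span-restrict μ (e ∷ es) {v} (t , s) = t ,
  Span-cong (map (λ e i → μ i * e i) es) (λ i → expand (μ i) (v i) t (e i)) (Span-restrict μ es s)
  where
  expand : ∀ μ v t e → μ * (v - t * e) ≡ μ * v - t * (μ * e)
  expand = solve-∀ ℚ-ring

restricted-column : Matrix ℚ m n → Subset m → Subset n → Fin n → Fin m → ℚ
restricted-column A X Y j i = ind Y j * (ind X i * A i j)

restricted-frobenius : ∀ (A : Matrix ℚ m n) X Y →
  ∑ (λ j → dot (restricted-column A X Y j) (restricted-column A X Y j)) ≡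
  form (λ i j → A i j * A i j) (ind X) (ind Y)
restricted-frobenius A X Y = trans (∑-cong λ j → ∑-cong λ i → entry i j)
  (∑-comm λ j i → A i j * A i j * (ind X i * ind Y j))
  where
  regroup : ∀ a x y → y * (x * a) * (y * (x * a)) ≡ a * a * (x * x * (y * y))
  regroup = solve-∀ ℚ-ring
  entry : ∀ i j → ind Y j * (ind X i * A i j) * (ind Y j * (ind X i * A i j)) ≡
          A i j * A i j * (ind X i * ind Y j)
  entry i j = trans (regroup (A i j) (ind X i) (ind Y j))
    (cong (A i j * A i j *_) (cong₂ _*_ (ind-idem X i) (ind-idem Y j)))

-- A direction u of large norm for the restriction of A to X × Y is turned into
-- the pair (8 γ m u, 4 Aᵀ u).
direction⇒efficient : ∀ {A : Matrix ℚ m n} → 0ℚ < fromℕ m → ∀ {γ} → 0ℚ ≤ γ → ∀ X Y u →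
  fromℕ 4 * (γ * γ) * (fromℕ m * fromℕ n) * dot u u <
    ∑ (λ j → dot (restricted-column A X Y j) u * dot (restricted-column A X Y j) u) →
  ∃[ z ] Efficient A γ X Y z
direction⇒efficient {m} {n} {A} 0<M {γ} 0≤γ X Y u Λu²<τ = z , z-rows , z-cols , 0<weight , z-gain
  where
  M = fromℕ m
  N = fromℕ n
  Λ = fromℕ 4 * (γ * γ) * (M * N)
  U = dot u u
  v : Fin n → Fin m → ℚ
  v = restricted-column A X Y
  τ = ∑ λ j → dot (v j) u * dot (v j) u
  z : Pair m n
  -- For a pair (α u, β Aᵀ u), balancing γ (n α² ‖u‖² + m β² τ) against the form α β τ under Λ ‖u‖²
  -- < τ calls for α = 2 γ m β; the common scale is arbitrary.
  z (inj₁ i) = fromℕ 8 * γ * M * (ind X i * u i)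
  z (inj₂ j) = fromℕ 4 * dot (v j) u
  Au : Fin n → ℚ
  Au j = ∑ λ i → A i j * (ind X i * u i)
  vu≡ : ∀ j → dot (v j) u ≡ ind Y j * Au j
  vu≡ j = trans (∑-cong λ i → regroup (ind Y j) (ind X i) (A i j) (u i))
    (∑-*ˡ (ind Y j) (λ i → A i j * (ind X i * u i)))
    where
    regroup : ∀ y x a u → y * (x * a) * u ≡ y * (a * (x * u))
    regroup = solve-∀ ℚ-ring
  z-rows : ∀ i → ind X i ≡ 0ℚ → z (inj₁ i) ≡ 0ℚ
  z-rows i X≡0 = trans (cong (λ x → fromℕ 8 * γ * M * (x * u i)) X≡0) (vanish (fromℕ 8 * γ * M) (u i))
    where
    vanish : ∀ c u → c * (0ℚ * u) ≡ 0ℚ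
    vanish = solve-∀ ℚ-ring
  z-cols : ∀ j → ind Y j ≡ 0ℚ → z (inj₂ j) ≡ 0ℚ
  z-cols j Y≡0 = trans (cong (fromℕ 4 *_) (trans (vu≡ j) (trans (cong (_* Au j) Y≡0) (*-zeroˡ (Au j)))))
    (*-zeroʳ (fromℕ 4))
  form≡ : form A (z ∘ inj₁) (z ∘ inj₂) ≡ fromℕ 32 * (γ * M) * τ
  form≡ = trans (form-∑ʳ A (z ∘ inj₁) (z ∘ inj₂))
    (trans (∑-cong entry) (∑-*ˡ (fromℕ 32 * (γ * M)) (λ j → dot (v j) u * dot (v j) u)))
    where
    open ≡-Reasoning
    pull : ∀ c a x → a * (c * x) ≡ c * (a * x)
    pull = solve-∀ ℚ-ring
    collect : ∀ g M y a → fromℕ 4 * (y * a) * (fromℕ 8 * g * M * a) ≡ fromℕ 32 * (g * M) * (y * (a * a))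
    collect = solve-∀ ℚ-ring
    square : ∀ y a → y * y * (a * a) ≡ y * a * (y * a)
    square = solve-∀ ℚ-ring
    entry : ∀ j → fromℕ 4 * dot (v j) u * ∑ (λ i → A i j * (fromℕ 8 * γ * M * (ind X i * u i))) ≡
            fromℕ 32 * (γ * M) * (dot (v j) u * dot (v j) u)
    entry j = begin
      fromℕ 4 * dot (v j) u * ∑ (λ i → A i j * (fromℕ 8 * γ * M * (ind X i * u i)))
        ≡⟨ cong₂ (λ s t → fromℕ 4 * s * t) (vu≡ j)
             (trans (∑-cong λ i → pull (fromℕ 8 * γ * M) (A i j) (ind X i * u i))
                    (∑-*ˡ (fromℕ 8 * γ * M) (λ i → A i j * (ind X i * u i)))) ⟩
      fromℕ 4 * (ind Y j * Au j) * (fromℕ 8 * γ * M * Au j)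
        ≡⟨ collect γ M (ind Y j) (Au j) ⟩
      fromℕ 32 * (γ * M) * (ind Y j * (Au j * Au j))
        ≡⟨ cong (λ y → fromℕ 32 * (γ * M) * (y * (Au j * Au j))) (sym (ind-idem Y j)) ⟩
      fromℕ 32 * (γ * M) * (ind Y j * ind Y j * (Au j * Au j))
        ≡⟨ cong (fromℕ 32 * (γ * M) *_) (trans (square (ind Y j) (Au j)) (cong₂ _*_ (sym (vu≡ j)) (sym (vu≡ j)))) ⟩
      fromℕ 32 * (γ * M) * (dot (v j) u * dot (v j) u) ∎
  row≤ : row-weight z ≤ fromℕ 64 * (γ * γ * (M * M)) * U
  row≤ = ≤-trans (∑-mono entry)
    (≤-reflexive (∑-*ˡ (fromℕ 64 * (γ * γ * (M * M))) (λ i → u i * u i)))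
    where
    regroup : ∀ g M x u → fromℕ 8 * g * M * (x * u) * (fromℕ 8 * g * M * (x * u)) ≡
              fromℕ 64 * (g * g * (M * M)) * (x * x * (u * u))
    regroup = solve-∀ ℚ-ring
    ind≤1 : ∀ i → ind X i ≤ 1ℚ
    ind≤1 i with lookup X i
    ... | true  = ≤-refl
    ... | false = nonNegative⁻¹ 1ℚ
    entry : ∀ i → z (inj₁ i) * z (inj₁ i) ≤ fromℕ 64 * (γ * γ * (M * M)) * (u i * u i)
    entry i = begin
      z (inj₁ i) * z (inj₁ i)
        ≡⟨ trans (regroup γ M (ind X i) (u i))
             (cong (λ x → fromℕ 64 * (γ * γ * (M * M)) * (x * (u i * u i))) (ind-idem X i)) ⟩
      fromℕ 64 * (γ * γ * (M * M)) * (ind X i * (u i * u i))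
        ≤⟨ *-monoˡ (0≤* (0≤fromℕ 64) (0≤* (0≤sq γ) (0≤sq M))) (*-monoʳ (0≤sq (u i)) (ind≤1 i)) ⟩
      fromℕ 64 * (γ * γ * (M * M)) * (1ℚ * (u i * u i))
        ≡⟨ cong (fromℕ 64 * (γ * γ * (M * M)) *_) (*-identityˡ (u i * u i)) ⟩
      fromℕ 64 * (γ * γ * (M * M)) * (u i * u i) ∎
      where open ≤-Reasoning
  col≡ : col-weight z ≡ fromℕ 16 * τ
  col≡ = trans (∑-cong λ j → regroup (dot (v j) u)) (∑-*ˡ (fromℕ 16) (λ j → dot (v j) u * dot (v j) u))
    where
    regroup : ∀ x → fromℕ 4 * x * (fromℕ 4 * x) ≡ fromℕ 16 * (x * x)
    regroup = solve-∀ ℚ-ring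
  0≤Λ : 0ℚ ≤ Λ
  0≤Λ = 0≤* (0≤* (0≤fromℕ 4) (0≤sq γ)) (0≤* (<⇒≤ 0<M) (0≤fromℕ n))
  0<τ : 0ℚ < τ
  0<τ = ≤-<-trans (0≤* 0≤Λ (0≤dot u)) Λu²<τ
  0<weight : 0ℚ < weight z
  0<weight = subst (0ℚ <_) (+-comm (M * col-weight z) (N * row-weight z))
    (0<+ (0<* 0<M (subst (0ℚ <_) (sym col≡) (0<* (positive⁻¹ (fromℕ 16)) 0<τ)))
      (0≤* (0≤fromℕ n) (0≤dot (z ∘ inj₁))))
  z-gain : γ * weight z ≤ form A (z ∘ inj₁) (z ∘ inj₂)
  z-gain = begin
    γ * (N * row-weight z + M * col-weight z)
      ≤⟨ *-monoˡ 0≤γ (+-mono-≤ (*-monoˡ (0≤fromℕ n) row≤) (≤-reflexive (cong (M *_) col≡))) ⟩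
    γ * (N * (fromℕ 64 * (γ * γ * (M * M)) * U) + M * (fromℕ 16 * τ))
      ≤⟨ ≤-by (fromℕ 16 * (γ * M) * (τ - Λ * U))
           (0≤* (0≤* (0≤fromℕ 16) (0≤* 0≤γ (<⇒≤ 0<M))) (0≤-diff (<⇒≤ Λu²<τ)))
           (identity γ M N U τ) ⟩
    fromℕ 32 * (γ * M) * τ
      ≡⟨ sym form≡ ⟩
    form A (z ∘ inj₁) (z ∘ inj₂) ∎
    where
    open ≤-Reasoning
    identity : ∀ g M N U t → fromℕ 32 * (g * M) * t ≡
      g * (N * (fromℕ 64 * (g * g * (M * M)) * U) + M * (fromℕ 16 * t)) +
      fromℕ 16 * (g * M) * (t - fromℕ 4 * (g * g) * (M * N) * U)
    identity = solve-∀ ℚ-ring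

-- Were there no direction of large norm, the squared Frobenius norm of the restriction would be at
-- most `length es` times 4 γ² m n, against the hypothesis.
efficient-pair : ∀ {A : Matrix ℚ m n} es → (∀ j → Span es (λ i → A i j)) → 0ℚ < fromℕ m →
  ∀ {γ} → 0ℚ ≤ γ → ∀ X Y →
  fromℕ (length es) * (fromℕ 4 * (γ * γ) * (fromℕ m * fromℕ n)) <
    form (λ i j → A i j * A i j) (ind X) (ind Y) →
  ∃[ z ] Efficient A γ X Y z
efficient-pair {m} {n} {A} es spans 0<M {γ} 0≤γ X Y large =
  conclude (frobenius≤rank*norm es′ v v-spans Λ
    (0≤* (0≤* (0≤fromℕ 4) (0≤sq γ)) (0≤* (<⇒≤ 0<M) (0≤fromℕ n))))
  where
  Λ = fromℕ 4 * (γ * γ) * (fromℕ m * fromℕ n)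
  es′ = map (λ e i → ind X i * e i) es
  v = restricted-column A X Y
  v-spans : ∀ j → Span es′ (v j)
  v-spans j = Span-cong es′ (λ i → drop-0 (ind Y j * (ind X i * A i j)) (ind X i * A i j))
    (Span-lin es′ (ind Y j) 0ℚ restricted restricted)
    where
    restricted : Span es′ (λ i → ind X i * A i j)
    restricted = Span-restrict (ind X) es (spans j)
    drop-0 : ∀ x y → x + 0ℚ * y ≡ x
    drop-0 = solve-∀ ℚ-ring
  conclude : (∑ (λ j → dot (v j) (v j)) ≤ fromℕ (length es′) * Λ) ⊎
             (∃[ u ] Λ * dot u u < ∑ (λ j → dot (v j) u * dot (v j) u)) →
             ∃[ z ] Efficient A γ X Y z
  conclude (inj₁ small) = ⊥-elim (<-irrefl refl (<-≤-trans large (begin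
    form (λ i j → A i j * A i j) (ind X) (ind Y)  ≡⟨ sym (restricted-frobenius A X Y) ⟩
    ∑ (λ j → dot (v j) (v j))                     ≤⟨ small ⟩
    fromℕ (length es′) * Λ                        ≡⟨ cong (λ l → fromℕ l * Λ) (length-map _ es) ⟩
    fromℕ (length es) * Λ                         ∎)))
    where open ≤-Reasoning
  conclude (inj₂ (u , Λu²<τ)) = direction⇒efficient {A = A} 0<M 0≤γ X Y u Λu²<τ

-- Binary matrices and discrepancy

open CommutativeMonoidSum ℕ.+-0-commutativeMonoid using () renaming (sum to ∑ℕ)
open Extrema (DecTotalOrder.totalOrder ≤-decTotalOrder) using (f[⊥]≤f[argmax]; f[xs]≤f[argmax])

∈-subsets : ∀ (X : Subset n) → X ∈ subsets n
∈-subsets []            = here refl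
∈-subsets (inside ∷ X)  = ∈-++⁺ˡ (∈-map⁺ (inside ∷_) (∈-subsets X))
∈-subsets {suc n} (outside ∷ X) =
  ∈-++⁺ʳ (map (inside ∷_) (subsets n)) (∈-map⁺ (outside ∷_) (∈-subsets X))

module _ .{{_ : NonZero m}} .{{_ : NonZero n}} (M : BinaryMatrix m n) where

  private
    pairs = cartesianProduct (subsets m) (subsets n)

  0≤disc : 0ℚ ≤ disc M
  0≤disc = f[⊥]≤f[argmax] {f = λ x → x} 0ℚ (map (λ (X , Y) → deviation M X Y) pairs)

  deviation≤disc : ∀ X Y → deviation M X Y ≤ disc M
  deviation≤disc X Y = All.lookup
    (f[xs]≤f[argmax] {f = λ x → x} 0ℚ (map (λ (X , Y) → deviation M X Y) pairs))
    (∈-map⁺ (λ (X , Y) → deviation M X Y) (∈-cartesianProduct⁺ (∈-subsets X) (∈-subsets Y)))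

fromℕ-∑ : ∀ (f : Fin n → ℕ) → fromℕ (∑ℕ f) ≡ ∑ (λ i → fromℕ (f i))
fromℕ-∑ {zero}  f = refl
fromℕ-∑ {suc n} f = trans (fromℕ-+ (f zero) (∑ℕ (f ∘ suc)))
  (cong (fromℕ (f zero) +_) (fromℕ-∑ (f ∘ suc)))

fromℕ-∣∣ : ∀ (X : Subset n) → fromℕ Subset.∣ X ∣ ≡ ∑ (ind X)
fromℕ-∣∣ []            = refl
fromℕ-∣∣ (inside ∷ X)  = trans (fromℕ-suc Subset.∣ X ∣) (cong (1ℚ +_) (fromℕ-∣∣ X))
fromℕ-∣∣ (outside ∷ X) = trans (fromℕ-∣∣ X) (sym (+-identityˡ (∑ (ind X))))

fromℕ-ones : ∀ (M : BinaryMatrix m n) X Y →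
             fromℕ (ones (M [ X ×ˢ Y ])) ≡ form (toℚ M) (ind X) (ind Y)
fromℕ-ones M X Y = trans (fromℕ-∑ (λ i → ∑ℕ (bit i)))
  (∑-cong λ i → trans (fromℕ-∑ (bit i)) (∑-cong λ j → entry (lookup X i) (lookup Y j) (M i j)))
  where
  bit : _ → _ → ℕ
  bit i j = if (M [ X ×ˢ Y ]) i j then 1 else 0
  entry : ∀ x y b → fromℕ (if x ∧ y ∧ b then 1 else 0) ≡
    (if b then 1ℚ else 0ℚ) * ((if x then 1ℚ else 0ℚ) * (if y then 1ℚ else 0ℚ))
  entry true  true  true  = refl
  entry true  true  false = refl
  entry true  false true  = refl
  entry true  false false = refl
  entry false true  true  = refl
  entry false true  false = refl
  entry false false true  = refl
  entry false false false = refl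

-- Applied twice: to centre `toℚ M`, and to the centred matrix, whose entrywise square is affine in
-- itself.
form-affine : ∀ (A : Matrix ℚ m n) α β x y →
  form (λ i j → α * A i j + β) x y ≡ α * form A x y + β * (∑ x * ∑ y)
form-affine A α β x y = begin
  form (λ i j → α * A i j + β) x y
    ≡⟨ (∑-cong λ i → trans (∑-cong λ j → expand α β (A i j) (x i) (y j))
         (∑-lin α (β * x i) (λ j → A i j * (x i * y j)) y)) ⟩
  ∑ (λ i → α * r i + β * x i * ∑ y)
    ≡⟨ ∑-cong (λ i → regroup (α * r i) β (x i) (∑ y)) ⟩
  ∑ (λ i → 1ℚ * (α * r i) + β * ∑ y * x i)
    ≡⟨ ∑-lin 1ℚ (β * ∑ y) (λ i → α * r i) x ⟩
  1ℚ * ∑ (λ i → α * r i) + β * ∑ y * ∑ x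
    ≡⟨ cong (λ s → 1ℚ * s + β * ∑ y * ∑ x) (∑-*ˡ α r) ⟩
  1ℚ * (α * form A x y) + β * ∑ y * ∑ x
    ≡⟨ collect (α * form A x y) β (∑ x) (∑ y) ⟩
  α * form A x y + β * (∑ x * ∑ y) ∎
  where
  open ≡-Reasoning
  r : _ → ℚ
  r i = ∑ λ j → A i j * (x i * y j)
  expand : ∀ α β a x y → (α * a + β) * (x * y) ≡ α * (a * (x * y)) + β * x * y
  expand = solve-∀ ℚ-ring
  regroup : ∀ s β x t → s + β * x * t ≡ 1ℚ * s + β * t * x
  regroup = solve-∀ ℚ-ring
  collect : ∀ s β x y → 1ℚ * s + β * y * x ≡ s + β * (x * y)
  collect = solve-∀ ℚ-ring

-- Written as α a + β with α = 1, so that `form-affine` applies by definition.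
centred : BinaryMatrix m n → ℚ → Matrix ℚ m n
centred M p i j = 1ℚ * toℚ M i j + - p

form-centred : .{{_ : NonZero m}} .{{_ : NonZero n}} → ∀ (M : BinaryMatrix m n) X Y →
  ∣ form (centred M (density M)) (ind X) (ind Y) ∣ ≡ deviation M X Y
form-centred M X Y = cong ∣_∣ (trans (form-affine (toℚ M) 1ℚ (- density M) (ind X) (ind Y))
  (trans (collect (form (toℚ M) (ind X) (ind Y)) (density M) (∑ (ind X)) (∑ (ind Y)))
    (sym (cong₂ _-_ (fromℕ-ones M X Y)
      (cong₂ (λ x y → density M * x * y) (fromℕ-∣∣ X) (fromℕ-∣∣ Y))))))
  where
  collect : ∀ f p x y → 1ℚ * f + - p * (x * y) ≡ f - p * x * y
  collect = solve-∀ ℚ-ring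

-- The possible entries 1 - p and -p are the two roots of x² = (1 - 2p) x + p (1 - p).
centred-sq : ∀ (M : BinaryMatrix m n) p i j → centred M p i j * centred M p i j ≡
             (1ℚ - fromℕ 2 * p) * centred M p i j + p * (1ℚ - p)
centred-sq M p i j with M i j
... | true  = one p
  where
  one : ∀ p → (1ℚ * 1ℚ + - p) * (1ℚ * 1ℚ + - p) ≡
        (1ℚ - fromℕ 2 * p) * (1ℚ * 1ℚ + - p) + p * (1ℚ - p)
  one = solve-∀ ℚ-ring
... | false = zer p
  where
  zer : ∀ p → (1ℚ * 0ℚ + - p) * (1ℚ * 0ℚ + - p) ≡
        (1ℚ - fromℕ 2 * p) * (1ℚ * 0ℚ + - p) + p * (1ℚ - p)
  zer = solve-∀ ℚ-ring

1/ₙ : ∀ n .{{_ : NonZero n}} → ℚ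
1/ₙ n = ℤ.+ 1 / n

-- By `centred-sq` the sum of squares over X × Y is (1 - 2p) f + p (1 - p) |X| |Y|, where f ≥ -D ≥
-- -p m n / 4 and |X| |Y| ≥ 49/64 m n. This leaves at least p m n (33/64 - 17/64 p), and p ≤ 1/2
-- keeps it above p m n / 8.
restricted-norm-large : ∀ (M : BinaryMatrix m n) {p D X Y} → 0ℚ < fromℕ m * fromℕ n →
  0ℚ < p → p ≤ ½ → ∣ form (centred M p) (ind X) (ind Y) ∣ ≤ D →
  D ≤ 1/ₙ 4 * (p * (fromℕ m * fromℕ n)) → Large X → Large Y →
  1/ₙ 8 * (p * (fromℕ m * fromℕ n)) <
    form (λ i j → centred M p i j * centred M p i j) (ind X) (ind Y)
restricted-norm-large {m} {n} M {p} {D} {X} {Y} 0<W 0<p p≤½ ≤D D≤ X-large Y-large = <-by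
  -- The slack has one term for each inequality used; 33/128 is the value of 33/64 - 17/64 p - 1/8
  -- at p = 1/2.
  ((1ℚ - fromℕ 2 * p) * (D - - f) + p * (1ℚ - p) * 1/ₙ 64 *
    (fromℕ 8 * ξ * (fromℕ 8 * υ) - fromℕ 7 * N′ * (fromℕ 7 * N))
    + (1ℚ - fromℕ 2 * p) * (1/ₙ 4 * (p * W) - D) + p * W * (ℤ.+ 17 / 64) * (½ - p) + p * W * (ℤ.+ 33 / 128))
  (subst (0ℚ <_) (+-comm (p * W * (ℤ.+ 33 / 128)) _) (0<+ (0<* (0<* 0<p 0<W) (positive⁻¹ (ℤ.+ 33 / 128)))
    (0≤+ (0≤+ (0≤+ (0≤* 0≤1-2p (0≤-diff (≤-trans (-≤∣∣ f) ≤D)))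
           (0≤* (0≤* (0≤* (<⇒≤ 0<p) 0≤1-p) (nonNegative⁻¹ (1/ₙ 64))) (0≤-diff 49W≤64S)))
         (0≤* 0≤1-2p (0≤-diff D≤)))
      (0≤* (0≤* (<⇒≤ (0<* 0<p 0<W)) (nonNegative⁻¹ (ℤ.+ 17 / 64))) (0≤-diff p≤½)))))
  (trans F≡ (identity p D f ξ υ N′ N))
  where
  N′ = fromℕ m
  N = fromℕ n
  W = N′ * N
  f = form (centred M p) (ind X) (ind Y)
  ξ = ∑ (ind X)
  υ = ∑ (ind Y)
  F≡ : form (λ i j → centred M p i j * centred M p i j) (ind X) (ind Y) ≡
       (1ℚ - fromℕ 2 * p) * f + p * (1ℚ - p) * (ξ * υ)
  F≡ = trans (∑-cong λ i → ∑-cong λ j → cong (_* (ind X i * ind Y j)) (centred-sq M p i j))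
    (form-affine (centred M p) (1ℚ - fromℕ 2 * p) (p * (1ℚ - p)) (ind X) (ind Y))
  0≤1-2p : 0ℚ ≤ 1ℚ - fromℕ 2 * p
  0≤1-2p = 0≤-diff (≤-trans (*-monoˡ (0≤fromℕ 2) p≤½) (≤-reflexive refl))
  0≤1-p : 0ℚ ≤ 1ℚ - p
  0≤1-p = 0≤-diff (≤-trans p≤½ (from-yes (½ ≤? 1ℚ)))
  49W≤64S : fromℕ 7 * N′ * (fromℕ 7 * N) ≤ fromℕ 8 * ξ * (fromℕ 8 * υ)
  49W≤64S = *-mono₂ (0≤* (0≤fromℕ 7) (0≤fromℕ m))
    (≤-trans (0≤* (0≤fromℕ 7) (0≤fromℕ n)) Y-large) X-large Y-large
  identity : ∀ p D f x y N′ N → (1ℚ - fromℕ 2 * p) * f + p * (1ℚ - p) * (x * y) ≡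
    (ℤ.+ 1 / 8) * (p * (N′ * N)) +
    ((1ℚ - fromℕ 2 * p) * (D - - f) +
     p * (1ℚ - p) * (ℤ.+ 1 / 64) * (fromℕ 8 * x * (fromℕ 8 * y) - fromℕ 7 * N′ * (fromℕ 7 * N)) +
     (1ℚ - fromℕ 2 * p) * ((ℤ.+ 1 / 4) * (p * (N′ * N)) - D) +
     p * (N′ * N) * (ℤ.+ 17 / 64) * (½ - p) + p * (N′ * N) * (ℤ.+ 33 / 128))
  identity = solve-∀ ℚ-ring

-- Subtracting `p` changes a column by a multiple of the all-ones vector, so one more vector
-- suffices.
centred-span : ∀ (M : BinaryMatrix m n) p {ρ} → HasRank (toℚ M) ρ →
               ∃[ es ] (length es ≡ suc ρ × ∀ j → Span es (λ i → centred M p i j))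
centred-span M p rank =
  let es , length≡ρ , spans = column-span rank
  in (λ _ → 1ℚ) ∷ es , cong suc length≡ρ ,
     λ j → - p , Span-cong es (λ i → restore (toℚ M i j) p) (spans j)
  where
  restore : ∀ b p → b ≡ 1ℚ * b + - p - - p * 1ℚ
  restore = solve-∀ ℚ-ring

-- If D > 2 γ m n the claim is immediate. Otherwise 8 γ ≤ p gives D ≤ p m n / 4, so restrictions to
-- large sets have squared Frobenius norm above p m n / 8, while 64 r γ² ≤ p keeps the rank term, at
-- most 2 r · 4 γ² m n, from exceeding p m n / 8. The factor 288 is 9 · 32.
disc-bound : ∀ r .{{_ : NonZero r}} .{{_ : NonZero m}} .{{_ : NonZero n}} (M : BinaryMatrix m n) {ρ} →
  HasRank (toℚ M) ρ → ρ ℕ.≤ r → density M ≤ ½ → ∀ {γ} → 0ℚ < γ →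
  fromℕ 8 * γ ≤ density M → fromℕ 64 * (fromℕ r * (γ * γ)) ≤ density M →
  γ * (fromℕ m * fromℕ n) ≤ fromℕ 288 * disc M
disc-bound {m} {n} r M {ρ} rank ρ≤r p≤½ {γ} 0<γ 8γ≤p 64rγ²≤p = by-cases (D ≤? fromℕ 2 * (γ * W))
  where
  open ≤-Reasoning
  δ = density M
  D = disc M
  W = fromℕ m * fromℕ n
  A = centred M δ
  0<W : 0ℚ < W
  0<W = 0<* (fromℕ-pos m) (fromℕ-pos n)
  0<p : 0ℚ < δ
  0<p = <-≤-trans (0<* (positive⁻¹ (fromℕ 8)) 0<γ) 8γ≤p
  cut : ∀ X Y → ∣ form A (ind X) (ind Y) ∣ ≤ D
  cut X Y = ≤-trans (≤-reflexive (form-centred M X Y)) (deviation≤disc M X Y)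
  es = proj₁ (centred-span M δ rank)
  length≡ = proj₁ (proj₂ (centred-span M δ rank))
  spans = proj₂ (proj₂ (centred-span M δ rank))
  1+ρ≤2r : fromℕ (suc ρ) ≤ fromℕ r + fromℕ r
  1+ρ≤2r = ≤-trans (fromℕ-mono (ℕ.+-mono-≤ (ℕ.>-nonZero⁻¹ r) ρ≤r)) (≤-reflexive (fromℕ-+ r r))
  rank-term≤ : fromℕ (length es) * (fromℕ 4 * (γ * γ) * W) ≤ 1/ₙ 8 * (δ * W)
  rank-term≤ = begin
    fromℕ (length es) * (fromℕ 4 * (γ * γ) * W)
      ≡⟨ cong (λ l → fromℕ l * (fromℕ 4 * (γ * γ) * W)) length≡ ⟩
    fromℕ (suc ρ) * (fromℕ 4 * (γ * γ) * W)
      ≤⟨ *-monoʳ (0≤* (0≤* (0≤fromℕ 4) (0≤sq γ)) (<⇒≤ 0<W)) 1+ρ≤2r ⟩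
    (fromℕ r + fromℕ r) * (fromℕ 4 * (γ * γ) * W)
      ≤⟨ ≤-by (1/ₙ 8 * ((δ - fromℕ 64 * (fromℕ r * (γ * γ))) * W))
           (0≤* (nonNegative⁻¹ (1/ₙ 8)) (0≤* (0≤-diff 64rγ²≤p) (<⇒≤ 0<W)))
           (identity δ (fromℕ r) γ W) ⟩
    1/ₙ 8 * (δ * W) ∎
    where
    identity : ∀ p r g W → (ℤ.+ 1 / 8) * (p * W) ≡
      (r + r) * (fromℕ 4 * (g * g) * W) + (ℤ.+ 1 / 8) * ((p - fromℕ 64 * (r * (g * g))) * W)
    identity = solve-∀ ℚ-ring
  2γW≤ : fromℕ 2 * (γ * W) ≤ 1/ₙ 4 * (δ * W)
  2γW≤ = ≤-by (1/ₙ 4 * ((δ - fromℕ 8 * γ) * W))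
    (0≤* (nonNegative⁻¹ (1/ₙ 4)) (0≤* (0≤-diff 8γ≤p) (<⇒≤ 0<W))) (identity δ γ W)
    where
    identity : ∀ p g W → (ℤ.+ 1 / 4) * (p * W) ≡
      fromℕ 2 * (g * W) + (ℤ.+ 1 / 4) * ((p - fromℕ 8 * g) * W)
    identity = solve-∀ ℚ-ring
  by-cases : Dec (D ≤ fromℕ 2 * (γ * W)) → γ * W ≤ fromℕ 288 * D
  by-cases (yes D≤) = begin
    γ * W                      ≤⟨ greedy-bound {A = A} {γ} (grothendieck A cut (0≤disc M))
                                    (λ X Y X-large Y-large → efficient-pair {A = A} es spans
                                      (fromℕ-pos m) {γ} (<⇒≤ 0<γ) X Y (≤-<-trans rank-term≤
                                        (restricted-norm-large M {X = X} {Y} 0<W 0<p p≤½ (cut X Y)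
                                          (≤-trans D≤ 2γW≤) X-large Y-large))) ⟩
    fromℕ 9 * (fromℕ 32 * D)   ≡⟨ sym (*-assoc (fromℕ 9) (fromℕ 32) D) ⟩
    fromℕ 288 * D              ∎
  by-cases (no D≰) = ≤-by
    (fromℕ 288 * (D - fromℕ 2 * (γ * W)) + fromℕ 575 * (γ * W))
    (0≤+ (0≤* (0≤fromℕ 288) (0≤-diff (<⇒≤ (≰⇒> D≰)))) (0≤* (0≤fromℕ 575) (<⇒≤ (0<* 0<γ 0<W))))
    (identity D (γ * W))
    where
    identity : ∀ D w → fromℕ 288 * D ≡ w + (fromℕ 288 * (D - fromℕ 2 * w) + fromℕ 575 * w)
    identity = solve-∀ ℚ-ring

-- Square roots

bisect-interval : ∀ q lo hi → 1ℚ ≤ lo → lo ≤ hi →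
  let (lo′ , hi′) = bisect q (lo , hi) in
  1ℚ ≤ lo′ × lo′ ≤ hi′ × hi′ - lo′ ≡ ½ * (hi - lo)
bisect-interval q lo hi 1≤lo lo≤hi with ((lo + hi) * ½) * ((lo + hi) * ½) ≤? q
... | yes _ = ≤-trans 1≤lo (≤-by (½ * (hi - lo)) 0≤half (lower lo hi)) ,
              ≤-by (½ * (hi - lo)) 0≤half (upper lo hi) , width lo hi
  where
  0≤half = 0≤* (nonNegative⁻¹ ½) (0≤-diff lo≤hi)
  lower : ∀ a b → (a + b) * ½ ≡ a + ½ * (b - a)
  lower = solve-∀ ℚ-ring
  upper : ∀ a b → b ≡ (a + b) * ½ + ½ * (b - a)
  upper = solve-∀ ℚ-ring
  width : ∀ a b → b - (a + b) * ½ ≡ ½ * (b - a)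
  width = solve-∀ ℚ-ring
... | no _ = 1≤lo , ≤-by (½ * (hi - lo)) 0≤half (lower lo hi) , width lo hi
  where
  0≤half = 0≤* (nonNegative⁻¹ ½) (0≤-diff lo≤hi)
  lower : ∀ a b → (a + b) * ½ ≡ a + ½ * (b - a)
  lower = solve-∀ ℚ-ring
  width : ∀ a b → (a + b) * ½ - a ≡ ½ * (b - a)
  width = solve-∀ ℚ-ring

bracket-interval : ∀ {q} → 1ℚ ≤ q → ∀ i → let (lo , hi) = bracket q i in
  1ℚ ≤ lo × lo ≤ hi × fromℕ (suc i) * (hi - lo) ≤ q
bracket-interval {q} 1≤q zero rewrite p≤q⇒p⊓q≡p 1≤q | p≤q⇒p⊔q≡q 1≤q =
  ≤-refl , 1≤q , ≤-by 1ℚ (nonNegative⁻¹ 1ℚ) (identity q)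
  where
  identity : ∀ q → q ≡ fromℕ 1 * (q - 1ℚ) + 1ℚ
  identity = solve-∀ ℚ-ring
bracket-interval {q} 1≤q (suc i) =
  let 1≤lo , lo≤hi , width≤ = bracket-interval 1≤q i
      1≤lo′ , lo′≤hi′ , width′≡ = bisect-interval q (proj₁ (bracket q i)) (proj₂ (bracket q i)) 1≤lo lo≤hi
  in 1≤lo′ , lo′≤hi′ , ≤-trans (≤-reflexive (cong (fromℕ (suc (suc i)) *_) width′≡))
       (≤-trans (halve (0≤-diff lo≤hi)) width≤)
  where
  halve : ∀ {w} → 0ℚ ≤ w → fromℕ (suc (suc i)) * (½ * w) ≤ fromℕ (suc i) * w
  halve {w} 0≤w = begin
    fromℕ (suc (suc i)) * (½ * w)               ≡⟨ cong (_* (½ * w)) (fromℕ-suc (suc i)) ⟩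
    (1ℚ + fromℕ (suc i)) * (½ * w)              ≤⟨ *-monoʳ (0≤* (nonNegative⁻¹ ½) 0≤w)
                                                    (+-monoˡ-≤ (fromℕ (suc i)) (fromℕ-mono {1} {suc i} (ℕ.s≤s ℕ.z≤n))) ⟩
    (fromℕ (suc i) + fromℕ (suc i)) * (½ * w)   ≡⟨ regroup (fromℕ (suc i)) w ⟩
    fromℕ (suc i) * w                           ∎
    where
    open ≤-Reasoning
    regroup : ∀ t w → (t + t) * (½ * w) ≡ t * w
    regroup = solve-∀ ℚ-ring

-- The lower end `lo` is close to √q only eventually, but half of √q is enough here. Once i + 1 ≥ q
-- the bracket has width at most 1 ≤ lo, so hi ≤ 2 lo and q ≤ hi² ≤ 4 lo².
bracket-lower : ∀ {q} → 1ℚ ≤ q → ∀ i → q ≤ fromℕ (suc i) → let lo = proj₁ (bracket q i) in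
  1ℚ ≤ lo × q ≤ fromℕ 4 * (lo * lo)
bracket-lower {q} 1≤q i q≤ =
  let 1≤lo , lo≤hi , width≤ = bracket-interval 1≤q i
      _ , q≤hi² = bracket-sound (≤-trans (nonNegative⁻¹ 1ℚ) 1≤q) i
  in 1≤lo , ≤-trans q≤hi² (hi²≤4lo² (proj₁ (bracket q i)) (proj₂ (bracket q i)) 1≤lo lo≤hi width≤)
  where
  hi²≤4lo² : ∀ lo hi → 1ℚ ≤ lo → lo ≤ hi → fromℕ (suc i) * (hi - lo) ≤ q →
             hi * hi ≤ fromℕ 4 * (lo * lo)
  hi²≤4lo² lo hi 1≤lo lo≤hi width≤ = ≤-trans
    (*-mono₂ 0≤hi (≤-trans 0≤hi hi≤2lo) hi≤2lo hi≤2lo) (≤-reflexive (square lo))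
    where
    0≤hi : 0ℚ ≤ hi
    0≤hi = ≤-trans (nonNegative⁻¹ 1ℚ) (≤-trans 1≤lo lo≤hi)
    width≤1 : hi - lo ≤ 1ℚ
    width≤1 = *-cancelˡ-≤ (fromℕ-pos (suc i))
      (≤-trans width≤ (≤-trans q≤ (≤-reflexive (sym (*-identityʳ (fromℕ (suc i)))))))
    hi≤2lo : hi ≤ fromℕ 2 * lo
    hi≤2lo = ≤-by ((1ℚ - (hi - lo)) + (lo - 1ℚ)) (0≤+ (0≤-diff width≤1) (0≤-diff 1≤lo)) (identity lo hi)
      where
      identity : ∀ a b → fromℕ 2 * a ≡ b + ((1ℚ - (b - a)) + (a - 1ℚ))
      identity = solve-∀ ℚ-ring
    square : ∀ a → fromℕ 2 * a * (fromℕ 2 * a) ≡ fromℕ 4 * (a * a)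
    square = solve-∀ ℚ-ring

-- The bound with approximate square roots

*-inv : ∀ {q} → 0ℚ < q → q * inv q ≡ 1ℚ
*-inv {q} 0<q with q ≟ 0ℚ
... | yes q≡0 = ⊥-elim (<-irrefl (sym q≡0) 0<q)
... | no q≢0  = *-inverseʳ q {{≢-nonZero q≢0}}

-- `a` stands for √p from below and `b` for √r up to a factor 2. With `s` the minimum and γ = s/16,
-- 64 r γ² = r s²/4 ≤ b² (a/b)² = a² ≤ p.
disc-bound-⊓ : ∀ r .{{_ : NonZero r}} .{{_ : NonZero m}} .{{_ : NonZero n}} (M : BinaryMatrix m n) {ρ} →
  HasRank (toℚ M) ρ → ρ ℕ.≤ r → density M ≤ ½ →
  ∀ a b → a * a ≤ density M → 1ℚ ≤ b → fromℕ r ≤ fromℕ 4 * (b * b) →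
  1/ₙ 4608 * fromℕ (m ℕ.* n) * (density M ⊓ (a * inv b)) ≤ disc M
disc-bound-⊓ {m} {n} r M rank ρ≤r p≤½ a b a²≤p 1≤b r≤4b² = by-cases (0ℚ <? s)
  where
  open ≤-Reasoning
  t = a * inv b
  s = density M ⊓ t
  γ = 1/ₙ 16 * s
  W = fromℕ m * fromℕ n
  0≤c : 0ℚ ≤ 1/ₙ 4608 * fromℕ (m ℕ.* n)
  0≤c = 0≤* (nonNegative⁻¹ (1/ₙ 4608)) (0≤fromℕ (m ℕ.* n))
  tb≡a : t * b ≡ a
  tb≡a = trans (*-assoc a (inv b) b) (trans (cong (a *_)
    (trans (*-comm (inv b) b) (*-inv (<-≤-trans (positive⁻¹ 1ℚ) 1≤b)))) (*-identityʳ a))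
  positive-case : 0ℚ < s → 1/ₙ 4608 * fromℕ (m ℕ.* n) * s ≤ disc M
  positive-case 0<s = *-cancelˡ-≤ (positive⁻¹ (fromℕ 288)) (begin
    fromℕ 288 * (1/ₙ 4608 * fromℕ (m ℕ.* n) * s)
      ≡⟨ cong (λ w → fromℕ 288 * (1/ₙ 4608 * w * s)) (fromℕ-* m n) ⟩
    fromℕ 288 * (1/ₙ 4608 * W * s)
      ≡⟨ regroup W s ⟩
    γ * W
      ≤⟨ disc-bound r M rank ρ≤r p≤½ (0<* (positive⁻¹ (1/ₙ 16)) 0<s) 8γ≤p 64rγ²≤p ⟩
    fromℕ 288 * disc M ∎)
    where
    regroup : ∀ W s → fromℕ 288 * ((ℤ.+ 1 / 4608) * W * s) ≡ (ℤ.+ 1 / 16) * s * W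
    regroup = solve-∀ ℚ-ring
    0≤s : 0ℚ ≤ s
    0≤s = <⇒≤ 0<s
    s≤p : s ≤ density M
    s≤p = p⊓q≤p (density M) t
    s²≤t² : s * s ≤ t * t
    s²≤t² = *-mono₂ 0≤s (≤-trans 0≤s s≤t) s≤t s≤t
      where
      s≤t = p⊓q≤q (density M) t
    8γ≤p : fromℕ 8 * γ ≤ density M
    8γ≤p = ≤-by ((density M - s) + ½ * s) (0≤+ (0≤-diff s≤p) (0≤* (nonNegative⁻¹ ½) 0≤s))
      (identity (density M) s)
      where
      identity : ∀ p s → p ≡ fromℕ 8 * ((ℤ.+ 1 / 16) * s) + ((p - s) + ½ * s)
      identity = solve-∀ ℚ-ring
    64rγ²≤p : fromℕ 64 * (fromℕ r * (γ * γ)) ≤ density M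
    64rγ²≤p = begin
      fromℕ 64 * (fromℕ r * (γ * γ))         ≡⟨ quarter (fromℕ r) s ⟩
      1/ₙ 4 * (fromℕ r * (s * s))            ≤⟨ *-monoˡ (nonNegative⁻¹ (1/ₙ 4))
                                                 (*-mono₂ (0≤fromℕ r) (0≤sq t) r≤4b² s²≤t²) ⟩
      1/ₙ 4 * (fromℕ 4 * (b * b) * (t * t))  ≡⟨ collect b t ⟩
      t * b * (t * b)                        ≡⟨ cong₂ _*_ tb≡a tb≡a ⟩
      a * a                                  ≤⟨ a²≤p ⟩
      density M                              ∎
      where
      quarter : ∀ r s → fromℕ 64 * (r * ((ℤ.+ 1 / 16) * s * ((ℤ.+ 1 / 16) * s))) ≡ (ℤ.+ 1 / 4) * (r * (s * s))
      quarter = solve-∀ ℚ-ring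
      collect : ∀ b t → (ℤ.+ 1 / 4) * (fromℕ 4 * (b * b) * (t * t)) ≡ t * b * (t * b)
      collect = solve-∀ ℚ-ring
  by-cases : Dec (0ℚ < s) → 1/ₙ 4608 * fromℕ (m ℕ.* n) * s ≤ disc M
  by-cases (yes 0<s) = positive-case 0<s
  -- `disc-bound` asks for γ > 0, but p may vanish and `a` may have any sign; then `0≤disc` is
  -- enough.
  by-cases (no 0≮s)  = ≤-trans (*-monoˡ 0≤c (≮⇒≥ 0≮s))
    (≤-trans (≤-reflexive (*-zeroʳ (1/ₙ 4608 * fromℕ (m ℕ.* n)))) (0≤disc M))

theorem1p2 : ∃[ c ] (0ℝ <ℝ c ×
    (∀ (r m n : ℕ) .{{_ : NonZero r}} .{{_ : NonZero m}} .{{_ : NonZero n}}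
    (M : BinaryMatrix m n) →
    (ρ : ℕ) → HasRank (toℚ M) ρ → ρ ℕ.≤ r →
    density M ≤ ½ →
    c *ℝ fromℚ (fromℕ (m ℕ.* n))
    *ℝ (fromℚ (density M) ⊓ℝ (√ (density M) ÷ √ (fromℕ r) [ √-pos (fromℕ-pos r) ]))
    ≤ℝ fromℚ (disc M)))
theorem1p2 = fromℚ c₀ , (c₀ , positive⁻¹ c₀ , 0 , λ _ _ → ≤-reflexive (+-identityˡ c₀)) ,
  -- From index `r` on, i + 1 ≥ r as `bracket-lower` requires, and the inequality holds there
  -- termwise, before ε is added.
  λ r m n M ρ rank ρ≤r p≤½ ε 0<ε → r , λ i r≤i →
    let 1≤lo , r≤4lo² = bracket-lower (1≤fromℕ r) i (fromℕ-mono (ℕ.m≤n⇒m≤1+n r≤i))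
        lo²≤p , _ = bracket-sound (0≤density M) i
    in ≤-trans (disc-bound-⊓ r M rank ρ≤r p≤½ (seq (√ (density M)) i) (seq (√ (fromℕ r)) i)
         lo²≤p 1≤lo r≤4lo²) (≤-by ε (<⇒≤ 0<ε) refl)
  where
  c₀ = 1/ₙ 4608
  1≤fromℕ : ∀ r .{{_ : NonZero r}} → 1ℚ ≤ fromℕ r
  1≤fromℕ r = fromℕ-mono {1} {r} (ℕ.>-nonZero⁻¹ r)
  0≤density : .{{_ : NonZero m}} .{{_ : NonZero n}} (M : BinaryMatrix m n) → 0ℚ ≤ density M
  0≤density {m} {n} M = nonNegative⁻¹ (density M)
    {{normalize-nonNeg (ones M) (m ℕ.* n) {{ℕ.m*n≢0 m n}}}}
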